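{- Let $n\in\mathbb{N}$, $n\ge 3$. Let $\mathcal{D}=\{\alpha_1,\ldots,\alpha_m\}$ be a dissection of a convex $n$-gon $P_n$ of type $\{d_1,\ldots,d_m\}$ (where $\alpha_l$ has degree $d_l$), and let $M_{\mathcal{D}}=(m_{ij})_{1\le i,j\le n}$ be the matrix whose entry $m_{ij}$ is the number of walks from vertex $i$ to vertex $j$ around $P_n$. Then the matrix $M_{\mathcal{D}}$ is symmetric, with determinant $$\det M_{\mathcal{D}}=(-1)^{n-1}\prod_{j=1}^m (d_j-1).$$ Furthermore, there are matrices $U,V\in \mathrm{GL}(n,\mathbb{Z})$ with $$U M_{\mathcal{D}} V=\Delta(d_1-1,\ldots,d_m-1,1,\ldots,1).$$
   Context: $P_n$ is a convex $n$-gon ($n\ge3$) with vertices labelled $1,2,\ldots,n$ in counterclockwise order, labels being taken modulo $n$. A dissection $\mathcal{D}$ of $P_n$ is obtained by drawing $m-1$ ($m\ge 1$) pairwise noncrossing diagonals, which cut $P_n$ into $m$ polygons $\alpha_1,\ldots,\alpha_m$, called the pieces of the dissection; one writes $\mathcal{D}=\{\alpha_1,\ldots,\alpha_m\}$. If $\alpha_l$ has $d_l$ vertices, it is called a piece of degree $d_l$; the multiset $\{d_1,\ldots,d_m\}$ is the type of $\mathcal{D}$. For vertices $i,j$, a (counterclockwise) walk from $i$ to $j$ around $P_n$ is a sequence $w=(p_{i+1},p_{i+2},\ldots,p_{j-1})$ of pieces of $\mathcal{D}$, indexed by the vertices strictly between $i$ and $j$ when going counterclockwise from $i$ to $j$ (labels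 modulo $n$), such that: (i) $p_k$ is incident to vertex $k$ (i.e. $k$ is a vertex of $p_k$) for all $k\in\{i+1,\ldots,j-1\}$; (ii) each piece $\alpha\in\mathcal{D}$ of degree $d$ appears at most $d-2$ times among $p_{i+1},\ldots,p_{j-1}$. By convention, for $i=j$ there is no walk from $i$ to $i$; for $j=i+1$ (modulo $n$) the empty sequence is the unique walk from $i$ to $i+1$. $\Delta(a_1,\ldots,a_n)$ denotes the diagonal matrix with diagonal entries $a_1,\ldots,a_n$. -}

module Defs where

open import Algebra.Definitions using (Invertible)
import Algebra.Properties.CommutativeMonoid.Sum as Sum
open import Data.Bool using (if_then_else_)
open import Data.Fin using (Fin; zero; suc; toℕ; fromℕ<; punchIn; _≟_; _≤?_; _<_)
open import Data.Fin.Properties using (all?; nonZeroIndex)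
open import Data.Fin.Subset using (Subset; ⊤; _∩_; _∈_; ∣_∣)
open import Data.Fin.Subset.Properties using (_∈?_)
open import Data.Integer using (ℤ; +_; -1ℤ; 0ℤ; 1ℤ; _*_; _-_; _^_)
open import Data.Integer.Properties using (+-0-commutativeMonoid; *-1-commutativeMonoid)
open import Data.List using (List; []; _∷_; length; filter; foldr; concatMap;
  cartesianProductWith; allFin; lookup)
open import Data.List.Relation.Binary.Permutation.Propositional using (_↭_)
open import Data.List.Relation.Unary.AllPairs using (AllPairs)
open import Data.List.Relation.Unary.Unique.Propositional using (Unique)
open import Data.Nat as ℕ using (ℕ; _+_; _∸_; _%_)
open import Data.Nat.DivMod using (_mod_)
open import Data.Product using (_×_)
open import Data.Sum using (_⊎_)
open import Data.Vec as Vec using (Vec; []; _∷_; count; tabulate)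
open import Data.Vec.Functional using (Vector)
open import Relation.Binary.PropositionalEquality using (_≡_; _≢_)
open import Relation.Nullary using (Dec; yes; no; ¬_; ⌊_⌋; ¬?; _×-dec_; _⊎-dec_)

open Sum +-0-commutativeMonoid public using (sum)
open Sum *-1-commutativeMonoid public using () renaming (sum to product)

Matrix : ℕ → Set
Matrix n = Fin n → Fin n → ℤ

infix 4 _≋_
_≋_ : ∀ {n} → Matrix n → Matrix n → Set
A ≋ B = ∀ i j → A i j ≡ B i j

infixl 7 _⊗_
_⊗_ : ∀ {n} → Matrix n → Matrix n → Matrix n
(A ⊗ B) i j = sum (λ k → A i k * B k j)

Δ : ∀ {n} → Vector ℤ n → Matrix n
Δ a i j = if ⌊ i ≟ j ⌋ then a i else 0ℤ

𝟙 : ∀ {n} → Matrix n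
𝟙 = Δ (λ _ → 1ℤ)

InGL : ∀ {n} → Matrix n → Set
InGL = Invertible _≋_ 𝟙 _⊗_

IsSymmetric : ∀ {n} → Matrix n → Set
IsSymmetric A = ∀ i j → A i j ≡ A j i

-- Laplace expansion along the first row.
det : ∀ {n} → Matrix n → ℤ
det {ℕ.zero}  A = 1ℤ
det {ℕ.suc n} A =
  sum (λ j → -1ℤ ^ toℕ j * A zero j * det (λ i k → A (suc i) (punchIn j k)))

-- P_n is a convex n-gon whose vertices, in counterclockwise order, are
-- the elements of Fin n (so the vertex usually labelled v is the element
-- v - 1).

-- The last field rules out the edge joining the vertices 0 and n - 1.
record Diagonal (n : ℕ) : Set where
  constructor diagonal
  field
    a b          : Fin n
    not-adjacent : ℕ.suc (toℕ a) ℕ.< toℕ b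
    not-closing  : ℕ.suc (toℕ b) ℕ.< toℕ a + n

-- The segments meet in an interior point exactly when their endpoints
-- alternate around the polygon.
Crossing : ∀ {n} → Diagonal n → Diagonal n → Set
Crossing (diagonal a b _ _) (diagonal c d _ _) =
  (a < c × c < b × b < d) ⊎ (c < a × a < d × d < b)

-- A polygon with vertices among those of P_n is given by its vertex set.
Polygon : ℕ → Set
Polygon = Subset

-- Vertices in the two closed half-planes bounded by a diagonal; the
-- endpoints of the diagonal lie in both.
inner outer : ∀ {n} → Diagonal n → Subset n
inner (diagonal a b _ _) = tabulate (λ v → ⌊ (a ≤? v) ×-dec (v ≤? b) ⌋)
outer (diagonal a b _ _) = tabulate (λ v → ⌊ (v ≤? a) ⊎-dec (b ≤? v) ⌋)

-- Parts with fewer than three vertices are degenerate and discarded, so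
-- a polygon lying entirely on one side of the diagonal is left unchanged.
cut : ∀ {n} → Diagonal n → Polygon n → List (Polygon n)
cut d α = filter (λ β → 3 ℕ.≤? ∣ β ∣) (α ∩ inner d ∷ α ∩ outer d ∷ [])

-- The polygons into which P_n (vertex set ⊤) is cut by drawing the given
-- diagonals one after another.
cutAlong : ∀ {n} → List (Diagonal n) → List (Polygon n)
cutAlong = foldr (λ d → concatMap (cut d)) (⊤ ∷ [])

-- A set of diagonals is a list without repetitions.  The labelling
-- α₁, …, α_m of the pieces is arbitrary, hence the permutation.
record Dissection (n : ℕ) : Set where
  field
    diagonals   : List (Diagonal n)
    distinct    : Unique diagonals
    noncrossing : AllPairs (λ d e → ¬ Crossing d e) diagonals
    pieces      : List (Polygon n)
    enumerates  : pieces ↭ cutAlong diagonals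

  m : ℕ
  m = length pieces

  α : Fin m → Polygon n
  α = lookup pieces

  degree : Fin m → ℕ
  degree l = ∣ α l ∣

-- For i ≢ j, the number of vertices strictly between i and j when going
-- counterclockwise from i to j.
between : ∀ {n} → Fin n → Fin n → ℕ
between {n} i j = (toℕ j + n ∸ ℕ.suc (toℕ i)) % n
  where instance _ = nonZeroIndex i

-- ahead i k is the vertex i + 1 + k, modulo n.
ahead : ∀ {n} → Fin n → ℕ → Fin n
ahead {n} i k = (toℕ i + ℕ.suc k) mod n
  where instance _ = nonZeroIndex i

module _ {n : ℕ} (D : Dissection n) where
  open Dissection D

  -- A piece is represented by its index, and p_{i+1+k} by lookup p k.
  IsWalk : (i j : Fin n) → Vec (Fin m) (between i j) → Set
  IsWalk i j p =
      i ≢ j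
    × (∀ k → ahead i (toℕ k) ∈ α (Vec.lookup p k))
    × (∀ l → count (_≟ l) p ℕ.≤ degree l ∸ 2)

  isWalk? : ∀ i j p → Dec (IsWalk i j p)
  isWalk? i j p =
          ¬? (i ≟ j)
    ×-dec all? (λ k → ahead i (toℕ k) ∈? α (Vec.lookup p k))
    ×-dec all? (λ l → count (_≟ l) p ℕ.≤? degree l ∸ 2)

-- Every sequence occurs exactly once, so filtering this list and taking
-- its length counts sequences.
sequences : (m k : ℕ) → List (Vec (Fin m) k)
sequences m ℕ.zero    = [] ∷ []
sequences m (ℕ.suc k) = cartesianProductWith _∷_ (allFin m) (sequences m k)

module _ {n : ℕ} (D : Dissection n) where
  open Dissection D

  numberOfWalks : Fin n → Fin n → ℕ
  numberOfWalks i j = length (filter (isWalk? D i j) (sequences m (between i j)))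

  walkMatrix : Matrix n
  walkMatrix i j = + numberOfWalks i j

  degree-1 : Fin m → ℤ
  degree-1 l = + degree l - 1ℤ

  -- The n entries d₁ - 1, …, d_m - 1, 1, …, 1; there is room for all of
  -- the first m since n = 2 + Σ (d_l - 2) ≥ 2 + m.
  diagonalEntries : Vector ℤ n
  diagonalEntries i with toℕ i ℕ.<? m
  ... | yes i<m = degree-1 (fromℕ< i<m)
  ... | no  _   = 1ℤ

{-# OPTIONS --safe #-}
module Submission where

-- Write α for the pieces and d_α for their degrees.  A walk from i to j is a
-- way to write the open arc from i to j as a disjoint union of sets Y_α ⊆ α
-- with |Y_α| ≤ d_α - 2, so walks are counted by a convolution product over
-- the pieces.  Since the capacities d_α - 2 add up to n - 2, cutting along a
-- diagonal a b gives the Ptolemy relation m_ij = m_ia m_bj + m_ib m_aj for i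
-- and j on different sides, and leaves m_ij unchanged for i and j on the same
-- side.  Hence M is symmetric by induction on the number of diagonals.
--
-- Every vertex v other than 0 and n - 1 is strictly between the smallest
-- vertex l and the largest vertex r of exactly one piece.  Replacing row v by
-- row v - row l - row r, and likewise for columns, turns M into a block
-- diagonal matrix, with a block (0 1; 1 0) at the vertices 0 and n - 1, and a
-- block with entries - 1 - δ for each piece, indexed by the d - 2 vertices
-- belonging to it.  Elementary operations within a block leave ±1 and a
-- single entry -(d - 1) on the diagonal.

-- The capacity total enters as a bound: a set of vertices of a sub-polygon S that decomposes has at
-- most |S| - 2 elements. A walk with both ends on one side of a chord that passes the whole other
-- side therefore has no capacity to spare there, and the other side is filled in exactly one way,
-- because symmetry equates this count with that of the empty walk along the chord. So symmetry is
-- needed inside the induction and is not only its outcome.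
--
-- Both kinds of block have the form η - δ, with η = 1 at the vertices 0 and n - 1 and η = -1 for a
-- piece. A block of size k yields the entry η k - 1 once and -1 otherwise, so only vertex 0 gets a
-- positive entry, namely 1, and the other n - 1 vertices account for the sign of the determinant.
--
-- The list of cuts is rearranged into a binary tree, so that the induction can split along one
-- chord. The eliminations are products of matrices 1 + X of determinant 1, which serve the
-- determinant and the normal form at once. The many case distinctions on cyclic order are
-- statements about at most five numbers and are settled by a finite check.

open import Defs

-- Finite sums of integers

module Sums where
  open import Data.Fin using (zero; suc)
  open import Data.Integer using (ℤ; 0ℤ; _+_; _*_)
  open import Data.Integer.Properties hiding (_≟_)
  open import Data.Nat using (zero; suc)
  open import Data.Vec.Functional using (Vector)
  open import Function using (_∘_)
  open import Relation.Binary.PropositionalEquality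
  import Algebra.Properties.CommutativeMonoid.Sum as CMSum
  import Algebra.Properties.Semiring.Sum as SSum
  open CMSum +-0-commutativeMonoid public using (sum-cong-≗; ∑-distrib-+; ∑-comm)
  open CMSum *-1-commutativeMonoid public using () renaming (sum-cong-≗ to product-cong)
  open SSum +-*-semiring public using (*-distribˡ-sum; *-distribʳ-sum)

  sum-zero : ∀ {n} {f : Vector ℤ n} → (∀ k → f k ≡ 0ℤ) → sum f ≡ 0ℤ
  sum-zero {zero}  f≡0 = refl
  sum-zero {suc n} f≡0 = cong₂ _+_ (f≡0 zero) (sum-zero (f≡0 ∘ suc))

  sum-single : ∀ {n} (f : Vector ℤ n) j → (∀ k → k ≢ j → f k ≡ 0ℤ) → sum f ≡ f j
  sum-single {suc n} f zero    f≡0 =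
    trans (cong (f zero +_) (sum-zero λ k → f≡0 (suc k) λ ())) (+-identityʳ _)
  sum-single {suc n} f (suc j) f≡0 =
    trans (cong₂ _+_ (f≡0 zero λ ()) (sum-single (f ∘ suc) j λ k k≢j → f≡0 (suc k) λ { refl → k≢j refl }))
          (+-identityˡ _)

  sum-linear : ∀ {n} (f g : Vector ℤ n) t → sum (λ k → f k + t * g k) ≡ sum f + t * sum g
  sum-linear f g t = trans (∑-distrib-+ f _) (cong (sum f +_) (sym (*-distribˡ-sum t g)))

-- Matrix algebra up to entrywise equality

module Matrices where
  open import Data.Fin using (Fin; _≟_)
  open import Data.Integer using (ℤ; 0ℤ; _*_)
  open import Data.Integer.Properties hiding (_≟_)
  open import Data.Vec.Functional using (Vector)
  open import Relation.Binary.PropositionalEquality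
  open import Relation.Nullary using (yes; no; contradiction)
  open Sums

  Δ-diagonal : ∀ {n} (a : Vector ℤ n) i → Δ a i i ≡ a i
  Δ-diagonal a i with i ≟ i
  ... | yes _  = refl
  ... | no i≢i = contradiction refl i≢i

  Δ-off-diagonal : ∀ {n} (a : Vector ℤ n) {i j} → i ≢ j → Δ a i j ≡ 0ℤ
  Δ-off-diagonal a {i} {j} i≢j with i ≟ j
  ... | yes i≡j = contradiction i≡j i≢j
  ... | no _    = refl

  𝟙-sym : ∀ {n} (i j : Fin n) → 𝟙 i j ≡ 𝟙 j i
  𝟙-sym i j with i ≟ j
  ... | yes refl = sym (Δ-diagonal _ i)
  ... | no i≢j   = sym (Δ-off-diagonal _ (≢-sym i≢j))

  sum-𝟙ˡ : ∀ {n} (f : Vector ℤ n) j → sum (λ k → 𝟙 j k * f k) ≡ f j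
  sum-𝟙ˡ f j = trans
    (sum-single _ j λ k k≢j → trans (cong (_* f k) (Δ-off-diagonal _ (≢-sym k≢j))) (*-zeroˡ (f k)))
    (trans (cong (_* f j) (Δ-diagonal _ j)) (*-identityˡ _))

  sum-𝟙ʳ : ∀ {n} (f : Vector ℤ n) j → sum (λ k → f k * 𝟙 k j) ≡ f j
  sum-𝟙ʳ f j = trans (sum-cong-≗ λ k → trans (*-comm (f k) _) (cong (_* f k) (𝟙-sym k j))) (sum-𝟙ˡ f j)

  infix 9 _ᵀ
  _ᵀ : ∀ {n} → Matrix n → Matrix n
  (A ᵀ) i j = A j i

  ≋-refl : ∀ {n} {A : Matrix n} → A ≋ A
  ≋-refl i j = refl

  ≋-sym : ∀ {n} {A B : Matrix n} → A ≋ B → B ≋ A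
  ≋-sym p i j = sym (p i j)

  ≋-trans : ∀ {n} {A B C : Matrix n} → A ≋ B → B ≋ C → A ≋ C
  ≋-trans p q i j = trans (p i j) (q i j)

  ⊗-cong : ∀ {n} {A A′ B B′ : Matrix n} → A ≋ A′ → B ≋ B′ → A ⊗ B ≋ A′ ⊗ B′
  ⊗-cong p q i j = sum-cong-≗ λ k → cong₂ _*_ (p i k) (q k j)

  ⊗-identityˡ : ∀ {n} (A : Matrix n) → 𝟙 ⊗ A ≋ A
  ⊗-identityˡ A i j = sum-𝟙ˡ (λ k → A k j) i

  ⊗-identityʳ : ∀ {n} (A : Matrix n) → A ⊗ 𝟙 ≋ A
  ⊗-identityʳ A i j = sum-𝟙ʳ (A i) j

  ⊗-assoc : ∀ {n} (A B C : Matrix n) → A ⊗ B ⊗ C ≋ A ⊗ (B ⊗ C)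
  ⊗-assoc A B C i j = begin
    sum (λ k → sum (λ l → A i l * B l k) * C k j)    ≡⟨ sum-cong-≗ (λ k → *-distribʳ-sum (C k j) (λ l → A i l * B l k)) ⟩
    sum (λ k → sum (λ l → A i l * B l k * C k j))    ≡⟨ ∑-comm (λ k l → A i l * B l k * C k j) ⟩
    sum (λ l → sum (λ k → A i l * B l k * C k j))    ≡⟨ sum-cong-≗ (λ l → sum-cong-≗ λ k → *-assoc (A i l) (B l k) (C k j)) ⟩
    sum (λ l → sum (λ k → A i l * (B l k * C k j)))  ≡⟨ sum-cong-≗ (λ l → *-distribˡ-sum (A i l) (λ k → B l k * C k j)) ⟨
    sum (λ l → A i l * sum (λ k → B l k * C k j))    ∎
    where open ≡-Reasoning

-- Alternating functionals and multiplicativity of the determinant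

module Determinants where
  open import Data.Fin using (Fin; zero; suc; toℕ; punchIn; punchOut; _<_; _≟_)
  open import Data.Fin.Properties using (punchIn-punchOut; punchInᵢ≢i; punchIn-injective)
  open import Data.Integer using (ℤ; 0ℤ; 1ℤ; -1ℤ; _+_; _*_; -_; _^_)
  open import Data.Integer.Properties hiding (_≟_)
  open import Data.Integer.Tactic.RingSolver using (solve-∀)
  open import Data.Nat using (ℕ; zero; suc; z<s; s<s)
  import Data.Nat.Properties as ℕ
  open import Data.Vec.Functional using (Vector; _∷_; removeAt; head; tail)
  open import Function using (_∘_)
  open import Relation.Binary.PropositionalEquality hiding ([_])
  open import Relation.Nullary using (yes; no; contradiction)
  open Sums
  open Matrices

  private variable k n : ℕ

  -- Laplace expansion treats equal neighbouring columns directly: deleting a third column keeps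
  -- them neighbours, and deleting either of the two leaves the same minor, with opposite sign. For
  -- columns further apart, `swap-heads` moves one past the others.
  data Adjacent : Fin n → Fin n → Set where
    base : Adjacent {suc (suc n)} zero (suc zero)
    step : ∀ {i j : Fin n} → Adjacent i j → Adjacent (suc i) (suc j)

  -- Linearity relates three column lists which agree outside position j, so
  -- that no updates appear.
  record Alternating (f : (Fin n → Vector ℤ k) → ℤ) : Set where
    field
      respects    : ∀ {c d} → (∀ j i → c j i ≡ d j i) → f c ≡ f d
      linear      : ∀ j t {c d e} →
                    (∀ l → l ≢ j → ∀ i → c l i ≡ e l i) →
                    (∀ l → l ≢ j → ∀ i → d l i ≡ e l i) →
                    (∀ i → e j i ≡ c j i + t * d j i) →
                    f e ≡ f c + t * f d
      alternating : ∀ {j l c} → Adjacent j l → (∀ i → c j i ≡ c l i) → f c ≡ 0ℤ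

  open Alternating

  private
    cong-∷ : ∀ {x y : Vector ℤ k} {c d : Fin n → Vector ℤ k} →
             (∀ i → x i ≡ y i) → (∀ j i → c j i ≡ d j i) → ∀ j i → (x ∷ c) j i ≡ (y ∷ d) j i
    cong-∷ p q zero    = p
    cong-∷ p q (suc j) = q j

    η-∷ : ∀ (c : Fin (suc n) → Vector ℤ k) → ∀ j i → c j i ≡ (head c ∷ tail c) j i
    η-∷ c zero    i = refl
    η-∷ c (suc j) i = refl

  fix-head : ∀ {f : (Fin (suc n) → Vector ℤ k) → ℤ} → Alternating f → ∀ x → Alternating (f ∘ (x ∷_))
  fix-head alt x .respects p = alt .respects (cong-∷ (λ _ → refl) p)
  fix-head alt x .linear j t p q r = alt .linear (suc j) t
    (λ { zero _ i → refl ; (suc l) l≢j → p l (l≢j ∘ cong suc) })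
    (λ { zero _ i → refl ; (suc l) l≢j → q l (l≢j ∘ cong suc) }) r
  fix-head alt x .alternating adj = alt .alternating (step adj)

  linear-head : ∀ {f : (Fin (suc n) → Vector ℤ k) → ℤ} → Alternating f → ∀ t {x y z} c →
                (∀ i → z i ≡ x i + t * y i) → f (z ∷ c) ≡ f (x ∷ c) + t * f (y ∷ c)
  linear-head alt t c = alt .linear zero t
    (λ { zero 0≢0 → contradiction refl 0≢0 ; (suc l) _ i → refl })
    (λ { zero 0≢0 → contradiction refl 0≢0 ; (suc l) _ i → refl })

  equal-heads : ∀ {f : (Fin (suc (suc n)) → Vector ℤ k) → ℤ} → Alternating f → ∀ x c → f (x ∷ x ∷ c) ≡ 0ℤ
  equal-heads alt x c = alt .alternating base (λ i → refl)

  -- Polarisation: the value at equal first columns x + y is zero, and so are two of the four terms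
  -- of its expansion.
  swap-heads : ∀ {f : (Fin (suc (suc n)) → Vector ℤ k) → ℤ} → Alternating f →
               ∀ x y c → f (x ∷ y ∷ c) ≡ - f (y ∷ x ∷ c)
  swap-heads {f = f} alt x y c = solution (begin
    0ℤ                                                    ≡⟨ equal-heads alt s c ⟨
    f (s ∷ s ∷ c)                                         ≡⟨ linear-head alt 1ℤ (s ∷ c) (λ i → refl) ⟩
    f (x ∷ s ∷ c) + 1ℤ * f (y ∷ s ∷ c)
      ≡⟨ cong₂ (λ a b → a + 1ℤ * b) (linear-head (fix-head alt x) 1ℤ c (λ i → refl))
                                    (linear-head (fix-head alt y) 1ℤ c (λ i → refl)) ⟩
    (f (x ∷ x ∷ c) + 1ℤ * f (x ∷ y ∷ c)) + 1ℤ * (f (y ∷ x ∷ c) + 1ℤ * f (y ∷ y ∷ c))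
      ≡⟨ cong₂ (λ a b → (a + 1ℤ * f (x ∷ y ∷ c)) + 1ℤ * (f (y ∷ x ∷ c) + 1ℤ * b))
               (equal-heads alt x c) (equal-heads alt y c) ⟩
    (0ℤ + 1ℤ * f (x ∷ y ∷ c)) + 1ℤ * (f (y ∷ x ∷ c) + 1ℤ * 0ℤ) ∎)
    where
    open ≡-Reasoning
    s : Vector ℤ _
    s i = x i + 1ℤ * y i
    rearrange : ∀ a b → a ≡ ((0ℤ + 1ℤ * a) + 1ℤ * (b + 1ℤ * 0ℤ)) + - b
    rearrange = solve-∀
    solution : ∀ {a b} → 0ℤ ≡ (0ℤ + 1ℤ * a) + 1ℤ * (b + 1ℤ * 0ℤ) → a ≡ - b
    solution {a} {b} eq = trans (rearrange a b) (trans (cong (_+ - b) (sym eq)) (+-identityˡ _))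

  -- Only neighbours cancel, so the multiple is removed from the second column first; x is then
  -- swapped past that column, which puts it at the head of the remaining ones for the recursive
  -- call, and swapped back.
  add-multiples-of-head : ∀ {f : (Fin (suc n) → Vector ℤ k) → ℤ} → Alternating f →
    ∀ x (t : Vector ℤ n) {c d} → (∀ j i → d j i ≡ c j i + t j * x i) → f (x ∷ d) ≡ f (x ∷ c)
  add-multiples-of-head {zero}  alt x t p = alt .respects λ { zero i → refl }
  add-multiples-of-head {suc n} {f = f} alt x t {c} {d} p = begin
    f (x ∷ d)                                             ≡⟨ fix-head alt x .respects (η-∷ d) ⟩
    f (x ∷ d zero ∷ tail d)
      ≡⟨ linear-head (fix-head alt x) (t zero) (tail d) (p zero) ⟩
    f (x ∷ c zero ∷ tail d) + t zero * f (x ∷ x ∷ tail d)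
      ≡⟨ cong (λ a → f (x ∷ c zero ∷ tail d) + t zero * a) (equal-heads alt x (tail d)) ⟩
    f (x ∷ c zero ∷ tail d) + t zero * 0ℤ                 ≡⟨ drop (f (x ∷ c zero ∷ tail d)) (t zero) ⟩
    f (x ∷ c zero ∷ tail d)                               ≡⟨ swap-heads alt x (c zero) (tail d) ⟩
    - f (c zero ∷ x ∷ tail d)
      ≡⟨ cong -_ (add-multiples-of-head (fix-head alt (c zero)) x (tail t) (p ∘ suc)) ⟩
    - f (c zero ∷ x ∷ tail c)                             ≡⟨ swap-heads alt x (c zero) (tail c) ⟨
    f (x ∷ c zero ∷ tail c)                               ≡⟨ fix-head alt x .respects (η-∷ c) ⟨
    f (x ∷ c)                                             ∎
    where
    open ≡-Reasoning
    drop : ∀ a b → a + b * 0ℤ ≡ a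
    drop = solve-∀

  -- Since x = 0 = x + (-1) x, linearity equates the value with its difference from itself.
  zero-head : ∀ {f : (Fin (suc n) → Vector ℤ k) → ℤ} → Alternating f → ∀ {x} c →
              (∀ i → x i ≡ 0ℤ) → f (x ∷ c) ≡ 0ℤ
  zero-head {f = f} alt {x} c x≡0 = trans (linear-head alt -1ℤ c λ i → trans (x≡0 i) (sym (cancel i)))
                                        (cancels (f (x ∷ c)))
    where
    cancels : ∀ a → a + -1ℤ * a ≡ 0ℤ
    cancels = solve-∀
    cancel : ∀ i → x i + -1ℤ * x i ≡ 0ℤ
    cancel i = cancels (x i)

  linear-sum : ∀ {m} {f : (Fin (suc n) → Vector ℤ k) → ℤ} → Alternating f →
    ∀ (t : Vector ℤ m) (v : Fin m → Vector ℤ k) {x} c →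
    (∀ i → x i ≡ sum (λ l → t l * v l i)) → f (x ∷ c) ≡ sum (λ l → t l * f (v l ∷ c))
  linear-sum {m = zero}  alt t v c eq = zero-head alt c eq
  linear-sum {m = suc m} {f} alt t v {x} c eq = begin
    f (x ∷ c)                                                    ≡⟨ linear-head alt (t zero) c (λ i → trans (eq i) (+-comm _ (rest i))) ⟩
    f (rest ∷ c) + t zero * f (v zero ∷ c)                       ≡⟨ +-comm _ (t zero * f (v zero ∷ c)) ⟩
    t zero * f (v zero ∷ c) + f (rest ∷ c)                       ≡⟨ cong (t zero * f (v zero ∷ c) +_)
                                                                      (linear-sum alt (tail t) (tail v) c λ i → refl) ⟩
    t zero * f (v zero ∷ c) + sum (λ l → t (suc l) * f (v (suc l) ∷ c)) ∎
    where
    open ≡-Reasoning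
    rest : Vector ℤ _
    rest i = sum (λ l → t (suc l) * v (suc l) i)

  -- Carrying only the vanishing of the value, not the value itself, avoids keeping the sign of the
  -- cyclic shift.
  move-to-front : ∀ {f : (Fin (suc n) → Vector ℤ k) → ℤ} → Alternating f → ∀ c i →
                  f c ≡ 0ℤ → f (c i ∷ removeAt c i) ≡ 0ℤ
  move-to-front alt c zero fc≡0 = trans (sym (alt .respects (η-∷ c))) fc≡0
  move-to-front {suc n} {f = f} alt c (suc i) fc≡0 = begin
    f (c (suc i) ∷ removeAt c (suc i))
      ≡⟨ alt .respects (cong-∷ (λ _ → refl) (η-∷ (removeAt c (suc i)))) ⟩
    f (c (suc i) ∷ c zero ∷ removeAt (tail c) i)
      ≡⟨ swap-heads alt (c (suc i)) (c zero) (removeAt (tail c) i) ⟩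
    - f (c zero ∷ c (suc i) ∷ removeAt (tail c) i)
      ≡⟨ cong -_ (move-to-front (fix-head alt (c zero)) (tail c) i (trans (sym (alt .respects (η-∷ c))) fc≡0)) ⟩
    0ℤ ∎
    where open ≡-Reasoning

  private
    -- Embeds columns of length n as those of length n + 1 with 0 at position i, so that an
    -- alternating functional in dimension n + 1 with first column `𝟙 i` restricts to one in
    -- dimension n.
    pad : Fin (suc n) → Vector ℤ n → Vector ℤ (suc n)
    pad i x l with i ≟ l
    ... | yes _  = 0ℤ
    ... | no i≢l = x (punchOut i≢l)

    pad-linear : ∀ (i : Fin (suc n)) t {x y z} → (∀ l → z l ≡ x l + t * y l) →
                 ∀ l → pad i z l ≡ pad i x l + t * pad i y l
    pad-linear i t p l with i ≟ l
    ... | yes _  = sym (trans (+-identityˡ _) (*-zeroʳ t))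
    ... | no i≢l = p (punchOut i≢l)

    pad-cong : ∀ (i : Fin (suc n)) {x y} → (∀ l → x l ≡ y l) → ∀ l → pad i x l ≡ pad i y l
    pad-cong i p l with i ≟ l
    ... | yes _  = refl
    ... | no i≢l = p (punchOut i≢l)

    pad-𝟙 : ∀ (i : Fin (suc n)) j l → 𝟙 (punchIn i j) l ≡ pad i (𝟙 j) l
    pad-𝟙 i j l with i ≟ l
    ... | yes refl = Δ-off-diagonal _ (punchInᵢ≢i i j)
    ... | no i≢l with j ≟ punchOut i≢l
    ...   | yes refl = trans (cong (λ a → 𝟙 a l) (punchIn-punchOut i≢l)) (Δ-diagonal _ l)
    ...   | no j≢    = Δ-off-diagonal _ λ eq → j≢ (punchIn-injective i _ _ (trans eq (sym (punchIn-punchOut i≢l))))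

  -- Uniqueness of the determinant form, by induction on the dimension. The first column is expanded
  -- in unit vectors; against `𝟙 i` the i-th coordinates of the other columns can be cleared by
  -- adding multiples, and what is left is an alternating functional of columns one shorter.
  vanishes : ∀ {f : (Fin n → Vector ℤ n) → ℤ} → Alternating f → f 𝟙 ≡ 0ℤ → ∀ c → f c ≡ 0ℤ
  vanishes {zero}  alt f𝟙≡0 c = trans (alt .respects λ ()) f𝟙≡0
  vanishes {suc n} {f} alt f𝟙≡0 c = begin
    f c                                              ≡⟨ alt .respects (η-∷ c) ⟩
    f (c zero ∷ tail c)                              ≡⟨ linear-sum alt (c zero) 𝟙 (tail c) (λ i → sym (sum-𝟙ʳ (c zero) i)) ⟩
    sum (λ i → c zero i * f (𝟙 i ∷ tail c))          ≡⟨ sum-zero (λ i → trans (cong (c zero i *_) (unit-head i)) (*-zeroʳ (c zero i))) ⟩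
    0ℤ                                               ∎
    where
    open ≡-Reasoning
    minor : ∀ i → Alternating (λ d → f (𝟙 i ∷ (pad i ∘ d)))
    minor i .respects p = fix-head alt (𝟙 i) .respects λ j → pad-cong i (p j)
    minor i .linear j t p q r = fix-head alt (𝟙 i) .linear j t
      (λ l l≢j → pad-cong i (p l l≢j)) (λ l l≢j → pad-cong i (q l l≢j)) (pad-linear i t r)
    minor i .alternating adj p = fix-head alt (𝟙 i) .alternating adj (pad-cong i p)

    cancel : ∀ a → 0ℤ ≡ a + - a * 1ℤ
    cancel = solve-∀
    drop : ∀ a b → a ≡ a + - b * 0ℤ
    drop = solve-∀

    clear : ∀ i j l → pad i (c (suc j) ∘ punchIn i) l ≡ c (suc j) l + - c (suc j) i * 𝟙 i l
    clear i j l with i ≟ l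
    ... | yes refl = cancel (c (suc j) i)
    ... | no i≢l = trans (cong (c (suc j)) (punchIn-punchOut i≢l)) (drop (c (suc j) l) (c (suc j) i))

    unit-head : ∀ i → f (𝟙 i ∷ tail c) ≡ 0ℤ
    unit-head i = begin
      f (𝟙 i ∷ tail c)                                        ≡⟨ add-multiples-of-head alt (𝟙 i) (λ j → - c (suc j) i) (clear i) ⟨
      f (𝟙 i ∷ (λ j → pad i (c (suc j) ∘ punchIn i)))         ≡⟨ vanishes (minor i) f-minor-𝟙 (λ j → c (suc j) ∘ punchIn i) ⟩
      0ℤ                                                      ∎
      where
      f-minor-𝟙 : f (𝟙 i ∷ (pad i ∘ 𝟙)) ≡ 0ℤ
      f-minor-𝟙 = trans (sym (fix-head alt (𝟙 i) .respects (pad-𝟙 i))) (move-to-front alt 𝟙 i f𝟙≡0)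

  det-cong : ∀ {A B : Matrix n} → A ≋ B → det A ≡ det B
  det-cong {zero}  p = refl
  det-cong {suc n} p = sum-cong-≗ λ j →
    cong₂ (λ a b → -1ℤ ^ toℕ j * a * b) (p zero j) (det-cong λ i l → p (suc i) (punchIn j l))

  private
    punchOut-adjacent : ∀ {i j l : Fin (suc n)} (i≢j : i ≢ j) (i≢l : i ≢ l) →
                        Adjacent j l → Adjacent (punchOut i≢j) (punchOut i≢l)
    punchOut-adjacent {i = zero}          i≢j i≢l base       = contradiction refl i≢j
    punchOut-adjacent {i = suc zero}      i≢j i≢l base       = contradiction refl i≢l
    punchOut-adjacent {suc (suc n)} {i = suc (suc i)} i≢j i≢l base       = base
    punchOut-adjacent {i = zero}          i≢j i≢l (step adj) = adj
    punchOut-adjacent {suc n} {i = suc i} i≢j i≢l (step adj) = step (punchOut-adjacent {i = i} (i≢j ∘ cong suc) (i≢l ∘ cong suc) adj)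

    punchIn-adjacent : ∀ {a} {A : Set a} {j l : Fin (suc n)} (c : Fin (suc n) → A) →
                       Adjacent j l → c j ≡ c l → ∀ x → c (punchIn j x) ≡ c (punchIn l x)
    punchIn-adjacent c base       eq zero    = sym eq
    punchIn-adjacent c base       eq (suc x) = refl
    punchIn-adjacent c (step adj) eq zero    = refl
    punchIn-adjacent c (step adj) eq (suc x) = punchIn-adjacent (c ∘ suc) adj eq x

    sum-adjacent : ∀ {j l : Fin n} (f : Vector ℤ n) → Adjacent j l →
                   (∀ x → x ≢ j → x ≢ l → f x ≡ 0ℤ) → sum f ≡ f j + f l
    sum-adjacent f base f≡0 =
      cong (f zero +_) (trans (cong (f (suc zero) +_) (sum-zero λ x → f≡0 (suc (suc x)) (λ ()) λ ())) (+-identityʳ _))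
    sum-adjacent f (step adj) f≡0 = trans
      (cong₂ _+_ (f≡0 zero (λ ()) λ ())
        (sum-adjacent (f ∘ suc) adj λ x x≢j x≢l → f≡0 (suc x) (λ { refl → x≢j refl }) (λ { refl → x≢l refl })))
      (+-identityˡ _)

    sign-adjacent : ∀ {j l : Fin n} → Adjacent j l → -1ℤ ^ toℕ l ≡ - (-1ℤ ^ toℕ j)
    sign-adjacent base       = refl
    sign-adjacent (step adj) = trans (cong (-1ℤ *_) (sign-adjacent adj)) (sym (neg-distribʳ-* -1ℤ _))

  det-linear : ∀ j t {A B C : Matrix n} →
               (∀ l → l ≢ j → ∀ i → A i l ≡ C i l) →
               (∀ l → l ≢ j → ∀ i → B i l ≡ C i l) →
               (∀ i → C i j ≡ A i j + t * B i j) →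
               det C ≡ det A + t * det B
  det-linear {suc n} j t {A} {B} {C} p q r =
    trans (sum-cong-≗ expand) (sum-linear (term A) (term B) t)
    where
    minor : Matrix (suc n) → Fin (suc n) → Matrix n
    minor M l i x = M (suc i) (punchIn l x)
    term : Matrix (suc n) → Fin (suc n) → ℤ
    term M l = -1ℤ ^ toℕ l * M zero l * det (minor M l)
    ring₁ : ∀ s a b t d → s * (a + t * b) * d ≡ s * a * d + t * (s * b * d)
    ring₁ = solve-∀
    ring₂ : ∀ s a d t e → s * a * (d + t * e) ≡ s * a * d + t * (s * a * e)
    ring₂ = solve-∀
    away : ∀ {l x} (l≢j : l ≢ j) → x ≢ punchOut l≢j → punchIn l x ≢ j
    away {l} l≢j x≢ eq = x≢ (punchIn-injective l _ _ (trans eq (sym (punchIn-punchOut l≢j))))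
    expand : ∀ l → term C l ≡ term A l + t * term B l
    expand l with l ≟ j
    -- The deleted column is the varying one: the three minors coincide, and linearity is that of
    -- the first-row entry. Otherwise the entries coincide and the minors are related by induction.
    ... | yes refl
      rewrite r zero
        | det-cong {A = minor C l} {minor A l} (λ i x → sym (p (punchIn l x) (punchInᵢ≢i l x) (suc i)))
        | det-cong {A = minor B l} {minor A l}
            (λ i x → trans (q (punchIn l x) (punchInᵢ≢i l x) (suc i)) (sym (p (punchIn l x) (punchInᵢ≢i l x) (suc i))))
      = ring₁ (-1ℤ ^ toℕ l) (A zero l) (B zero l) t (det (minor A l))
    ... | no l≢j
      rewrite p l l≢j zero | q l l≢j zero
        | det-linear (punchOut l≢j) t {minor A l} {minor B l} {minor C l}
            (λ x x≢ i → p (punchIn l x) (away l≢j x≢) (suc i))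
            (λ x x≢ i → q (punchIn l x) (away l≢j x≢) (suc i))
            (λ i → trans (cong (C (suc i)) (punchIn-punchOut l≢j))
                     (trans (r (suc i)) (cong (λ x → A (suc i) x + t * B (suc i) x) (sym (punchIn-punchOut l≢j)))))
      = ring₂ (-1ℤ ^ toℕ l) (C zero l) (det (minor A l)) t (det (minor B l))
  det-alternating : ∀ {j l} {A : Matrix n} → Adjacent j l → (∀ i → A i j ≡ A i l) → det A ≡ 0ℤ
  det-alternating {suc n} {j} {l} {A} adj eq = begin
    det A            ≡⟨ sum-adjacent term adj others ⟩
    term j + term l  ≡⟨ cong (term j +_) (cong₂ _*_ (cong₂ _*_ (sign-adjacent adj) (sym (eq zero)))
                          (det-cong λ i x → sym (punchIn-adjacent (A (suc i)) adj (eq (suc i)) x))) ⟩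
    s * A zero j * d + - s * A zero j * d  ≡⟨ cancel s (A zero j) d ⟩
    0ℤ               ∎
    where
    open ≡-Reasoning
    s = -1ℤ ^ toℕ j
    minor : Fin (suc n) → Matrix n
    minor x i y = A (suc i) (punchIn x y)
    term : Fin (suc n) → ℤ
    term x = -1ℤ ^ toℕ x * A zero x * det (minor x)
    d = det (minor j)
    cancel : ∀ s a d → s * a * d + - s * a * d ≡ 0ℤ
    cancel = solve-∀
    others : ∀ x → x ≢ j → x ≢ l → term x ≡ 0ℤ
    others x x≢j x≢l = trans
      (cong (-1ℤ ^ toℕ x * A zero x *_) (det-alternating (punchOut-adjacent x≢j x≢l adj)
        λ i → trans (cong (A (suc i)) (punchIn-punchOut x≢j))
                (trans (eq (suc i)) (cong (A (suc i)) (sym (punchIn-punchOut x≢l))))))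
      (*-zeroʳ (-1ℤ ^ toℕ x * A zero x))

  private
    minor-det first-row-term : Matrix (suc n) → Fin (suc n) → ℤ
    minor-det A j = det (λ i x → A (suc i) (punchIn j x))
    first-row-term A j = -1ℤ ^ toℕ j * A zero j * minor-det A j

  det-lower : (A : Matrix n) → (∀ i j → i < j → A i j ≡ 0ℤ) → det A ≡ product (λ i → A i i)
  det-lower {zero}  A p = refl
  det-lower {suc n} A p = trans
    (sum-single (first-row-term A) zero
      λ { zero 0≢0 → contradiction refl 0≢0
        ; (suc j) _ → trans (cong (λ a → -1ℤ ^ toℕ (suc j) * a * minor-det A (suc j)) (p zero (suc j) z<s))
                            (ring (-1ℤ ^ toℕ (suc j)) (minor-det A (suc j))) })
    (cong₂ _*_ (*-identityˡ (A zero zero)) (det-lower (λ i j → A (suc i) (suc j)) λ i j i<j → p (suc i) (suc j) (s<s i<j)))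
    where
    ring : ∀ s d → s * 0ℤ * d ≡ 0ℤ
    ring = solve-∀

  det-zero-column : (A : Matrix (suc n)) → (∀ i → A i zero ≡ 0ℤ) → det A ≡ 0ℤ
  det-zero-column A p = trans
    (det-linear zero -1ℤ {A} {A} {A} (λ _ _ _ → refl) (λ _ _ _ → refl) (λ i → trans (p i) (sym (cong (λ a → a + -1ℤ * a) (p i)))))
    (cancels (det A))
    where
    cancels : ∀ a → a + -1ℤ * a ≡ 0ℤ
    cancels = solve-∀

  -- Expansion along the first row suits this triangular case too: every minor but the first has a
  -- zero first column.
  det-upper : (A : Matrix n) → (∀ i j → j < i → A i j ≡ 0ℤ) → det A ≡ product (λ i → A i i)
  det-upper {zero}  A p = refl
  det-upper {suc n} A p = trans
    (sum-single (first-row-term A) zero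
      λ { zero 0≢0 → contradiction refl 0≢0
        ; (suc j) _ → trans (cong (-1ℤ ^ toℕ (suc j) * A zero (suc j) *_) (minor-zero A p j))
                            (*-zeroʳ (-1ℤ ^ toℕ (suc j) * A zero (suc j))) })
    (cong₂ _*_ (*-identityˡ (A zero zero)) (det-upper (λ i j → A (suc i) (suc j)) λ i j i<j → p (suc i) (suc j) (s<s i<j)))
    where
    minor-zero : ∀ {n} (A : Matrix (suc n)) → (∀ i j → j < i → A i j ≡ 0ℤ) → ∀ (j : Fin n) →
                 det (λ i x → A (suc i) (punchIn (suc j) x)) ≡ 0ℤ
    minor-zero {suc n} A p j = det-zero-column (λ i x → A (suc i) (punchIn (suc j) x)) λ i → p (suc i) zero z<s

  det-Δ : (a : Vector ℤ n) → det (Δ a) ≡ product a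
  det-Δ a = trans (det-lower (Δ a) λ i j i<j → Δ-off-diagonal a λ { refl → ℕ.<-irrefl refl i<j })
                  (product-cong λ i → Δ-diagonal a i)

  det-𝟙 : det (𝟙 {n}) ≡ 1ℤ
  det-𝟙 {n} = trans (det-Δ {n} _) (product-one n)
    where
    product-one : ∀ n → product {n} (λ _ → 1ℤ) ≡ 1ℤ
    product-one zero    = refl
    product-one (suc n) = trans (*-identityˡ _) (product-one n)

  -- Both sides are alternating functionals of the columns of B.
  det-⊗ : (A B : Matrix n) → det (A ⊗ B) ≡ det A * det B
  det-⊗ {n} A B = solution _ _ (vanishes alt base-case (B ᵀ))
    where
    f : (Fin n → Vector ℤ n) → ℤ
    f c = det (A ⊗ c ᵀ) + - det A * det (c ᵀ)
    ring₁ : ∀ x y t a u v → (x + t * y) + - a * (u + t * v) ≡ (x + - a * u) + t * (y + - a * v)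
    ring₁ = solve-∀
    ring₂ : ∀ a b t c → a * (b + t * c) ≡ a * b + t * (a * c)
    ring₂ = solve-∀
    ring₃ : ∀ a → a + - a * 1ℤ ≡ 0ℤ
    ring₃ = solve-∀
    ring₄ : ∀ a → 0ℤ + - a * 0ℤ ≡ 0ℤ
    ring₄ = solve-∀
    ring₅ : ∀ x a b → x ≡ (x + - a * b) + a * b
    ring₅ = solve-∀
    solution : ∀ x b → x + - det A * b ≡ 0ℤ → x ≡ det A * b
    solution x b eq = trans (ring₅ x (det A) b) (trans (cong (_+ det A * b) eq) (+-identityˡ _))
    alt : Alternating f
    alt .respects p = cong₂ (λ x y → x + - det A * y)
      (det-cong λ i j → sum-cong-≗ λ l → cong (A i l *_) (p j l)) (det-cong λ i j → p j i)
    alt .linear j t {c} {d} {e} p q r = trans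
      (cong₂ (λ x y → x + - det A * y)
        (det-linear j t {A ⊗ c ᵀ} {A ⊗ d ᵀ} {A ⊗ e ᵀ}
          (λ l l≢j i → sum-cong-≗ λ x → cong (A i x *_) (p l l≢j x))
          (λ l l≢j i → sum-cong-≗ λ x → cong (A i x *_) (q l l≢j x))
          (λ i → trans (sum-cong-≗ λ x → trans (cong (A i x *_) (r x)) (ring₂ (A i x) (c j x) t (d j x)))
                       (sum-linear (λ x → A i x * c j x) _ t)))
        (det-linear j t {c ᵀ} {d ᵀ} {e ᵀ} p q r))
      (ring₁ (det (A ⊗ c ᵀ)) (det (A ⊗ d ᵀ)) t (det A) (det (c ᵀ)) (det (d ᵀ)))
    alt .alternating {c = c} adj p = trans
      (cong₂ (λ x y → x + - det A * y)
        (det-alternating {A = A ⊗ c ᵀ} adj λ i → sum-cong-≗ λ x → cong (A i x *_) (p x))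
        (det-alternating {A = c ᵀ} adj p))
      (ring₄ (det A))
    base-case : f 𝟙 ≡ 0ℤ
    base-case = trans
      (cong₂ (λ x y → x + - det A * y)
        (det-cong (≋-trans (⊗-cong (≋-refl {A = A}) (λ i j → 𝟙-sym j i)) (⊗-identityʳ A)))
        (trans (det-cong {n} {𝟙 ᵀ} {𝟙} λ i j → 𝟙-sym j i) (det-𝟙 {n})))
      (ring₃ (det A))

-- Square-zero elementary operations and blocks of the form η - δ

module Unimodularity where
  open import Data.Fin using (Fin; zero; suc; _<_; _≟_; _<?_)
  open import Data.Fin.Properties using (<-irrefl; <-asym; <-cmp)
  open import Data.Integer using (ℤ; 0ℤ; 1ℤ; -1ℤ; _+_; _*_; -_; _-_)
  open import Data.Integer.Properties hiding (_≟_; _<?_; <-irrefl; <-asym; <-cmp)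
  open import Data.Integer.Tactic.RingSolver using (solve-∀)
  open import Data.Nat using (ℕ; zero; suc)
  open import Data.Product using (_,_)
  open import Data.Sum using (reduce)
  open import Data.Vec.Functional using (Vector)
  open import Function using (_∘_)
  open import Relation.Binary.Definitions using (tri<; tri≈; tri>)
  open import Relation.Binary.PropositionalEquality
  open import Relation.Nullary using (yes; no; contradiction)
  open Sums
  open Matrices
  open Determinants

  private variable n : ℕ

  -- Membership in `InGL` leaves the sign of the determinant open. Keeping `det-one` beside the
  -- inverse lets the same operations prove both the determinant formula and the normal form.
  record Unimodular {n} (A : Matrix n) : Set where
    field
      inverse  : Matrix n
      inverseˡ : inverse ⊗ A ≋ 𝟙
      inverseʳ : A ⊗ inverse ≋ 𝟙
      det-one  : det A ≡ 1ℤ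

    inGL : InGL A
    inGL = inverse , inverseˡ , inverseʳ

  open Unimodular

  cancel-inner : ∀ {A B A′ B′ : Matrix n} → A ⊗ A′ ≋ 𝟙 → B ⊗ B′ ≋ 𝟙 → (A ⊗ B) ⊗ (B′ ⊗ A′) ≋ 𝟙
  cancel-inner {A = A} {B} {A′} {B′} p q =
    ≋-trans (⊗-assoc A B (B′ ⊗ A′)) (≋-trans (⊗-cong (≋-refl {A = A})
      (≋-trans (≋-sym (⊗-assoc B B′ A′)) (≋-trans (⊗-cong q (≋-refl {A = A′})) (⊗-identityˡ A′)))) p)

  unimodular-⊗ : ∀ {A B : Matrix n} → Unimodular A → Unimodular B → Unimodular (A ⊗ B)
  unimodular-⊗ {A = A} {B} u v .inverse  = v .inverse ⊗ u .inverse
  unimodular-⊗ {A = A} {B} u v .inverseˡ = cancel-inner {A = v .inverse} {u .inverse} {B} {A} (v .inverseˡ) (u .inverseˡ)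
  unimodular-⊗ {A = A} {B} u v .inverseʳ = cancel-inner {A = A} {B} (u .inverseʳ) (v .inverseʳ)
  unimodular-⊗ {A = A} {B} u v .det-one = trans (det-⊗ A B) (cong₂ _*_ (u .det-one) (v .det-one))

  unimodular-cong : ∀ {A B : Matrix n} → A ≋ B → Unimodular A → Unimodular B
  unimodular-cong p u .inverse  = u .inverse
  unimodular-cong p u .inverseˡ = ≋-trans (⊗-cong (≋-refl {A = u .inverse}) (≋-sym p)) (u .inverseˡ)
  unimodular-cong p u .inverseʳ = ≋-trans (⊗-cong (≋-sym p) (≋-refl {A = u .inverse})) (u .inverseʳ)
  unimodular-cong p u .det-one  = trans (det-cong (≋-sym p)) (u .det-one)

  infix 9 𝟙+_
  𝟙+_ : Matrix n → Matrix n
  (𝟙+ X) i j = 𝟙 i j + X i j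

  𝟙+-⊗ : (X A : Matrix n) → ∀ i j → (𝟙+ X ⊗ A) i j ≡ A i j + sum (λ k → X i k * A k j)
  𝟙+-⊗ X A i j = trans
    (sum-cong-≗ λ k → *-distribʳ-+ (A k j) (𝟙 i k) (X i k))
    (trans (∑-distrib-+ (λ k → 𝟙 i k * A k j) (λ k → X i k * A k j))
           (cong (_+ sum (λ k → X i k * A k j)) (sum-𝟙ˡ (λ k → A k j) i)))

  ⊗-𝟙+ : (A X : Matrix n) → ∀ i j → (A ⊗ 𝟙+ X) i j ≡ A i j + sum (λ k → A i k * X k j)
  ⊗-𝟙+ A X i j = trans
    (sum-cong-≗ λ k → *-distribˡ-+ (A i k) (𝟙 k j) (X k j))
    (trans (∑-distrib-+ (λ k → A i k * 𝟙 k j) (λ k → A i k * X k j))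
           (cong (_+ sum (λ k → A i k * X k j)) (sum-𝟙ʳ (A i) j)))

  𝟙+-⊗-𝟙+ : (X Y : Matrix n) → (∀ i j k → X i j * Y j k ≡ 0ℤ) →
             𝟙+ X ⊗ 𝟙+ Y ≋ 𝟙+ (λ i j → X i j + Y i j)
  𝟙+-⊗-𝟙+ X Y XY≡0 i j = trans (⊗-𝟙+ (𝟙+ X) Y i j) (trans
    (cong (𝟙 i j + X i j +_) (trans
      (sum-cong-≗ λ k → trans (*-distribʳ-+ (Y k j) (𝟙 i k) (X i k))
                          (trans (cong (𝟙 i k * Y k j +_) (XY≡0 i k j)) (+-identityʳ _)))
      (sum-𝟙ˡ (λ k → Y k j) i)))
    (+-assoc (𝟙 i j) (X i j) (Y i j)))

  private
    square-zero-inverse : (X Y : Matrix n) → (∀ i j → X i j + Y i j ≡ 0ℤ) →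
                          (∀ i j k → X i j * Y j k ≡ 0ℤ) → 𝟙+ X ⊗ 𝟙+ Y ≋ 𝟙
    square-zero-inverse X Y sum≡0 XY≡0 i j =
      trans (𝟙+-⊗-𝟙+ X Y XY≡0 i j) (trans (cong (𝟙 i j +_) (sum≡0 i j)) (+-identityʳ _))

  -- A square-zero X is the sum of its strictly lower and upper parts L and
  -- R, and L R = 0, so that 1 + X = (1 + L)(1 + R) has determinant 1.
  module _ (X : Matrix n) (X²≡0 : ∀ i j k → X i j * X j k ≡ 0ℤ) where
    private
      L R : Matrix n
      L i j with j <? i
      ... | yes _ = X i j
      ... | no _  = 0ℤ
      R i j with i <? j
      ... | yes _ = X i j
      ... | no _  = 0ℤ

      LR≡0 : ∀ i j k → L i j * R j k ≡ 0ℤ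
      LR≡0 i j k with j <? i | j <? k
      ... | yes _ | yes _ = X²≡0 i j k
      ... | yes _ | no _  = *-zeroʳ (X i j)
      ... | no _  | yes _ = *-zeroˡ (X j k)
      ... | no _  | no _  = refl

      -- The vanishing is assumed for each product of entries, not only for their sum. With all
      -- three indices equal it gives a square that is zero, so the diagonal of X, which neither `L`
      -- nor `R` covers, is zero.
      X-diagonal : ∀ i → X i i ≡ 0ℤ
      X-diagonal i = reduce (i*j≡0⇒i≡0∨j≡0 (X i i) (X²≡0 i i i))

      L+R≡X : ∀ i j → L i j + R i j ≡ X i j
      L+R≡X i j with j <? i | i <? j
      ... | yes j<i | yes i<j = contradiction i<j (<-asym j<i)
      ... | yes _   | no _    = +-identityʳ _
      ... | no _    | yes _   = +-identityˡ _
      ... | no j≮i  | no i≮j with <-cmp i j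
      ...   | tri< i<j _ _  = contradiction i<j i≮j
      ...   | tri≈ _ refl _ = sym (X-diagonal i)
      ...   | tri> _ _ j<i  = contradiction j<i j≮i

      product-one : ∀ {m} {a : Vector ℤ m} → (∀ i → a i ≡ 1ℤ) → product a ≡ 1ℤ
      product-one {zero}  p = refl
      product-one {suc m} p = cong₂ _*_ (p zero) (product-one (p ∘ suc))

      det-L : det (𝟙+ L) ≡ 1ℤ
      det-L = trans (det-lower (𝟙+ L) above) (product-one diag)
        where
        above : ∀ i j → i < j → (𝟙+ L) i j ≡ 0ℤ
        above i j i<j with j <? i
        ... | yes j<i = contradiction j<i (<-asym i<j)
        ... | no _    = trans (+-identityʳ (𝟙 i j)) (Δ-off-diagonal (λ _ → 1ℤ) {i} {j} λ { refl → <-irrefl refl i<j })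
        diag : ∀ i → (𝟙+ L) i i ≡ 1ℤ
        diag i with i <? i
        ... | yes i<i = contradiction i<i (<-irrefl refl)
        ... | no _    = trans (+-identityʳ (𝟙 i i)) (Δ-diagonal (λ _ → 1ℤ) i)

      det-R : det (𝟙+ R) ≡ 1ℤ
      det-R = trans (det-upper (𝟙+ R) below) (product-one diag)
        where
        below : ∀ i j → j < i → (𝟙+ R) i j ≡ 0ℤ
        below i j j<i with i <? j
        ... | yes i<j = contradiction i<j (<-asym j<i)
        ... | no _    = trans (+-identityʳ (𝟙 i j)) (Δ-off-diagonal (λ _ → 1ℤ) {i} {j} λ { refl → <-irrefl refl j<i })
        diag : ∀ i → (𝟙+ R) i i ≡ 1ℤ
        diag i with i <? i
        ... | yes i<i = contradiction i<i (<-irrefl refl)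
        ... | no _    = trans (+-identityʳ (𝟙 i i)) (Δ-diagonal (λ _ → 1ℤ) i)

    unimodular-𝟙+ : Unimodular (𝟙+ X)
    unimodular-𝟙+ .inverse  = 𝟙+ (λ i j → - X i j)
    unimodular-𝟙+ .inverseˡ = square-zero-inverse (λ i j → - X i j) X (λ i j → +-inverseˡ (X i j))
      λ i j k → trans (sym (neg-distribˡ-* (X i j) (X j k))) (cong -_ (X²≡0 i j k))
    unimodular-𝟙+ .inverseʳ = square-zero-inverse X (λ i j → - X i j) (λ i j → +-inverseʳ (X i j))
      λ i j k → trans (sym (neg-distribʳ-* (X i j) (X j k))) (cong -_ (X²≡0 i j k))
    unimodular-𝟙+ .det-one  = begin
      det (𝟙+ X)                ≡⟨ det-cong (λ i j → cong (𝟙 i j +_) (sym (L+R≡X i j))) ⟩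
      det (𝟙+ (λ i j → L i j + R i j)) ≡⟨ det-cong (𝟙+-⊗-𝟙+ L R LR≡0) ⟨
      det (𝟙+ L ⊗ 𝟙+ R)         ≡⟨ det-⊗ (𝟙+ L) (𝟙+ R) ⟩
      det (𝟙+ L) * det (𝟙+ R)   ≡⟨ cong₂ _*_ det-L det-R ⟩
      1ℤ                        ∎
      where open ≡-Reasoning

  -- The blocks are the fibres of q, and q v represents the block of v.
  module BlockDiagonalisation
    (B : Matrix n) (q : Fin n → Fin n) (η : Fin n → ℤ)
    (q-idem : ∀ v → q (q v) ≡ q v) (η-q : ∀ v → η (q v) ≡ η v)
    (B-same : ∀ v w → q v ≡ q w → B v w ≡ η v - 𝟙 v w)
    (B-different : ∀ v w → q v ≢ q w → B v w ≡ 0ℤ)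
    where

    abstract
      -- Points from each non-representative to its representative. Thus 1 - K on the left subtracts
      -- the representative's row from the other rows of its block, and 1 + K on the right adds the
      -- other columns of a block to that of its representative.
      K : Matrix n
      K v w with v ≟ w | q v ≟ w
      ... | no _  | yes _ = 1ℤ
      ... | no _  | no _  = 0ℤ
      ... | yes _ | _     = 0ℤ

      K-representative : ∀ {v} → q v ≡ v → ∀ w → K v w ≡ 0ℤ
      K-representative {v} qv≡v w with v ≟ w | q v ≟ w
      ... | no v≢w | yes qv≡w = contradiction (trans (sym qv≡v) qv≡w) v≢w
      ... | no _   | no _     = refl
      ... | yes _  | _        = refl

      K-other : ∀ {v} → q v ≢ v → ∀ w → K v w ≡ 𝟙 (q v) w
      K-other {v} qv≢v w with v ≟ w | q v ≟ w
      ... | no _     | yes refl = refl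
      ... | no _     | no qv≢w  = refl
      ... | yes refl | yes qv≡v = contradiction qv≡v qv≢v
      ... | yes refl | no _     = refl

      K-elsewhere : ∀ v w → q v ≢ w → K v w ≡ 0ℤ
      K-elsewhere v w qv≢w with v ≟ w | q v ≟ w
      ... | no _  | yes qv≡w = contradiction qv≡w qv≢w
      ... | no _  | no _     = refl
      ... | yes _ | _        = refl

    K²≡0 : ∀ u v w → K u v * K v w ≡ 0ℤ
    K²≡0 u v w with q u ≟ v
    ... | yes refl = trans (cong (K u (q u) *_) (K-representative (q-idem u) w)) (*-zeroʳ (K u (q u)))
    ... | no qu≢v  = cong (_* K v w) (K-elsewhere u v qu≢v)

    -- Once the rows of the other members w of a block have become -δ, the representative's row
    -- still has η v in column w; adding η v times row w clears it, and `Y` collects these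
    -- multiples.
    -K Y : Matrix n
    -K v w = - K v w
    Y v w = η v * K w v

    abstract
      -- The sum counts the other members of the block, so a block of size k gives its
      -- representative the entry η k - 1, which is the common row sum of the block η - δ.
      entry : Fin n → ℤ
      entry v with q v ≟ v
      ... | yes _ = η v * (1ℤ + sum (λ w → K w v)) - 1ℤ
      ... | no _  = -1ℤ

      entry-representative : ∀ {v} → q v ≡ v → entry v ≡ η v * (1ℤ + sum (λ w → K w v)) - 1ℤ
      entry-representative {v} qv≡v with q v ≟ v
      ... | yes _   = refl
      ... | no qv≢v = contradiction qv≡v qv≢v

      entry-other : ∀ {v} → q v ≢ v → entry v ≡ -1ℤ
      entry-other {v} qv≢v with q v ≟ v
      ... | yes qv≡v = contradiction qv≡v qv≢v
      ... | no _     = refl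

    left right : Matrix n
    left  = 𝟙+ Y ⊗ 𝟙+ -K
    right = 𝟙+ K

    left-unimodular : Unimodular left
    left-unimodular = unimodular-⊗
      (unimodular-𝟙+ Y λ u v w → trans (ring (η u) (K v u) (η v) (K w v)) (trans (cong (η u * η v *_) (K²≡0 w v u)) (*-zeroʳ (η u * η v))))
      (unimodular-𝟙+ -K λ u v w → trans (ring′ (K u v) (K v w)) (K²≡0 u v w))
      where
      ring : ∀ a b c d → a * b * (c * d) ≡ a * c * (d * b)
      ring = solve-∀
      ring′ : ∀ a b → - a * - b ≡ a * b
      ring′ = solve-∀

    right-unimodular : Unimodular right
    right-unimodular = unimodular-𝟙+ K K²≡0

    private
      ring₁ : ∀ a b c → (a - b) + - (a - c) ≡ c - b
      ring₁ = solve-∀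
      ring₂ : ∀ a b → (a - b) + - a ≡ - b
      ring₂ = solve-∀
      ring₃ : ∀ a b c → (a - b) * c ≡ a * c + -1ℤ * (b * c)
      ring₃ = solve-∀
      ring₄ : ∀ a b c → (a - b) + (0ℤ + -1ℤ * a) ≡ - b
      ring₄ = solve-∀
      ring₅ : ∀ a k c → (a - 1ℤ) + 1ℤ * (a * c) + - (a * 0ℤ) ≡ a * (1ℤ + c) - 1ℤ
      ring₅ = solve-∀

      X₁ X₂ : Matrix n
      X₁ = 𝟙+ -K ⊗ B
      X₂ = X₁ ⊗ right

      sum-neg : ∀ (f g : Vector ℤ n) → sum (λ k → - f k * g k) ≡ - sum (λ k → f k * g k)
      sum-neg f g = trans (sum-cong-≗ λ k → ring (f k) (g k))
                      (trans (sym (*-distribˡ-sum -1ℤ (λ k → f k * g k))) (-1*i≡-i _))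
        where
        ring : ∀ a b → - a * b ≡ -1ℤ * (a * b)
        ring = solve-∀

      X₁-representative : ∀ {v} → q v ≡ v → ∀ w → X₁ v w ≡ B v w
      X₁-representative {v} qv≡v w = trans (𝟙+-⊗ -K B v w) (trans
        (cong (B v w +_) (sum-zero λ k → cong (λ a → - a * B k w) (K-representative qv≡v k)))
        (+-identityʳ _))

      X₁-other : ∀ {v} → q v ≢ v → ∀ w → X₁ v w ≡ 𝟙 (q v) w - 𝟙 v w
      X₁-other {v} qv≢v w = trans (𝟙+-⊗ -K B v w) (trans
        (cong (B v w +_) (trans (sum-neg (K v) (λ k → B k w))
          (cong -_ (trans (sum-cong-≗ λ k → cong (_* B k w) (K-other qv≢v k)) (sum-𝟙ˡ (λ k → B k w) (q v))))))
        (difference w))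
        where
        difference : ∀ w → B v w + - B (q v) w ≡ 𝟙 (q v) w - 𝟙 v w
        difference w with q v ≟ q w
        ... | yes qv≡qw = trans
          (cong₂ (λ a b → a + - b) (B-same v w qv≡qw)
            (trans (B-same (q v) w (trans (q-idem v) qv≡qw)) (cong (_- 𝟙 (q v) w) (η-q v))))
          (ring₁ (η v) (𝟙 v w) (𝟙 (q v) w))
        ... | no qv≢qw = trans
          (cong₂ (λ a b → a + - b) (B-different v w qv≢qw)
            (B-different (q v) w λ eq → qv≢qw (trans (sym (q-idem v)) eq)))
          (sym (cong₂ (λ a b → a - b)
            (Δ-off-diagonal (λ _ → 1ℤ) {q v} {w} λ { refl → qv≢qw (sym (q-idem v)) })
            (Δ-off-diagonal (λ _ → 1ℤ) {v} {w} λ { refl → qv≢qw refl })))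

      -- The first row operation left row v as a difference of two unit rows, at q v and at v;
      -- adding column v to column q v cancels the first.
      X₂-other : ∀ {v} → q v ≢ v → ∀ w → X₂ v w ≡ - 𝟙 v w
      X₂-other {v} qv≢v w = begin
        X₂ v w
          ≡⟨ ⊗-𝟙+ X₁ K v w ⟩
        X₁ v w + sum (λ k → X₁ v k * K k w)
          ≡⟨ cong₂ _+_ (X₁-other qv≢v w) (trans
               (sum-cong-≗ λ k → trans (cong (_* K k w) (X₁-other qv≢v k)) (ring₃ (𝟙 (q v) k) (𝟙 v k) (K k w)))
               (sum-linear (λ k → 𝟙 (q v) k * K k w) (λ k → 𝟙 v k * K k w) -1ℤ)) ⟩
        (𝟙 (q v) w - 𝟙 v w) + (sum (λ k → 𝟙 (q v) k * K k w) + -1ℤ * sum (λ k → 𝟙 v k * K k w))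
          ≡⟨ cong₂ (λ a b → (𝟙 (q v) w - 𝟙 v w) + (a + -1ℤ * b))
               (trans (sum-𝟙ˡ (λ k → K k w) (q v)) (K-representative (q-idem v) w))
               (trans (sum-𝟙ˡ (λ k → K k w) v) (K-other qv≢v w)) ⟩
        (𝟙 (q v) w - 𝟙 v w) + (0ℤ + -1ℤ * 𝟙 (q v) w)
          ≡⟨ ring₄ (𝟙 (q v) w) (𝟙 v w) 0ℤ ⟩
        - 𝟙 v w ∎
        where open ≡-Reasoning

      -- In a representative's row only its own column changes: there the entries η v of the other
      -- members of the block are added.
      X₂-representative : ∀ {v} → q v ≡ v → ∀ w →
                          X₂ v w ≡ B v w + 𝟙 v w * (η v * sum (λ k → K k v))
      X₂-representative {v} qv≡v w = trans (⊗-𝟙+ X₁ K v w) (cong₂ _+_ (X₁-representative qv≡v w) (begin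
        sum (λ k → X₁ v k * K k w)              ≡⟨ sum-cong-≗ term ⟩
        sum (λ k → 𝟙 v w * η v * K k v)         ≡⟨ *-distribˡ-sum (𝟙 v w * η v) (λ k → K k v) ⟨
        𝟙 v w * η v * sum (λ k → K k v)         ≡⟨ *-assoc (𝟙 v w) (η v) _ ⟩
        𝟙 v w * (η v * sum (λ k → K k v))       ∎))
        where
        open ≡-Reasoning
        term : ∀ k → X₁ v k * K k w ≡ 𝟙 v w * η v * K k v
        term k with v ≟ w
        term k | yes refl with v ≟ k | q v ≟ q k
        ... | yes refl | _        = trans (cong (X₁ v v *_) (K-representative qv≡v v))
                                      (trans (*-zeroʳ (X₁ v v)) (sym (trans (cong (1ℤ * η v *_) (K-representative qv≡v v)) (*-zeroʳ (1ℤ * η v)))))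
        ... | no v≢k   | yes same = cong (_* K k v) (trans (X₁-representative qv≡v k) (trans (B-same v k same)
                                      (trans (cong (λ a → η v - a) (Δ-off-diagonal _ v≢k)) (ring (η v)))))
          where
          ring : ∀ a → a - 0ℤ ≡ 1ℤ * a
          ring = solve-∀
        ... | no v≢k   | no diff  = trans (cong (X₁ v k *_) (K-elsewhere k v off)) (trans (*-zeroʳ (X₁ v k))
                                      (sym (trans (cong (1ℤ * η v *_) (K-elsewhere k v off)) (*-zeroʳ (1ℤ * η v)))))
          where
          off : q k ≢ v
          off qk≡v = diff (trans qv≡v (sym qk≡v))
        term k | no v≢w with q k ≟ w
        ... | no qk≢w  = trans (cong (X₁ v k *_) (K-elsewhere k w qk≢w)) (*-zeroʳ (X₁ v k))
        ... | yes refl = trans (cong (_* K k (q k)) (trans (X₁-representative qv≡v k)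
                           (B-different v k λ eq → v≢w (trans (sym qv≡v) eq)))) refl

    diagonalise : left ⊗ B ⊗ right ≋ Δ entry
    diagonalise v w = begin
      (left ⊗ B ⊗ right) v w                ≡⟨ ⊗-cong (⊗-assoc (𝟙+ Y) (𝟙+ -K) B) (≋-refl {A = right}) v w ⟩
      (𝟙+ Y ⊗ X₁ ⊗ right) v w               ≡⟨ ⊗-assoc (𝟙+ Y) X₁ right v w ⟩
      (𝟙+ Y ⊗ X₂) v w                       ≡⟨ 𝟙+-⊗ Y X₂ v w ⟩
      X₂ v w + sum (λ k → Y v k * X₂ k w)   ≡⟨ cong (X₂ v w +_) (trans (sum-cong-≗ term)
                                                 (trans (sum-cong-≗ λ k → swap (Y v k) (𝟙 k w)) (sum-𝟙ʳ (λ k → - Y v k) w))) ⟩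
      X₂ v w + - Y v w                      ≡⟨ finish ⟩
      Δ entry v w                           ∎
      where
      open ≡-Reasoning
      swap : ∀ a b → a * - b ≡ - a * b
      swap = solve-∀
      term : ∀ k → Y v k * X₂ k w ≡ Y v k * - 𝟙 k w
      term k with q k ≟ k
      ... | no qk≢k  = cong (Y v k *_) (X₂-other qk≢k w)
      ... | yes qk≡k = trans (cong (_* X₂ k w) Y≡0) (sym (cong (_* - 𝟙 k w) Y≡0))
        where
        Y≡0 : Y v k ≡ 0ℤ
        Y≡0 = trans (cong (η v *_) (K-representative qk≡k v)) (*-zeroʳ (η v))
      other : q v ≢ v → Y v w ≡ 0ℤ
      other qv≢v = trans (cong (η v *_) (K-elsewhere w v λ { refl → qv≢v (q-idem w) })) (*-zeroʳ (η v))
      zero-sum : ∀ b c → (b - 0ℤ) + 0ℤ * c + - (b * 1ℤ) ≡ 0ℤ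
      zero-sum = solve-∀
      finish : X₂ v w + - Y v w ≡ Δ entry v w
      finish with q v ≟ v
      ... | no qv≢v = trans (cong₂ (λ a b → a + - b) (X₂-other qv≢v w) (other qv≢v)) (trans (+-identityʳ _) value)
        where
        value : - 𝟙 v w ≡ Δ entry v w
        value with v ≟ w
        ... | no _ = refl
        ... | yes refl = sym (entry-other qv≢v)
      ... | yes qv≡v = trans (cong (_+ - Y v w) (X₂-representative qv≡v w)) value
        where
        value : B v w + 𝟙 v w * (η v * sum (λ k → K k v)) + - Y v w ≡ Δ entry v w
        value with v ≟ w
        ... | yes refl = trans
          (cong₂ (λ a b → a + 1ℤ * (η v * sum (λ k → K k v)) + - (η v * b))
            (trans (B-same v v refl) (cong (λ a → η v - a) (Δ-diagonal _ v))) (K-representative qv≡v v))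
          (trans (ring₅ (η v) 0ℤ (sum (λ k → K k v))) (sym (entry-representative qv≡v)))
        ... | no v≢w with q w ≟ v
        ...   | yes qw≡v = trans
          (cong₂ (λ a b → a + 0ℤ * (η v * sum (λ k → K k v)) + - (η v * b))
            (trans (B-same v w (trans qv≡v (sym qw≡v))) (cong (λ a → η v - a) (Δ-off-diagonal _ v≢w)))
            (trans (K-other (λ qw≡w → v≢w (trans (sym qw≡v) qw≡w)) v)
                   (trans (cong (λ a → 𝟙 a v) qw≡v) (Δ-diagonal _ v))))
          (zero-sum (η v) (η v * sum (λ k → K k v)))
        ...   | no qw≢v = trans
          (cong₂ (λ a b → a + 0ℤ * (η v * sum (λ k → K k v)) + - (η v * b))
            (B-different v w λ eq → qw≢v (trans (sym eq) qv≡v)) (K-elsewhere w v qw≢v))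
          (ring₆ (η v) (η v * sum (λ k → K k v)))
          where
          ring₆ : ∀ a b → 0ℤ + 0ℤ * b + - (a * 0ℤ) ≡ 0ℤ
          ring₆ = solve-∀

-- A formula in comparisons of k natural numbers which holds for all tuples
-- of numbers below k holds for all tuples: replacing each x i by the number
-- of j with x j < x i does not change the comparisons.
module OrderFormulas where
  open import Data.Bool using (Bool; true; _∧_; T)
  open import Data.Bool.Properties using (T-∧)
  open import Data.Empty using (⊥)
  open import Data.Fin using (Fin; zero; suc)
  open import Data.Nat using (ℕ; zero; suc; _+_; _<_; _≤_; _≤?_; _<?_; _≟_; z≤n)
  open import Data.Nat.Properties using (≤-refl; ≤-trans; ≤-antisym; ≤-reflexive; <-≤-trans;
    <-irrefl; ≰⇒>; ≮⇒≥; <⇒≱;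
    +-mono-≤; +-mono-<-≤; +-mono-≤-<; m≤n⇒m≤1+n; m<1+n⇒m<n∨m≡n)
  open import Data.Product using (_×_; _,_; proj₁; proj₂)
  open import Data.Sum using (_⊎_; inj₁; inj₂)
  open import Data.Vec using (Vec; []; _∷_; lookup; tabulate)
  open import Data.Vec.Properties using (lookup∘tabulate)
  open import Function using (_∘_; Equivalence)
  open import Relation.Binary.PropositionalEquality
  open import Relation.Nullary using (Dec; yes; no; does; contradiction; _×-dec_; _⊎-dec_; _→-dec_)

  infix  8 _<̇_ _≤̇_ _≐_
  infixr 7 _∧̇_
  infixr 6 _∨̇_
  infixr 5 _⇒̇_

  data Formula (k : ℕ) : Set where
    ⊥̇               : Formula k
    _<̇_ _≤̇_ _≐_     : Fin k → Fin k → Formula k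
    _∧̇_ _∨̇_ _⇒̇_     : Formula k → Formula k → Formula k

  private variable k : ℕ

  ⟦_⟧ : Formula k → Vec ℕ k → Set
  ⟦ ⊥̇ ⟧ x     = ⊥
  ⟦ i <̇ j ⟧ x = lookup x i < lookup x j
  ⟦ i ≤̇ j ⟧ x = lookup x i ≤ lookup x j
  ⟦ i ≐ j ⟧ x = lookup x i ≡ lookup x j
  ⟦ φ ∧̇ ψ ⟧ x = ⟦ φ ⟧ x × ⟦ ψ ⟧ x
  ⟦ φ ∨̇ ψ ⟧ x = ⟦ φ ⟧ x ⊎ ⟦ ψ ⟧ x
  ⟦ φ ⇒̇ ψ ⟧ x = ⟦ φ ⟧ x → ⟦ ψ ⟧ x

  holds? : (φ : Formula k) → ∀ x → Dec (⟦ φ ⟧ x)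
  holds? ⊥̇ x       = no λ ()
  holds? (i <̇ j) x = lookup x i <? lookup x j
  holds? (i ≤̇ j) x = lookup x i ≤? lookup x j
  holds? (i ≐ j) x = lookup x i ≟ lookup x j
  holds? (φ ∧̇ ψ) x = holds? φ x ×-dec holds? ψ x
  holds? (φ ∨̇ ψ) x = holds? φ x ⊎-dec holds? ψ x
  holds? (φ ⇒̇ ψ) x = holds? φ x →-dec holds? ψ x

  private
    allBelow : ℕ → (ℕ → Bool) → Bool
    allBelow zero    p = true
    allBelow (suc k) p = p k ∧ allBelow k p

    allBelow-sound : ∀ k p → T (allBelow k p) → ∀ {i} → i < k → T (p i)
    allBelow-sound (suc k) p all i<1+k with m<1+n⇒m<n∨m≡n i<1+k
    ... | inj₁ i<k  = allBelow-sound k p (proj₂ (Equivalence.to T-∧ all)) i<k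
    ... | inj₂ refl = proj₁ (Equivalence.to T-∧ all)

    allTuples : ∀ m → ℕ → (Vec ℕ m → Bool) → Bool
    allTuples zero    k p = p []
    allTuples (suc m) k p = allBelow k λ i → allTuples m k (p ∘ (i ∷_))

    allTuples-sound : ∀ {m} k p → T (allTuples m k p) → (x : Fin m → ℕ) → (∀ i → x i < k) → T (p (tabulate x))
    allTuples-sound {zero}  k p all x x<k = all
    allTuples-sound {suc m} k p all x x<k = allTuples-sound k (p ∘ (x zero ∷_))
      (allBelow-sound k (λ i → allTuples m k (p ∘ (i ∷_))) all (x<k zero)) (x ∘ suc) (x<k ∘ suc)

  valid : Formula k → Bool
  valid {k} φ = allTuples k k λ x → does (holds? φ x)

  private
    total : (Fin k → ℕ) → ℕ
    total {zero}  f = 0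
    total {suc k} f = f zero + total (f ∘ suc)

    total-mono : ∀ {f g : Fin k → ℕ} → (∀ i → f i ≤ g i) → total f ≤ total g
    total-mono {zero}  f≤g = z≤n
    total-mono {suc k} f≤g = +-mono-≤ (f≤g zero) (total-mono (f≤g ∘ suc))

    total-strict : ∀ {f g : Fin k → ℕ} → (∀ i → f i ≤ g i) → ∀ i → f i < g i → total f < total g
    total-strict f≤g zero    fi<gi = +-mono-<-≤ fi<gi (total-mono (f≤g ∘ suc))
    total-strict f≤g (suc i) fi<gi = +-mono-≤-< (f≤g zero) (total-strict (f≤g ∘ suc) i fi<gi)

    total-one : ∀ k → total {k} (λ _ → 1) ≡ k
    total-one zero    = refl
    total-one (suc k) = cong suc (total-one k)

    below : ℕ → ℕ → ℕ
    below y x with x <? y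
    ... | yes _ = 1
    ... | no _  = 0

    below-≤1 : ∀ y x → below y x ≤ 1
    below-≤1 y x with x <? y
    ... | yes _ = ≤-refl
    ... | no _  = z≤n

    below-mono : ∀ {y z} x → y ≤ z → below y x ≤ below z x
    below-mono {y} {z} x y≤z with x <? y | x <? z
    ... | yes x<y | no x≮z = contradiction (<-≤-trans x<y y≤z) x≮z
    ... | yes _   | yes _  = ≤-refl
    ... | no _    | yes _  = z≤n
    ... | no _    | no _   = z≤n

    below-< : ∀ {x y} → x < y → below x x < below y x
    below-< {x} {y} x<y with x <? x | x <? y
    ... | no _    | yes _  = ≤-refl
    ... | no _    | no x≮y = contradiction x<y x≮y
    ... | yes x<x | _      = contradiction x<x (<-irrefl refl)

    below-self : ∀ x → below x x < 1
    below-self x with x <? x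
    ... | no _    = ≤-refl
    ... | yes x<x = contradiction x<x (<-irrefl refl)

    module Rank (x : Vec ℕ k) where
      -- Equal numbers get equal ranks, and no index counts itself, which keeps every rank below k.
      rank : Fin k → ℕ
      rank i = total λ j → below (lookup x i) (lookup x j)

      rank<k : ∀ i → rank i < k
      rank<k i = <-≤-trans
        (total-strict (λ j → below-≤1 (lookup x i) (lookup x j)) i (below-self (lookup x i))) (≤-reflexive (total-one k))

      ranks : Vec ℕ k
      ranks = tabulate rank

      ≤⇒rank : ∀ i j → lookup x i ≤ lookup x j → lookup ranks i ≤ lookup ranks j
      ≤⇒rank i j le = subst₂ _≤_ (sym (lookup∘tabulate rank i)) (sym (lookup∘tabulate rank j))
        (total-mono λ l → below-mono (lookup x l) le)

      <⇒rank : ∀ i j → lookup x i < lookup x j → lookup ranks i < lookup ranks j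
      <⇒rank i j lt = subst₂ _<_ (sym (lookup∘tabulate rank i)) (sym (lookup∘tabulate rank j))
        (total-strict (λ l → below-mono (lookup x l) (≤-trans (m≤n⇒m≤1+n ≤-refl) lt)) i (below-< lt))

      rank⇒≤ : ∀ i j → lookup ranks i ≤ lookup ranks j → lookup x i ≤ lookup x j
      rank⇒≤ i j le = ≮⇒≥ λ lt → <⇒≱ (<⇒rank j i lt) le

      rank⇒< : ∀ i j → lookup ranks i < lookup ranks j → lookup x i < lookup x j
      rank⇒< i j lt = ≰⇒> λ le → <⇒≱ lt (≤⇒rank j i le)

      -- Both directions are proved together because an implication is contravariant in its premise.
      to   : ∀ φ → ⟦ φ ⟧ x → ⟦ φ ⟧ ranks
      from : ∀ φ → ⟦ φ ⟧ ranks → ⟦ φ ⟧ x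
      to (i <̇ j) p        = <⇒rank i j p
      to (i ≤̇ j) p        = ≤⇒rank i j p
      to (i ≐ j) p        = ≤-antisym (≤⇒rank i j (≤-reflexive p)) (≤⇒rank j i (≤-reflexive (sym p)))
      to (φ ∧̇ ψ) (p , q)  = to φ p , to ψ q
      to (φ ∨̇ ψ) (inj₁ p) = inj₁ (to φ p)
      to (φ ∨̇ ψ) (inj₂ q) = inj₂ (to ψ q)
      to (φ ⇒̇ ψ) f        = to ψ ∘ f ∘ from φ
      from (i <̇ j) p        = rank⇒< i j p
      from (i ≤̇ j) p        = rank⇒≤ i j p
      from (i ≐ j) p        = ≤-antisym (rank⇒≤ i j (≤-reflexive p)) (rank⇒≤ j i (≤-reflexive (sym p)))
      from (φ ∧̇ ψ) (p , q)  = from φ p , from ψ q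
      from (φ ∨̇ ψ) (inj₁ p) = inj₁ (from φ p)
      from (φ ∨̇ ψ) (inj₂ q) = inj₂ (from ψ q)
      from (φ ⇒̇ ψ) f        = from ψ ∘ f ∘ to φ

  -- `holds` is inferred by evaluation: `valid φ` runs through all k^k tuples during type checking.
  -- This replaces long case analyses on relative positions, at the price of keeping k small.
  order : (φ : Formula k) {holds : T (valid φ)} → ∀ x → ⟦ φ ⟧ x
  order {k} φ {holds} x = from φ (toWitness′ (holds? φ ranks)
    (allTuples-sound k (λ y → does (holds? φ y)) holds rank rank<k))
    where
    open Rank x
    toWitness′ : ∀ {P : Set} (P? : Dec P) → T (does P?) → P
    toWitness′ (yes p) _ = p

-- f ⋆ g sums f Y * g (X ─ Y) over the subsets Y of X.
module Convolution where
  open import Data.Fin using (zero; suc)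
  open import Data.Fin.Subset using (Subset; inside; outside; _∉_; _⊆_; _─_; ∣_∣; ⊥)
  open import Data.Fin.Subset.Properties using (_⊆?_; ⊆-refl; in⊆in; out⊆; drop-∷-⊆; drop-not-there)
  open import Data.Nat using (ℕ; zero; suc; _+_; _*_; _≤_; _≤?_)
  open import Data.Nat.Properties hiding (_≤?_)
  open import Data.Nat.Tactic.RingSolver using (solve-∀)
  open import Data.Product using (_×_; _,_)
  open import Data.Sum using (_⊎_; inj₁; inj₂; map₂)
  open import Data.Vec using ([]; _∷_; _[_]≔_; here)
  open import Data.Vec.Properties using (∷-injectiveʳ)
  open import Function using (_∘_)
  open import Relation.Binary.PropositionalEquality
  open import Relation.Nullary using (Dec; yes; no; contradiction; _×-dec_)

  private variable n : ℕ

  infixl 7 _⋆_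
  -- Recursion on X, where each element of X goes to one of the factors, is chosen over a sum over a
  -- list of subsets: the algebraic laws and `⋆-insert` become structural inductions.
  _⋆_ : (f g : Subset n → ℕ) → Subset n → ℕ
  (f ⋆ g) []            = f [] * g []
  (f ⋆ g) (outside ∷ X) = ((f ∘ (outside ∷_)) ⋆ (g ∘ (outside ∷_))) X
  (f ⋆ g) (inside ∷ X)  = ((f ∘ (inside ∷_)) ⋆ (g ∘ (outside ∷_))) X + ((f ∘ (outside ∷_)) ⋆ (g ∘ (inside ∷_))) X

  private
    +-interchange : ∀ a b c d → (a + b) + (c + d) ≡ (a + c) + (b + d)
    +-interchange = solve-∀

  ⋆-cong-⊆ : ∀ {f f′ g g′ : Subset n → ℕ} X → (∀ Y → Y ⊆ X → f Y ≡ f′ Y) → (∀ Y → Y ⊆ X → g Y ≡ g′ Y) →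
             (f ⋆ g) X ≡ (f′ ⋆ g′) X
  ⋆-cong-⊆ []            p q = cong₂ _*_ (p [] ⊆-refl) (q [] ⊆-refl)
  ⋆-cong-⊆ (outside ∷ X) p q =
    ⋆-cong-⊆ X (λ Y Y⊆X → p (outside ∷ Y) (out⊆ Y⊆X)) (λ Y Y⊆X → q (outside ∷ Y) (out⊆ Y⊆X))
  ⋆-cong-⊆ (inside ∷ X)  p q = cong₂ _+_
    (⋆-cong-⊆ X (λ Y Y⊆X → p (inside ∷ Y) (in⊆in Y⊆X)) (λ Y Y⊆X → q (outside ∷ Y) (out⊆ Y⊆X)))
    (⋆-cong-⊆ X (λ Y Y⊆X → p (outside ∷ Y) (out⊆ Y⊆X)) (λ Y Y⊆X → q (inside ∷ Y) (in⊆in Y⊆X)))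

  ⋆-cong : ∀ {f f′ g g′ : Subset n → ℕ} → (∀ Y → f Y ≡ f′ Y) → (∀ Y → g Y ≡ g′ Y) → ∀ X → (f ⋆ g) X ≡ (f′ ⋆ g′) X
  ⋆-cong p q X = ⋆-cong-⊆ X (λ Y _ → p Y) (λ Y _ → q Y)

  ⋆-comm : ∀ (f g : Subset n → ℕ) X → (f ⋆ g) X ≡ (g ⋆ f) X
  ⋆-comm f g []            = *-comm (f []) (g [])
  ⋆-comm f g (outside ∷ X) = ⋆-comm (f ∘ (outside ∷_)) (g ∘ (outside ∷_)) X
  ⋆-comm f g (inside ∷ X)  = trans
    (cong₂ _+_ (⋆-comm (f ∘ (inside ∷_)) (g ∘ (outside ∷_)) X) (⋆-comm (f ∘ (outside ∷_)) (g ∘ (inside ∷_)) X))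
    (+-comm (((g ∘ (outside ∷_)) ⋆ (f ∘ (inside ∷_))) X) _)

  ⋆-distribʳ-+ : ∀ (f g h : Subset n → ℕ) X → ((λ Y → f Y + g Y) ⋆ h) X ≡ (f ⋆ h) X + (g ⋆ h) X
  ⋆-distribʳ-+ f g h []            = *-distribʳ-+ (h []) (f []) (g [])
  ⋆-distribʳ-+ f g h (outside ∷ X) = ⋆-distribʳ-+ (f ∘ (outside ∷_)) (g ∘ (outside ∷_)) (h ∘ (outside ∷_)) X
  ⋆-distribʳ-+ f g h (inside ∷ X)  = trans
    (cong₂ _+_ (⋆-distribʳ-+ (f ∘ (inside ∷_)) (g ∘ (inside ∷_)) (h ∘ (outside ∷_)) X)
               (⋆-distribʳ-+ (f ∘ (outside ∷_)) (g ∘ (outside ∷_)) (h ∘ (inside ∷_)) X))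
    (+-interchange (((f ∘ (inside ∷_)) ⋆ (h ∘ (outside ∷_))) X) _ _ _)

  ⋆-distribˡ-+ : ∀ (f g h : Subset n → ℕ) X → (f ⋆ (λ Y → g Y + h Y)) X ≡ (f ⋆ g) X + (f ⋆ h) X
  ⋆-distribˡ-+ f g h X = trans (⋆-comm f _ X) (trans (⋆-distribʳ-+ g h f X) (cong₂ _+_ (⋆-comm g f X) (⋆-comm h f X)))

  ⋆-assoc : ∀ (f g h : Subset n → ℕ) X → ((f ⋆ g) ⋆ h) X ≡ (f ⋆ (g ⋆ h)) X
  ⋆-assoc f g h []            = *-assoc (f []) (g []) (h [])
  ⋆-assoc f g h (outside ∷ X) = ⋆-assoc (f ∘ (outside ∷_)) (g ∘ (outside ∷_)) (h ∘ (outside ∷_)) X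
  ⋆-assoc f g h (inside ∷ X)  = begin
    ((λ Y → (f₁ ⋆ g₀) Y + (f₀ ⋆ g₁) Y) ⋆ h₀) X + ((f₀ ⋆ g₀) ⋆ h₁) X
      ≡⟨ cong (_+ ((f₀ ⋆ g₀) ⋆ h₁) X) (⋆-distribʳ-+ (f₁ ⋆ g₀) (f₀ ⋆ g₁) h₀ X) ⟩
    (((f₁ ⋆ g₀) ⋆ h₀) X + ((f₀ ⋆ g₁) ⋆ h₀) X) + ((f₀ ⋆ g₀) ⋆ h₁) X
      ≡⟨ cong₂ _+_ (cong₂ _+_ (⋆-assoc f₁ g₀ h₀ X) (⋆-assoc f₀ g₁ h₀ X)) (⋆-assoc f₀ g₀ h₁ X) ⟩
    ((f₁ ⋆ (g₀ ⋆ h₀)) X + (f₀ ⋆ (g₁ ⋆ h₀)) X) + (f₀ ⋆ (g₀ ⋆ h₁)) X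
      ≡⟨ +-assoc ((f₁ ⋆ (g₀ ⋆ h₀)) X) _ _ ⟩
    (f₁ ⋆ (g₀ ⋆ h₀)) X + ((f₀ ⋆ (g₁ ⋆ h₀)) X + (f₀ ⋆ (g₀ ⋆ h₁)) X)
      ≡⟨ cong ((f₁ ⋆ (g₀ ⋆ h₀)) X +_) (⋆-distribˡ-+ f₀ (g₁ ⋆ h₀) (g₀ ⋆ h₁) X) ⟨
    (f₁ ⋆ (g₀ ⋆ h₀)) X + (f₀ ⋆ (λ Y → (g₁ ⋆ h₀) Y + (g₀ ⋆ h₁) Y)) X ∎
    where
    open ≡-Reasoning
    f₀ = f ∘ (outside ∷_)
    f₁ = f ∘ (inside ∷_)
    g₀ = g ∘ (outside ∷_)
    g₁ = g ∘ (inside ∷_)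
    h₀ = h ∘ (outside ∷_)
    h₁ = h ∘ (inside ∷_)

  ⋆-vanishes : ∀ (f g : Subset n → ℕ) X → (∀ Y → Y ⊆ X → f Y * g (X ─ Y) ≡ 0) → (f ⋆ g) X ≡ 0
  ⋆-vanishes f g []            p = p [] ⊆-refl
  ⋆-vanishes f g (outside ∷ X) p =
    ⋆-vanishes (f ∘ (outside ∷_)) (g ∘ (outside ∷_)) X λ Y Y⊆X → p (outside ∷ Y) (out⊆ Y⊆X)
  ⋆-vanishes f g (inside ∷ X)  p = cong₂ _+_
    (⋆-vanishes (f ∘ (inside ∷_)) (g ∘ (outside ∷_)) X λ Y Y⊆X → p (inside ∷ Y) (in⊆in Y⊆X))
    (⋆-vanishes (f ∘ (outside ∷_)) (g ∘ (inside ∷_)) X λ Y Y⊆X → p (outside ∷ Y) (out⊆ Y⊆X))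

  -- Turns uniqueness of a splitting into a value. In the applications the supports of f and g leave
  -- Z as the only part of X that f can receive.
  ⋆-unique : ∀ (f g : Subset n → ℕ) X Z → Z ⊆ X → (∀ Y → Y ⊆ X → f Y * g (X ─ Y) ≡ 0 ⊎ Y ≡ Z) →
             (f ⋆ g) X ≡ f Z * g (X ─ Z)
  ⋆-unique f g []            []            Z⊆X p = refl
  ⋆-unique f g (outside ∷ X) (outside ∷ Z) Z⊆X p =
    ⋆-unique (f ∘ (outside ∷_)) (g ∘ (outside ∷_)) X Z (drop-∷-⊆ Z⊆X)
      λ Y Y⊆X → map₂ ∷-injectiveʳ (p (outside ∷ Y) (out⊆ Y⊆X))
  ⋆-unique f g (outside ∷ X) (inside ∷ Z)  Z⊆X p with () ← Z⊆X here
  ⋆-unique f g (inside ∷ X)  (inside ∷ Z)  Z⊆X p = trans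
    (cong₂ _+_
      (⋆-unique (f ∘ (inside ∷_)) (g ∘ (outside ∷_)) X Z (drop-∷-⊆ Z⊆X)
        λ Y Y⊆X → map₂ ∷-injectiveʳ (p (inside ∷ Y) (in⊆in Y⊆X)))
      (⋆-vanishes (f ∘ (outside ∷_)) (g ∘ (inside ∷_)) X λ Y Y⊆X → wrong (p (outside ∷ Y) (out⊆ Y⊆X))))
    (+-identityʳ _)
    where
    wrong : ∀ {Y a} → a ≡ 0 ⊎ outside ∷ Y ≡ inside ∷ Z → a ≡ 0
    wrong (inj₁ a≡0) = a≡0
  ⋆-unique f g (inside ∷ X)  (outside ∷ Z) Z⊆X p = cong₂ _+_
    (⋆-vanishes (f ∘ (inside ∷_)) (g ∘ (outside ∷_)) X λ Y Y⊆X → wrong (p (inside ∷ Y) (in⊆in Y⊆X)))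
    (⋆-unique (f ∘ (outside ∷_)) (g ∘ (inside ∷_)) X Z (drop-∷-⊆ Z⊆X)
      λ Y Y⊆X → map₂ ∷-injectiveʳ (p (outside ∷ Y) (out⊆ Y⊆X)))
    where
    wrong : ∀ {Y a} → a ≡ 0 ⊎ inside ∷ Y ≡ outside ∷ Z → a ≡ 0
    wrong (inj₁ a≡0) = a≡0

  ⋆-insert : ∀ (f g : Subset n → ℕ) X b → b ∉ X →
             (f ⋆ g) (X [ b ]≔ inside) ≡
             ((λ Y → f (Y [ b ]≔ inside)) ⋆ g) X + (f ⋆ (λ Y → g (Y [ b ]≔ inside))) X
  ⋆-insert f g (inside ∷ X)  zero    b∉X = contradiction here b∉X
  ⋆-insert f g (outside ∷ X) zero    b∉X = refl
  ⋆-insert f g (outside ∷ X) (suc b) b∉X = ⋆-insert (f ∘ (outside ∷_)) (g ∘ (outside ∷_)) X b (drop-not-there b∉X)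
  ⋆-insert f g (inside ∷ X)  (suc b) b∉X = trans
    (cong₂ _+_ (⋆-insert (f ∘ (inside ∷_)) (g ∘ (outside ∷_)) X b (drop-not-there b∉X))
               (⋆-insert (f ∘ (outside ∷_)) (g ∘ (inside ∷_)) X b (drop-not-there b∉X)))
    (+-interchange ((_ ⋆ (g ∘ (outside ∷_))) X) _ _ _)

  ∣X∣≡∣Y∣+∣X─Y∣ : ∀ (X Y : Subset n) → Y ⊆ X → ∣ X ∣ ≡ ∣ Y ∣ + ∣ X ─ Y ∣
  ∣X∣≡∣Y∣+∣X─Y∣ []            []            Y⊆X = refl
  ∣X∣≡∣Y∣+∣X─Y∣ (outside ∷ X) (outside ∷ Y) Y⊆X = ∣X∣≡∣Y∣+∣X─Y∣ X Y (drop-∷-⊆ Y⊆X)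
  ∣X∣≡∣Y∣+∣X─Y∣ (outside ∷ X) (inside ∷ Y)  Y⊆X with () ← Y⊆X here
  ∣X∣≡∣Y∣+∣X─Y∣ (inside ∷ X)  (outside ∷ Y) Y⊆X =
    trans (cong suc (∣X∣≡∣Y∣+∣X─Y∣ X Y (drop-∷-⊆ Y⊆X))) (sym (+-suc ∣ Y ∣ ∣ X ─ Y ∣))
  ∣X∣≡∣Y∣+∣X─Y∣ (inside ∷ X)  (inside ∷ Y)  Y⊆X = cong suc (∣X∣≡∣Y∣+∣X─Y∣ X Y (drop-∷-⊆ Y⊆X))

  ⋆-supported : ∀ {f g : Subset n → ℕ} {P Q : Subset n → Set} →
                (∀ Y → f Y ≡ 0 ⊎ P Y) → (∀ Y → g Y ≡ 0 ⊎ Q Y) → ∀ {R : Set} → Dec R → ∀ X →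
                (∀ Y → Y ⊆ X → P Y → Q (X ─ Y) → R) → (f ⋆ g) X ≡ 0 ⊎ R
  ⋆-supported p q (yes r) X h = inj₂ r
  ⋆-supported {f = f} {g} p q (no ¬r) X h = inj₁ (⋆-vanishes f g X λ Y Y⊆X → term Y Y⊆X (p Y) (q (X ─ Y)))
    where
    term : ∀ Y → Y ⊆ X → _ → _ → f Y * g (X ─ Y) ≡ 0
    term Y Y⊆X (inj₁ fY≡0) _           = cong (_* g (X ─ Y)) fY≡0
    term Y Y⊆X (inj₂ _)    (inj₁ gZ≡0) = trans (cong (f Y *_) gZ≡0) (*-zeroʳ (f Y))
    term Y Y⊆X (inj₂ pY)   (inj₂ qZ)   = contradiction (h Y Y⊆X pY qZ) ¬r

  -- The unit of `⋆`: the indicator of the empty set, which counts decompositions when there are no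
  -- pieces.
  ε : Subset n → ℕ
  ε []            = 1
  ε (outside ∷ X) = ε X
  ε (inside ∷ X)  = 0

  ⋆-identityˡ : ∀ (f : Subset n → ℕ) X → (ε ⋆ f) X ≡ f X
  ⋆-identityˡ f []            = +-identityʳ (f [])
  ⋆-identityˡ f (outside ∷ X) = ⋆-identityˡ (f ∘ (outside ∷_)) X
  ⋆-identityˡ f (inside ∷ X)  = cong₂ _+_ (⋆-vanishes (λ _ → 0) (f ∘ (outside ∷_)) X λ _ _ → refl)
                                          (⋆-identityˡ (f ∘ (inside ∷_)) X)

  -- The contribution of one piece: Y is the set of vertices at which a walk uses α, and c will be d
  -- - 2.
  single : Subset n → ℕ → Subset n → ℕ
  single α c Y with Y ⊆? α ×-dec ∣ Y ∣ ≤? c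
  ... | yes _ = 1
  ... | no _  = 0

  single-one : ∀ {α : Subset n} {c Y} → Y ⊆ α → ∣ Y ∣ ≤ c → single α c Y ≡ 1
  single-one {α = α} {c} {Y} Y⊆α ∣Y∣≤c with Y ⊆? α ×-dec ∣ Y ∣ ≤? c
  ... | yes _ = refl
  ... | no ¬p = contradiction ((λ {x} → Y⊆α {x}) , ∣Y∣≤c) ¬p

  single-supported : ∀ (α : Subset n) c Y → single α c Y ≡ 0 ⊎ (Y ⊆ α × ∣ Y ∣ ≤ c)
  single-supported α c Y with Y ⊆? α ×-dec ∣ Y ∣ ≤? c
  ... | yes p = inj₂ p
  ... | no _  = inj₁ refl

  ε-supported : ∀ (Y : Subset n) → ε Y ≡ 0 ⊎ Y ≡ ⊥
  ε-supported []            = inj₂ refl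
  ε-supported (inside ∷ Y)  = inj₁ refl
  ε-supported (outside ∷ Y) = map₂ (cong (outside ∷_)) (ε-supported Y)

-- Insertion, removal and comprehension in finite subsets

module Membership where
  open import Data.Bool using (true)
  open import Data.Fin using (Fin; zero; suc)
  open import Data.Fin.Properties using (_≟_)
  open import Data.Fin.Subset using (Subset; inside; outside; _∈_; _∉_; _─_; ∣_∣)
  open import Data.Nat using (ℕ; suc; _≤_; s≤s)
  open import Data.Nat.Properties using (≤-refl; m≤n⇒m≤1+n)
  open import Data.Product using (_×_; _,_)
  open import Data.Sum using (_⊎_; inj₁; inj₂)
  open import Data.Vec using (_∷_; _[_]≔_; here; there; tabulate)
  open import Data.Vec.Properties using ([]≔-updates; []≔-minimal; lookup∘update′; []=⇒lookup;
    lookup⇒[]=; lookup∘tabulate)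
  open import Function using (_∘_)
  open import Relation.Binary.PropositionalEquality
  open import Relation.Nullary using (Dec; yes; no; ⌊_⌋; contradiction)

  private variable n : ℕ

  ∈-insert : ∀ (X : Subset n) b → b ∈ X [ b ]≔ inside
  ∈-insert X b = []≔-updates X b

  ∈-insert⁺ : ∀ {X : Subset n} b {v} → v ∈ X → v ∈ X [ b ]≔ inside
  ∈-insert⁺ {X = X} b {v} v∈X with v ≟ b
  ... | yes refl = ∈-insert X b
  ... | no v≢b   = []≔-minimal X v b v≢b v∈X

  ∈-insert⁻ : ∀ {X : Subset n} b {v} → v ∈ X [ b ]≔ inside → v ≡ b ⊎ v ∈ X
  ∈-insert⁻ {X = X} b {v} v∈ with v ≟ b
  ... | yes v≡b = inj₁ v≡b
  ... | no v≢b  = inj₂ (lookup⇒[]= v X (trans (sym (lookup∘update′ v≢b X inside)) ([]=⇒lookup v∈)))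

  ∣insert∣ : ∀ (X : Subset n) b → b ∉ X → ∣ X [ b ]≔ inside ∣ ≡ suc ∣ X ∣
  ∣insert∣ (inside ∷ X)  zero    b∉X = contradiction here b∉X
  ∣insert∣ (outside ∷ X) zero    b∉X = refl
  ∣insert∣ (inside ∷ X)  (suc b) b∉X = cong suc (∣insert∣ X b (b∉X ∘ there))
  ∣insert∣ (outside ∷ X) (suc b) b∉X = ∣insert∣ X b (b∉X ∘ there)

  ∣insert∣≤ : ∀ (X : Subset n) b → ∣ X [ b ]≔ inside ∣ ≤ suc ∣ X ∣
  ∣insert∣≤ (inside ∷ X)  zero    = m≤n⇒m≤1+n ≤-refl
  ∣insert∣≤ (outside ∷ X) zero    = ≤-refl
  ∣insert∣≤ (inside ∷ X)  (suc b) = s≤s (∣insert∣≤ X b)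
  ∣insert∣≤ (outside ∷ X) (suc b) = ∣insert∣≤ X b

  ∈-─⁻ : ∀ (X Y : Subset n) {v} → v ∈ X ─ Y → v ∈ X × v ∉ Y
  ∈-─⁻ (x ∷ X)       (outside ∷ Y) here      = here , λ ()
  ∈-─⁻ (x ∷ X)       (outside ∷ Y) (there p) with ∈-─⁻ X Y p
  ... | v∈X , v∉Y = there v∈X , λ { (there v∈Y) → v∉Y v∈Y }
  ∈-─⁻ (x ∷ X)       (inside ∷ Y)  (there p) with ∈-─⁻ X Y p
  ... | v∈X , v∉Y = there v∈X , λ { (there v∈Y) → v∉Y v∈Y }

  module _ {P : Fin n → Set} (P? : ∀ v → Dec (P v)) where
    ∈-tabulate⁺ : ∀ {v} → P v → v ∈ tabulate (λ v → ⌊ P? v ⌋)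
    ∈-tabulate⁺ {v} Pv = lookup⇒[]= v _ (trans (lookup∘tabulate _ v) holds)
      where
      holds : ⌊ P? v ⌋ ≡ true
      holds with P? v
      ... | yes _  = refl
      ... | no ¬Pv = contradiction Pv ¬Pv

    ∈-tabulate⁻ : ∀ {v} → v ∈ tabulate (λ v → ⌊ P? v ⌋) → P v
    ∈-tabulate⁻ {v} v∈ = holds (trans (sym (lookup∘tabulate _ v)) ([]=⇒lookup v∈))
      where
      holds : ⌊ P? v ⌋ ≡ true → P v
      holds eq with P? v
      ... | yes Pv = Pv

-- Walks as decompositions of a vertex set

module Decompositions where
  open import Data.Fin using (Fin; zero; suc; _≟_)
  open import Data.Fin.Properties using (suc-injective)
  open import Data.Fin.Subset using (Subset; inside; outside; _∈_; _∉_; _⊆_; _─_; ∣_∣; ⊥)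
  open import Data.Fin.Subset.Properties using (_∈?_; ∉⊥; ⊥⊆; ∣⊥∣≡0)
  open import Data.List as List using (List; []; _∷_; length; filter; map; allFin;
    cartesianProductWith)
  open import Data.Nat.ListAction using () renaming (sum to sumList)
  open import Data.List.Properties using (length-++; filter-++; filter-≐; filter-none)
  open import Data.List.Relation.Unary.All using (universal)
  open import Data.Nat using (ℕ; zero; suc; pred; _+_; _*_; _≤_; _<_; _<?_; z≤n; s≤s; s≤s⁻¹)
  open import Data.Nat.Properties hiding (_≟_; _<?_; suc-injective)
  open import Data.Product using (_×_; _,_; ∃; proj₁; proj₂)
  open import Data.Sum using (inj₁; inj₂)
  open import Data.Vec as Vec using (Vec; []; _∷_; _[_]≔_; count)
  open import Function using (_∘_; _⇔_; Equivalence; mk⇔; id)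
  open import Function.Definitions using (Injective)
  open import Relation.Binary.PropositionalEquality
  open import Relation.Nullary using (Dec; yes; no; contradiction; ¬_; _×-dec_)
  open import Relation.Unary using (Decidable)
  import Algebra.Properties.CommutativeMonoid.Sum as CMSum
  open CMSum +-0-commutativeMonoid using () renaming (sum to sumℕ; sum-cong-≗ to sumℕ-cong)
  open Convolution
  open Membership

  private variable m n k : ℕ

  -- The number of ways to write X as a disjoint union of sets Y l ⊆ α l
  -- with at most c l elements.
  decompositions : (Fin m → Subset n) → (Fin m → ℕ) → Subset n → ℕ
  decompositions {zero}  α c = ε
  decompositions {suc m} α c = single (α zero) (c zero) ⋆ decompositions (α ∘ suc) (c ∘ suc)

  decompositions-cong : ∀ {α : Fin m → Subset n} {c d} → (∀ l → c l ≡ d l) →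
                        ∀ X → decompositions α c X ≡ decompositions α d X
  decompositions-cong {zero}          p X = refl
  decompositions-cong {suc m} {α = α} p X =
    ⋆-cong (λ Y → cong (λ a → single (α zero) a Y) (p zero)) (decompositions-cong (p ∘ suc)) X

  private
    ⋆-⊥ : ∀ (f g : Subset n → ℕ) → (f ⋆ g) ⊥ ≡ f ⊥ * g ⊥
    ⋆-⊥ {zero}  f g = refl
    ⋆-⊥ {suc n} f g = ⋆-⊥ (f ∘ (outside ∷_)) (g ∘ (outside ∷_))

    ε-⊥ : ε (⊥ {n}) ≡ 1
    ε-⊥ {zero}  = refl
    ε-⊥ {suc n} = ε-⊥ {n}

    ε-insert : ∀ (X : Subset n) b → ε (X [ b ]≔ inside) ≡ 0
    ε-insert (x ∷ X)       zero    = refl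
    ε-insert (inside ∷ X)  (suc b) = refl
    ε-insert (outside ∷ X) (suc b) = ε-insert X b

  decompositions-⊥ : ∀ (α : Fin m → Subset n) c → decompositions α c ⊥ ≡ 1
  decompositions-⊥ {zero}  {n} α c = ε-⊥ {n}
  decompositions-⊥ {suc m} {n} α c = trans (⋆-⊥ (single (α zero) (c zero)) _)
    (cong₂ _*_ (single-one {Y = ⊥ {n}} ⊥⊆ (≤-trans (≤-reflexive (∣⊥∣≡0 n)) z≤n)) (decompositions-⊥ (α ∘ suc) (c ∘ suc)))

  decrement : Fin m → (Fin m → ℕ) → Fin m → ℕ
  decrement l c l′ with l ≟ l′
  ... | yes _ = pred (c l′)
  ... | no _  = c l′

  Usable : Fin n → (Fin m → Subset n) → (Fin m → ℕ) → Fin m → Set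
  Usable b α c l = b ∈ α l × 0 < c l

  usable? : ∀ b (α : Fin m → Subset n) c l → Dec (Usable b α c l)
  usable? b α c l = b ∈? α l ×-dec 0 <? c l

  -- The decompositions of X together with b that give b to piece l: one unit of its capacity is
  -- spent, and there are none if l cannot take b.
  place : Fin n → (Fin m → Subset n) → (Fin m → ℕ) → Fin m → Subset n → ℕ
  place b α c l X with usable? b α c l
  ... | yes _ = decompositions α (decrement l c) X
  ... | no _  = 0

  private
    ⋆-sum : ∀ (f : Subset n → ℕ) (g : Fin m → Subset n → ℕ) X →
            (f ⋆ (λ Y → sumℕ (λ l → g l Y))) X ≡ sumℕ (λ l → (f ⋆ g l) X)
    ⋆-sum {m = zero}  f g X = ⋆-vanishes f (λ _ → 0) X λ Y _ → *-zeroʳ (f Y)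
    ⋆-sum {m = suc m} f g X = trans (⋆-distribˡ-+ f (g zero) _ X) (cong ((f ⋆ g zero) X +_) (⋆-sum f (g ∘ suc) X))

    decrement-suc : ∀ (l l′ : Fin m) c → decrement (suc l) c (suc l′) ≡ decrement l (c ∘ suc) l′
    decrement-suc l l′ c with l ≟ l′
    ... | yes _ = refl
    ... | no _  = refl

    single-insert : ∀ {α : Subset n} {c b Y} → b ∈ α → 0 < c → b ∉ Y →
                    single α c (Y [ b ]≔ inside) ≡ single α (pred c) Y
    single-insert {α = α} {suc c} {b} {Y} b∈α _ b∉Y with single-supported α c Y
    ... | inj₂ (Y⊆α , ∣Y∣≤c) = trans
      (single-one inside⊆α (≤-trans (≤-reflexive (∣insert∣ Y b b∉Y)) (s≤s ∣Y∣≤c))) (sym (single-one Y⊆α ∣Y∣≤c))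
      where
      inside⊆α : Y [ b ]≔ inside ⊆ α
      inside⊆α v∈ with ∈-insert⁻ b v∈
      ... | inj₁ refl = b∈α
      ... | inj₂ v∈Y  = Y⊆α v∈Y
    ... | inj₁ eq with single-supported α (suc c) (Y [ b ]≔ inside)
    ...   | inj₁ eq′ = trans eq′ (sym eq)
    ...   | inj₂ (⊆α , ≤c) = contradiction
      (trans (sym eq) (single-one (λ v∈Y → ⊆α (∈-insert⁺ b v∈Y)) (s≤s⁻¹ (≤-trans (≤-reflexive (sym (∣insert∣ Y b b∉Y))) ≤c))))
      λ ()

    single-unusable : ∀ {α : Subset n} {c b} → ¬ (b ∈ α × 0 < c) → ∀ Y → single α c (Y [ b ]≔ inside) ≡ 0
    single-unusable {α = α} {c} {b} ¬usable Y with single-supported α c (Y [ b ]≔ inside)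
    ... | inj₁ eq = eq
    ... | inj₂ (⊆α , ≤c) = contradiction (⊆α (∈-insert Y b) , ≤-trans nonempty ≤c) ¬usable
      where
      nonempty : 0 < ∣ Y [ b ]≔ inside ∣
      nonempty = go Y b
        where
        go : ∀ {n} (Y : Subset n) b → 0 < ∣ Y [ b ]≔ inside ∣
        go (y ∷ Y)       zero    = s≤s z≤n
        go (inside ∷ Y)  (suc b) = s≤s z≤n
        go (outside ∷ Y) (suc b) = go Y b

  -- The product rule for ⋆, with decompositions a product of m factors.
  decompositions-insert : ∀ (α : Fin m → Subset n) c {X b} → b ∉ X →
                          decompositions α c (X [ b ]≔ inside) ≡ sumℕ (λ l → place b α c l X)
  decompositions-insert {zero}  α c {X} {b} b∉X = ε-insert X b
  decompositions-insert {suc m} α c {X} {b} b∉X =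
    trans (⋆-insert first rest X b b∉X) (cong₂ _+_ head-term tail-terms)
    where
    first = single (α zero) (c zero)
    rest  = decompositions (α ∘ suc) (c ∘ suc)
    head-term : ((λ Y → first (Y [ b ]≔ inside)) ⋆ rest) X ≡ place b α c zero X
    head-term with usable? b α c zero
    ... | yes (b∈α , 0<c) = ⋆-cong-⊆ X
      (λ Y Y⊆X → single-insert b∈α 0<c (b∉X ∘ Y⊆X))
      (λ Y _ → decompositions-cong {m} {α = α ∘ suc} (λ l → refl) Y)
    ... | no ¬usable = ⋆-vanishes _ rest X λ Y _ → cong (_* rest (X ─ Y)) (single-unusable ¬usable Y)
    tail-term : ∀ l → (first ⋆ place b (α ∘ suc) (c ∘ suc) l) X ≡ place b α c (suc l) X
    tail-term l with usable? b (α ∘ suc) (c ∘ suc) l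
    ... | yes _ = ⋆-cong (λ Y → refl) (decompositions-cong λ l′ → sym (decrement-suc l l′ c)) X
    ... | no _  = ⋆-vanishes first _ X λ Y _ → *-zeroʳ (first Y)
    tail-terms : (first ⋆ (λ Y → rest (Y [ b ]≔ inside))) X ≡ sumℕ (λ l → place b α c (suc l) X)
    tail-terms = trans
      (⋆-cong-⊆ {f = first} X (λ _ _ → refl) λ Y Y⊆X → decompositions-insert (α ∘ suc) (c ∘ suc) (b∉X ∘ Y⊆X))
      (trans (⋆-sum first (place b (α ∘ suc) (c ∘ suc)) X) (sumℕ-cong tail-term))

  image : (Fin k → Fin n) → Subset n
  image {zero}  vs = ⊥
  image {suc k} vs = image (vs ∘ suc) [ vs zero ]≔ inside

  ∈-image⁺ : ∀ (vs : Fin k → Fin n) t → vs t ∈ image vs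
  ∈-image⁺ vs zero    = ∈-insert (image (vs ∘ suc)) (vs zero)
  ∈-image⁺ vs (suc t) = ∈-insert⁺ (vs zero) (∈-image⁺ (vs ∘ suc) t)

  ∈-image⁻ : ∀ (vs : Fin k → Fin n) {v} → v ∈ image vs → ∃ λ t → vs t ≡ v
  ∈-image⁻ {zero}  vs v∈ = contradiction v∈ ∉⊥
  ∈-image⁻ {suc k} vs v∈ with ∈-insert⁻ (vs zero) v∈
  ... | inj₁ refl = zero , refl
  ... | inj₂ v∈′ with ∈-image⁻ (vs ∘ suc) v∈′
  ...   | t , eq = suc t , eq

  -- The walk condition for an arbitrary list of vertices and arbitrary capacities, so that dropping
  -- the first vertex and lowering one capacity stays within the notion.
  Fits : (Fin m → Subset n) → (Fin m → ℕ) → (Fin k → Fin n) → Vec (Fin m) k → Set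
  Fits α c vs p = (∀ t → vs t ∈ α (Vec.lookup p t)) × (∀ l → count (_≟ l) p ≤ c l)

  private
    fits-∷ : ∀ (α : Fin m → Subset n) c (vs : Fin (suc k) → Fin n) l p →
             Fits α c vs (l ∷ p) ⇔ (Usable (vs zero) α c l × Fits α (decrement l c) (vs ∘ suc) p)
    fits-∷ α c vs l p = mk⇔ to from
      where
      to : Fits α c vs (l ∷ p) → Usable (vs zero) α c l × Fits α (decrement l c) (vs ∘ suc) p
      to (incident , capacity) = (incident zero , positive) , (incident ∘ suc , remaining)
        where
        positive : 0 < c l
        positive with l ≟ l | capacity l
        ... | yes _  | le = ≤-trans (s≤s z≤n) le
        ... | no l≢l | _  = contradiction refl l≢l
        remaining : ∀ l′ → count (_≟ l′) p ≤ decrement l c l′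
        remaining l′ with l ≟ l′ | capacity l′
        ... | yes _ | le = <⇒≤pred le
        ... | no _  | le = le
      from : Usable (vs zero) α c l × Fits α (decrement l c) (vs ∘ suc) p → Fits α c vs (l ∷ p)
      from ((here∈ , positive) , (incident , remaining)) = (λ { zero → here∈ ; (suc t) → incident t }) , capacity
        where
        capacity : ∀ l′ → count (_≟ l′) (l ∷ p) ≤ c l′
        capacity l′ with l ≟ l′ | remaining l′
        ... | yes refl | le = ≤pred⇒< positive le
          where
          ≤pred⇒< : ∀ {a b} → 0 < b → a ≤ pred b → a < b
          ≤pred⇒< {b = suc b} _ le = s≤s le
        ... | no _     | le = le

    length-filter-map : ∀ {A B : Set} {P : B → Set} (P? : Decidable P) (f : A → B) xs →
                        length (filter P? (map f xs)) ≡ length (filter (P? ∘ f) xs)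
    length-filter-map P? f []       = refl
    length-filter-map P? f (x ∷ xs) with P? (f x)
    ... | yes _ = cong suc (length-filter-map P? f xs)
    ... | no _  = length-filter-map P? f xs

    length-filter-product : ∀ {A B C : Set} {P : C → Set} (P? : Decidable P) (f : A → B → C) xs ys →
      length (filter P? (cartesianProductWith f xs ys)) ≡ sumList (map (λ x → length (filter (P? ∘ f x) ys)) xs)
    length-filter-product P? f []       ys = refl
    length-filter-product P? f (x ∷ xs) ys = trans
      (cong length (filter-++ P? (map (f x) ys) (cartesianProductWith f xs ys)))
      (trans (length-++ (filter P? (map (f x) ys)))
        (cong₂ _+_ (length-filter-map P? (f x) ys) (length-filter-product P? f xs ys)))

    sum-tabulate : ∀ {A : Set} (f : A → ℕ) (g : Fin m → A) → sumList (map f (List.tabulate g)) ≡ sumℕ (f ∘ g)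
    sum-tabulate {zero}  f g = refl
    sum-tabulate {suc m} f g = cong (f (g zero) +_) (sum-tabulate f (g ∘ suc))

  -- Reading off the first entry of a sequence matches decompositions-insert.
  count-fitting : ∀ (α : Fin m → Subset n) c (vs : Fin k → Fin n) → Injective _≡_ _≡_ vs →
                  (fits? : Decidable (Fits α c vs)) →
                  length (filter fits? (sequences m k)) ≡ decompositions α c (image vs)
  count-fitting {k = zero} α c vs inj fits? with fits? []
  ... | yes _ = sym (decompositions-⊥ α c)
  ... | no ¬p = contradiction ((λ ()) , λ _ → z≤n) ¬p
  count-fitting {m = m} {k = suc k} α c vs inj fits? = begin
    length (filter fits? (cartesianProductWith _∷_ (allFin m) (sequences m k)))
      ≡⟨ length-filter-product fits? _∷_ (allFin m) (sequences m k) ⟩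
    sumList (map (λ l → length (filter (fits? ∘ (l ∷_)) (sequences m k))) (allFin m))
      ≡⟨ sum-tabulate (λ l → length (filter (fits? ∘ (l ∷_)) (sequences m k))) id ⟩
    sumℕ (λ l → length (filter (fits? ∘ (l ∷_)) (sequences m k)))
      ≡⟨ sumℕ-cong term ⟩
    sumℕ (λ l → place (vs zero) α c l (image (vs ∘ suc)))
      ≡⟨ decompositions-insert α c fresh ⟨
    decompositions α c (image vs) ∎
    where
    open ≡-Reasoning
    fresh : vs zero ∉ image (vs ∘ suc)
    fresh v∈ with ∈-image⁻ (vs ∘ suc) v∈
    ... | t , eq with () ← inj eq
    term : ∀ l → length (filter (fits? ∘ (l ∷_)) (sequences m k)) ≡ place (vs zero) α c l (image (vs ∘ suc))
    term l with usable? (vs zero) α c l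
    ... | no ¬usable = cong length (filter-none (fits? ∘ (l ∷_))
      (universal (λ p fits → ¬usable (proj₁ (Equivalence.to (fits-∷ α c vs l p) fits))) (sequences m k)))
    ... | yes usable = trans
      (cong length (filter-≐ (fits? ∘ (l ∷_)) rest?
        ((λ {p} fits → proj₂ (Equivalence.to (fits-∷ α c vs l p) fits)) ,
         (λ {p} fits → Equivalence.from (fits-∷ α c vs l p) (usable , fits)))
        (sequences m k)))
      (count-fitting α (decrement l c) (vs ∘ suc) (suc-injective ∘ inj) rest?)
      where
      rest? : Decidable (Fits α (decrement l c) (vs ∘ suc))
      rest? p with fits? (l ∷ p)
      ... | yes fits = yes (proj₂ (Equivalence.to (fits-∷ α c vs l p) fits))
      ... | no ¬fits = no λ fits → ¬fits (Equivalence.from (fits-∷ α c vs l p) (usable , fits))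

-- Arcs of the polygon and walks along them

module Arcs where
  open import Data.Fin using (Fin; toℕ; fromℕ<)
  open import Data.Fin.Properties using (toℕ-injective; toℕ<n; toℕ-fromℕ<; nonZeroIndex)
  open import Data.Fin.Subset using (Subset; _∈_)
  open import Data.Fin.Subset.Properties using (⊆-antisym)
  open import Data.List using (length; filter)
  open import Data.List.Properties using (filter-≐; filter-none)
  open import Data.List.Relation.Unary.All using (universal)
  open import Data.Nat hiding (_≟_)
  open import Data.Nat.DivMod
  open import Data.Nat.Properties hiding (_≟_)
  open import Data.Product using (_×_; _,_; ∃; proj₁; proj₂)
  open import Data.Sum using (_⊎_; inj₁; inj₂)
  open import Data.Vec using (tabulate)
  open import Function.Definitions using (Injective)
  open import Relation.Binary.PropositionalEquality
  open import Relation.Nullary using (Dec; yes; no; ⌊_⌋; contradiction; _×-dec_; _⊎-dec_)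
  open import Relation.Unary using (Decidable)
  open Membership
  open Decompositions

  private variable n : ℕ

  -- The open counterclockwise arc from i to j; the one from i to i contains
  -- all vertices but i.
  Arc : ℕ → ℕ → ℕ → Set
  Arc i j v = (i < v × v < j) ⊎ (j ≤ i × (i < v ⊎ v < j))

  arc? : ∀ i j v → Dec (Arc i j v)
  arc? i j v = (i <? v ×-dec v <? j) ⊎-dec (j ≤? i ×-dec (i <? v ⊎-dec v <? j))

  arc : Fin n → Fin n → Subset n
  arc i j = tabulate λ v → ⌊ arc? (toℕ i) (toℕ j) (toℕ v) ⌋

  ∈-arc⁺ : ∀ {i j v : Fin n} → Arc (toℕ i) (toℕ j) (toℕ v) → v ∈ arc i j
  ∈-arc⁺ {i = i} {j} = ∈-tabulate⁺ λ v → arc? (toℕ i) (toℕ j) (toℕ v)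

  ∈-arc⁻ : ∀ {i j v : Fin n} → v ∈ arc i j → Arc (toℕ i) (toℕ j) (toℕ v)
  ∈-arc⁻ {i = i} {j} = ∈-tabulate⁻ λ v → arc? (toℕ i) (toℕ j) (toℕ v)

  module _ {n} (i j : Fin n) where
    private
      instance _ = nonZeroIndex i
      a b k : ℕ
      a = toℕ i
      b = toℕ j
      k = between i j

      rotate : ∀ a t → a + suc t ≡ t + suc a
      rotate a t = trans (+-suc a t) (trans (cong suc (+-comm a t)) (sym (+-suc t a)))

      k<n : k < n
      k<n = m%n<n (b + n ∸ suc a) n

      -- Here and in `between-backward` the truncated subtraction and the remainder in `between` are
      -- traded for an equation between sums, with n added on the right when the arc wraps around.
      -- Later comparisons then reduce to cancellation.
      between-forward : a < b → k + suc a ≡ b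
      between-forward a<b = begin
        (b + n ∸ suc a) % n + suc a    ≡⟨ cong (λ x → x % n + suc a) (+-∸-comm n a<b) ⟩
        (b ∸ suc a + n) % n + suc a    ≡⟨ cong (_+ suc a) ([m+n]%n≡m%n (b ∸ suc a) n) ⟩
        (b ∸ suc a) % n + suc a        ≡⟨ cong (_+ suc a) (m<n⇒m%n≡m (≤-<-trans (m∸n≤m b (suc a)) (toℕ<n j))) ⟩
        b ∸ suc a + suc a              ≡⟨ m∸n+n≡m a<b ⟩
        b                              ∎
        where open ≡-Reasoning

      between-backward : b ≤ a → k + suc a ≡ b + n
      between-backward b≤a = trans
        (cong (_+ suc a) (m<n⇒m%n≡m (+-cancelʳ-< (suc a) _ n
          (subst₂ _<_ (sym (m∸n+n≡m a<b+n)) (+-comm (suc a) n) (+-monoˡ-≤ n (s≤s b≤a))))))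
        (m∸n+n≡m a<b+n)
        where
        a<b+n : a < b + n
        a<b+n = ≤-trans (toℕ<n i) (m≤n+m n b)

      -- Both a and t are below n, so a + t + 1 is below 2n and the remainder subtracts n at most
      -- once.
      ahead-cases : ∀ {t} → t < n →
        (toℕ (ahead i t) ≡ t + suc a × toℕ (ahead i t) < n) ⊎ toℕ (ahead i t) + n ≡ t + suc a
      ahead-cases {t} t<n with a + suc t <? n
      ... | yes lt = inj₁ (trans (toℕ-fromℕ< _) (trans (m<n⇒m%n≡m lt) (rotate a t)) , toℕ<n _)
      ... | no ≮n  = inj₂ (begin
        toℕ (ahead i t) + n              ≡⟨ cong (_+ n) (toℕ-fromℕ< _) ⟩
        (a + suc t) % n + n              ≡⟨ cong (_+ n) (m≤n⇒[n∸m]%m≡n%m n≤) ⟨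
        (a + suc t ∸ n) % n + n          ≡⟨ cong (_+ n) (m<n⇒m%n≡m (+-cancelʳ-< n _ n
                                              (subst (_< n + n) (sym (m∸n+n≡m n≤)) (+-mono-<-≤ (toℕ<n i) t<n)))) ⟩
        a + suc t ∸ n + n                ≡⟨ m∸n+n≡m n≤ ⟩
        a + suc t                        ≡⟨ rotate a t ⟩
        t + suc a                        ∎)
        where
        open ≡-Reasoning
        n≤ : n ≤ a + suc t
        n≤ = ≮⇒≥ ≮n

    between-bound : between i j < n
    between-bound = k<n

    ahead-injective : ∀ {s t} → s < n → t < n → ahead i s ≡ ahead i t → s ≡ t
    ahead-injective {s} {t} s<n t<n eq with ahead-cases s<n | ahead-cases t<n
    ... | inj₁ (p , _) | inj₁ (q , _) = +-cancelʳ-≡ (suc a) s t (trans (sym p) (trans (cong toℕ eq) q))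
    ... | inj₂ p       | inj₂ q       = +-cancelʳ-≡ (suc a) s t (trans (sym p) (trans (cong (λ v → toℕ v + n) eq) q))
    ... | inj₁ (p , _) | inj₂ q       = contradiction t<n (≤⇒≯ (≤-trans (m≤n+m n s) (≤-reflexive
      (+-cancelʳ-≡ (suc a) (s + n) t (trans (+-assoc-comm s n (suc a)) (trans (cong (_+ n) (trans (sym p) (cong toℕ eq))) q))))))
      where
      +-assoc-comm : ∀ x y z → x + y + z ≡ x + z + y
      +-assoc-comm x y z = trans (+-assoc x y z) (trans (cong (x +_) (+-comm y z)) (sym (+-assoc x z y)))
    ... | inj₂ p       | inj₁ (q , _) = contradiction s<n (≤⇒≯ (≤-trans (m≤n+m n t) (≤-reflexive
      (+-cancelʳ-≡ (suc a) (t + n) s (trans (+-assoc-comm t n (suc a)) (trans (cong (_+ n) (trans (sym q) (cong toℕ (sym eq)))) p))))))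
      where
      +-assoc-comm : ∀ x y z → x + y + z ≡ x + z + y
      +-assoc-comm x y z = trans (+-assoc x y z) (trans (cong (x +_) (+-comm y z)) (sym (+-assoc x z y)))

    ahead-in-arc : ∀ {t} → t < k → Arc a b (toℕ (ahead i t))
    ahead-in-arc {t} t<k with ahead-cases (<-trans t<k k<n) | a <? b
    ... | inj₁ (p , _) | yes a<b = inj₁ (≤-trans (m≤n+m (suc a) t) (≤-reflexive (sym p)) ,
      subst₂ _<_ (sym p) (between-forward a<b) (+-monoˡ-< (suc a) t<k))
    ... | inj₂ p | yes a<b = contradiction (toℕ<n j) (≤⇒≯ (begin
      n                      ≤⟨ m≤n+m n _ ⟩
      toℕ (ahead i t) + n    ≡⟨ p ⟩
      t + suc a              ≤⟨ +-monoˡ-≤ (suc a) (<⇒≤ t<k) ⟩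
      k + suc a              ≡⟨ between-forward a<b ⟩
      b                      ∎))
      where open ≤-Reasoning
    ... | inj₁ (p , _) | no a≮b = inj₂ (≮⇒≥ a≮b , inj₁ (≤-trans (m≤n+m (suc a) t) (≤-reflexive (sym p))))
    ... | inj₂ p | no a≮b = inj₂ (≮⇒≥ a≮b , inj₂ (+-cancelʳ-< n _ b
      (subst₂ _<_ (sym p) (between-backward (≮⇒≥ a≮b)) (+-monoˡ-< (suc a) t<k))))

    arc-reached : ∀ {v : Fin n} → Arc a b (toℕ v) → ∃ λ t → t < k × ahead i t ≡ v
    arc-reached {v} (inj₁ (a<v , v<b)) = t , t<k , toℕ-injective reached
      where
      t = toℕ v ∸ suc a
      t-spec : t + suc a ≡ toℕ v
      t-spec = m∸n+n≡m a<v
      t<k : t < k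
      t<k = +-cancelʳ-< (suc a) t k (subst₂ _<_ (sym t-spec) (sym (between-forward (<-trans a<v v<b))) v<b)
      reached : toℕ (ahead i t) ≡ toℕ v
      reached with ahead-cases (<-trans t<k k<n)
      ... | inj₁ (p , _) = trans p t-spec
      ... | inj₂ p       = contradiction (toℕ<n v) (≤⇒≯ (≤-trans (m≤n+m n _) (≤-reflexive (trans p t-spec))))
    arc-reached {v} (inj₂ (b≤a , inj₁ a<v)) = t , t<k , toℕ-injective reached
      where
      t = toℕ v ∸ suc a
      t-spec : t + suc a ≡ toℕ v
      t-spec = m∸n+n≡m a<v
      t<k : t < k
      t<k = +-cancelʳ-< (suc a) t k (subst₂ _<_ (sym t-spec) (sym (between-backward b≤a)) (≤-trans (toℕ<n v) (m≤n+m n b)))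
      reached : toℕ (ahead i t) ≡ toℕ v
      reached with ahead-cases (<-trans t<k k<n)
      ... | inj₁ (p , _) = trans p t-spec
      ... | inj₂ p       = contradiction (toℕ<n v) (≤⇒≯ (≤-trans (m≤n+m n _) (≤-reflexive (trans p t-spec))))
    arc-reached {v} (inj₂ (b≤a , inj₂ v<b)) = t , t<k , toℕ-injective reached
      where
      -- Beyond the wrap v is counted as v + n.
      t = toℕ v + n ∸ suc a
      t-spec : t + suc a ≡ toℕ v + n
      t-spec = m∸n+n≡m (≤-trans (toℕ<n i) (m≤n+m n (toℕ v)))
      t<k : t < k
      t<k = +-cancelʳ-< (suc a) t k (subst₂ _<_ (sym t-spec) (sym (between-backward b≤a)) (+-monoˡ-< n v<b))
      reached : toℕ (ahead i t) ≡ toℕ v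
      reached with ahead-cases (<-trans t<k k<n)
      ... | inj₁ (p , <n) = contradiction <n (≤⇒≯ (≤-trans (m≤n+m n (toℕ v)) (≤-reflexive (sym (trans p t-spec)))))
      ... | inj₂ p        = +-cancelʳ-≡ n _ (toℕ v) (trans p t-spec)

  module _ (D : Dissection n) where
    open Dissection D

    -- A walk amounts to the family of vertex sets at which each piece is used, because the vertices
    -- of an arc are listed without repetition. From here on walks are counted as decompositions of
    -- arcs.
    walks-distinct : ∀ {i j} → i ≢ j → numberOfWalks D i j ≡ decompositions α (λ l → degree l ∸ 2) (arc i j)
    walks-distinct {i} {j} i≢j = begin
      length (filter (isWalk? D i j) (sequences m (between i j)))
        ≡⟨ cong length (filter-≐ (isWalk? D i j) fits? (proj₂ , (i≢j ,_)) (sequences m (between i j))) ⟩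
      length (filter fits? (sequences m (between i j)))
        ≡⟨ count-fitting α (λ l → degree l ∸ 2) vs vs-injective fits? ⟩
      decompositions α (λ l → degree l ∸ 2) (image vs)
        ≡⟨ cong (decompositions α (λ l → degree l ∸ 2)) (⊆-antisym image⊆arc arc⊆image) ⟩
      decompositions α (λ l → degree l ∸ 2) (arc i j) ∎
      where
      open ≡-Reasoning
      vs : Fin (between i j) → Fin n
      vs t = ahead i (toℕ t)
      vs-injective : Injective _≡_ _≡_ vs
      vs-injective {s} {t} eq = toℕ-injective (ahead-injective i j (<-trans (toℕ<n s) (between-bound i j))
                                                                 (<-trans (toℕ<n t) (between-bound i j)) eq)
      fits? : Decidable (Fits α (λ l → degree l ∸ 2) vs)
      fits? p with isWalk? D i j p
      ... | yes (_ , fits) = yes fits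
      ... | no ¬walk       = no λ fits → ¬walk (i≢j , fits)
      image⊆arc : ∀ {v} → v ∈ image vs → v ∈ arc i j
      image⊆arc v∈ with ∈-image⁻ vs v∈
      ... | t , refl = ∈-arc⁺ {i = i} {j} (ahead-in-arc i j (toℕ<n t))
      arc⊆image : ∀ {v} → v ∈ arc i j → v ∈ image vs
      arc⊆image v∈ with arc-reached i j (∈-arc⁻ {i = i} {j} v∈)
      ... | t , t<k , refl = subst (_∈ image vs) (cong (ahead i) (toℕ-fromℕ< t<k)) (∈-image⁺ vs (fromℕ< t<k))

    walks-equal : ∀ i → numberOfWalks D i i ≡ 0
    walks-equal i = cong length (filter-none (isWalk? D i i)
      (universal (λ p walk → contradiction refl (proj₁ walk)) (sequences m (between i i))))

-- Dissections as binary trees of cuts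

module Subdivisions where
  open import Data.Fin using (Fin; zero; suc; toℕ; fromℕ)
  open import Data.Fin.Properties using (toℕ-injective)
  open import Data.Fin using () renaming (_≤?_ to _≤F?_)
  open import Data.Fin.Patterns
  open import Data.Fin.Subset using (Subset; inside; _∈_; _⊆_; _∩_; ∣_∣; ⊥; ⊤)
  open import Data.Fin.Subset.Properties using (p⊆q⇒∣p∣≤∣q∣; p∩q⊆p; p∩q⊆q; x∈p∩q⁺; x∈p∩q⁻;
    ⊆-antisym; ∣⊥∣≡0; ∣⊤∣≡n; ∈⊤)
  open import Data.List using (List; []; _∷_; _++_; filter; concatMap; lookup)
  open import Data.List.Properties using (filter-accept; filter-reject; filter-++; ++-identityʳ;
    ++-assoc)
  open import Data.List.Relation.Unary.All as All using (All; []; _∷_)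
  open import Data.List.Relation.Unary.All.Properties using (++⁺)
  open import Data.List.Relation.Unary.Any using (here; there)
  open import Data.List.Relation.Unary.AllPairs using (AllPairs; []; _∷_)
  open import Data.List.Relation.Binary.Permutation.Propositional using (_↭_; refl; prep; swap;
    trans; ↭-refl; ↭-reflexive; ↭-sym; ↭-trans; module PermutationReasoning)
  open import Data.List.Relation.Binary.Permutation.Propositional.Properties using (All-resp-↭;
    ++⁺ˡ; ++⁺ʳ; ++-comm) renaming (++⁺ to ↭-++⁺)
  import Data.List.Membership.Propositional as List
  open import Data.Nat using (ℕ; zero; suc; _∸_; _≤_; _<_; _≤?_; s≤s)
  open import Data.Nat.Properties using (≤-trans; ≤-reflexive; <-trans; n<1+n; ≤⇒≯)
  open import Data.Product using (_×_; _,_; ∃; proj₁; proj₂)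
  open import Data.Sum using (_⊎_; inj₁; inj₂)
  open import Data.Vec using ([]; _∷_; _[_]≔_)
  open import Relation.Binary.PropositionalEquality as ≡ using (_≡_; refl; sym; cong; cong₂; subst)
  open import Relation.Nullary using (yes; no; ¬_; contradiction; _×-dec_; _⊎-dec_)
  open OrderFormulas
  open Convolution
  open Membership
  open Decompositions

  private variable n : ℕ

  weight : List (Subset n) → Subset n → ℕ
  weight L = decompositions (lookup L) (λ l → ∣ lookup L l ∣ ∸ 2)

  -- The source of the convolutions of walk counts below: the pieces on the two sides of a chord are
  -- used independently.
  weight-++ : ∀ (L M : List (Subset n)) X → weight (L ++ M) X ≡ (weight L ⋆ weight M) X
  weight-++ []      M X = sym (⋆-identityˡ (weight M) X)
  weight-++ (β ∷ L) M X = ≡.trans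
    (⋆-cong {f = single β (∣ β ∣ ∸ 2)} (λ _ → refl) (weight-++ L M) X)
    (sym (⋆-assoc (single β (∣ β ∣ ∸ 2)) (weight L) (weight M) X))

  weight-↭ : ∀ {L M : List (Subset n)} → L ↭ M → ∀ X → weight L X ≡ weight M X
  weight-↭ refl         X = refl
  weight-↭ (prep β p)   X = ⋆-cong {f = single β (∣ β ∣ ∸ 2)} (λ _ → refl) (weight-↭ p) X
  weight-↭ {L = _ ∷ _ ∷ L} {M = _ ∷ _ ∷ M} (swap β γ p) X = begin
    (f ⋆ (g ⋆ weight L)) X   ≡⟨ ⋆-assoc f g (weight L) X ⟨
    ((f ⋆ g) ⋆ weight L) X   ≡⟨ ⋆-cong (⋆-comm f g) (weight-↭ p) X ⟩
    ((g ⋆ f) ⋆ weight M) X   ≡⟨ ⋆-assoc g f (weight M) X ⟩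
    (g ⋆ (f ⋆ weight M)) X   ∎
    where
    open ≡.≡-Reasoning
    f = single β (∣ β ∣ ∸ 2)
    g = single γ (∣ γ ∣ ∸ 2)
  weight-↭ (trans p q) X = ≡.trans (weight-↭ p X) (weight-↭ q X)

  open Diagonal

  diagonal-< : (d : Diagonal n) → toℕ (a d) < toℕ (b d)
  diagonal-< d = <-trans (n<1+n _) (not-adjacent d)

  ∈-inner⁺ : ∀ (d : Diagonal n) {v} → toℕ (a d) ≤ toℕ v × toℕ v ≤ toℕ (b d) → v ∈ inner d
  ∈-inner⁺ d = ∈-tabulate⁺ λ v → (a d ≤F? v) ×-dec (v ≤F? b d)

  ∈-inner⁻ : ∀ (d : Diagonal n) {v} → v ∈ inner d → toℕ (a d) ≤ toℕ v × toℕ v ≤ toℕ (b d)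
  ∈-inner⁻ d = ∈-tabulate⁻ λ v → (a d ≤F? v) ×-dec (v ≤F? b d)

  ∈-outer⁺ : ∀ (d : Diagonal n) {v} → toℕ v ≤ toℕ (a d) ⊎ toℕ (b d) ≤ toℕ v → v ∈ outer d
  ∈-outer⁺ d = ∈-tabulate⁺ λ v → (v ≤F? a d) ⊎-dec (b d ≤F? v)

  ∈-outer⁻ : ∀ (d : Diagonal n) {v} → v ∈ outer d → toℕ v ≤ toℕ (a d) ⊎ toℕ (b d) ≤ toℕ v
  ∈-outer⁻ d = ∈-tabulate⁻ λ v → (v ≤F? a d) ⊎-dec (b d ≤F? v)

  nondegenerate : List (Subset n) → List (Subset n)
  nondegenerate = filter λ β → 3 ≤? ∣ β ∣

  accept : ∀ (β : Subset n) βs → 3 ≤ ∣ β ∣ → nondegenerate (β ∷ βs) ≡ β ∷ nondegenerate βs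
  accept β βs = filter-accept (λ β → 3 ≤? ∣ β ∣) {β} {βs}

  reject : ∀ (β : Subset n) βs → ¬ 3 ≤ ∣ β ∣ → nondegenerate (β ∷ βs) ≡ nondegenerate βs
  reject β βs = filter-reject (λ β → 3 ≤? ∣ β ∣) {β} {βs}

  -- S is a polygon with smallest vertex s and largest vertex t.
  data Subdivision {n} (ds : List (Diagonal n)) : Subset n → Fin n → Fin n → List (Subset n) → Set where
    whole : ∀ {S s t} → Subdivision ds S s t (nondegenerate (S ∷ []))
    glue  : ∀ {S s t d L M N} → d List.∈ ds → a d ∈ S → b d ∈ S →
            Subdivision ds (S ∩ inner d) (a d) (b d) L → Subdivision ds (S ∩ outer d) s t M →
            N ↭ L ++ M → Subdivision ds S s t N

  weaken : ∀ {d ds} {S : Subset n} {s t L} → Subdivision ds S s t L → Subdivision (d ∷ ds) S s t L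
  weaken whole                     = whole
  weaken (glue e∈ a∈ b∈ sub₁ sub₂ p) = glue (there e∈) a∈ b∈ (weaken sub₁) (weaken sub₂) p

  Piece : Subset n → Subset n → Set
  Piece S β = β ⊆ S × 3 ≤ ∣ β ∣

  Piece-⊆ : ∀ {S T β : Subset n} → S ⊆ T → Piece S β → Piece T β
  Piece-⊆ S⊆T (β⊆ , 3≤) = (λ {v} v∈ → S⊆T (β⊆ v∈)) , 3≤

  pieces-of : ∀ {ds} {S : Subset n} {s t L} → Subdivision ds S s t L → All (Piece S) L
  pieces-of {S = S} whole with 3 ≤? ∣ S ∣
  ... | yes 3≤ = subst (All (Piece S)) (sym (accept S [] 3≤)) (((λ {v} v∈ → v∈) , 3≤) ∷ [])
  ... | no 3≰  = subst (All (Piece S)) (sym (reject S [] 3≰)) []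
  pieces-of {S = S} (glue {d = d} _ _ _ sub₁ sub₂ p) = All-resp-↭ (↭-sym p) (++⁺
    (All.map (Piece-⊆ (p∩q⊆p S (inner d))) (pieces-of sub₁)) (All.map (Piece-⊆ (p∩q⊆p S (outer d))) (pieces-of sub₂)))

  concatMap-++ : ∀ {A B : Set} (f : A → List B) xs ys → concatMap f (xs ++ ys) ≡ concatMap f xs ++ concatMap f ys
  concatMap-++ f []       ys = refl
  concatMap-++ f (x ∷ xs) ys = ≡.trans (cong (f x ++_) (concatMap-++ f xs ys)) (sym (++-assoc (f x) _ _))

  concatMap-↭ : ∀ {A B : Set} (f : A → List B) {xs ys} → xs ↭ ys → concatMap f xs ↭ concatMap f ys
  concatMap-↭ f refl         = ↭-refl
  concatMap-↭ f (prep x p)   = ++⁺ˡ (f x) (concatMap-↭ f p)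
  concatMap-↭ f (swap {xs} {ys} x y p) = begin
    f x ++ f y ++ concatMap f xs    ≡⟨ ++-assoc (f x) (f y) _ ⟨
    (f x ++ f y) ++ concatMap f xs  ↭⟨ ↭-++⁺ (++-comm (f x) (f y)) (concatMap-↭ f p) ⟩
    (f y ++ f x) ++ concatMap f ys  ≡⟨ ++-assoc (f y) (f x) _ ⟩
    f y ++ f x ++ concatMap f ys    ∎
    where open PermutationReasoning
  concatMap-↭ f (trans p q)  = ↭-trans (concatMap-↭ f p) (concatMap-↭ f q)

  concatMap-fixed : ∀ {A : Set} (f : A → List A) {xs} → All (λ x → f x ≡ x ∷ []) xs → concatMap f xs ≡ xs
  concatMap-fixed f []         = refl
  concatMap-fixed f (eq ∷ eqs) = cong₂ _++_ eq (concatMap-fixed f eqs)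

  ∣pair∣≤2 : ∀ {X : Subset n} x y → (∀ {v} → v ∈ X → v ≡ x ⊎ v ≡ y) → ∣ X ∣ ≤ 2
  ∣pair∣≤2 {n} {X} x y X⊆ = ≤-trans (p⊆q⇒∣p∣≤∣q∣ X⊆xy) (≤-trans (∣insert∣≤ (⊥ [ x ]≔ inside) y)
    (s≤s (≤-trans (∣insert∣≤ ⊥ x) (s≤s (≤-reflexive (∣⊥∣≡0 n))))))
    where
    X⊆xy : X ⊆ (⊥ [ x ]≔ inside) [ y ]≔ inside
    X⊆xy v∈ with X⊆ v∈
    ... | inj₁ refl = ∈-insert⁺ y (∈-insert ⊥ x)
    ... | inj₂ refl = ∈-insert (⊥ [ x ]≔ inside) y

  private
    ∩-absorb : ∀ {X Y : Subset n} → X ⊆ Y → X ∩ Y ≡ X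
    ∩-absorb {X = X} {Y} X⊆Y = ⊆-antisym (p∩q⊆p X Y) λ v∈ → x∈p∩q⁺ (v∈ , X⊆Y v∈)

  -- The other closed half-plane contains at most two vertices of β, so that part is degenerate and
  -- is discarded by `cut`. The vertices x and y will be the ends of another diagonal that has β on
  -- one side.
  cut-inside : ∀ (d : Diagonal n) {β} x y → 3 ≤ ∣ β ∣ → β ⊆ inner d →
               (∀ {v} → v ∈ β → v ∈ outer d → v ≡ x ⊎ v ≡ y) → cut d β ≡ β ∷ []
  cut-inside d {β} x y 3≤ β⊆ thin rewrite ∩-absorb β⊆ = ≡.trans (accept β _ 3≤) (cong (β ∷_)
    (reject (β ∩ outer d) [] (≤⇒≯ (∣pair∣≤2 x y λ v∈ → let (v∈β , v∈o) = x∈p∩q⁻ β (outer d) v∈ in thin v∈β v∈o))))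

  cut-outside : ∀ (d : Diagonal n) {β} x y → 3 ≤ ∣ β ∣ → β ⊆ outer d →
                (∀ {v} → v ∈ β → v ∈ inner d → v ≡ x ⊎ v ≡ y) → cut d β ≡ β ∷ []
  cut-outside d {β} x y 3≤ β⊆ thin rewrite ∩-absorb β⊆ = ≡.trans
    (reject (β ∩ inner d) (β ∷ []) (≤⇒≯ (∣pair∣≤2 x y λ v∈ → let (v∈β , v∈i) = x∈p∩q⁻ β (inner d) v∈ in thin v∈β v∈i))) (accept β [] 3≤)

  private
    toℕ-injective₂ : ∀ {u v w : Fin n} → toℕ v ≡ toℕ u ⊎ toℕ v ≡ toℕ w → v ≡ u ⊎ v ≡ w
    toℕ-injective₂ (inj₁ eq) = inj₁ (toℕ-injective eq)
    toℕ-injective₂ (inj₂ eq) = inj₂ (toℕ-injective eq)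

    -- The variables are the endpoints of the diagonals c f and a b, and a vertex v.
    sides : ∀ c f a b → c < f → a < b → ((c < a × a < f × f < b) ⊎ (a < c × c < b × b < f))
            ⊎ (a ≤ c × f ≤ b) ⊎ ((c ≤ a × b ≤ f) ⊎ (f ≤ a ⊎ b ≤ c))
    sides c f a b = order (0F <̇ 1F ⇒̇ 2F <̇ 3F ⇒̇
      ((0F <̇ 2F ∧̇ 2F <̇ 1F ∧̇ 1F <̇ 3F) ∨̇ (2F <̇ 0F ∧̇ 0F <̇ 3F ∧̇ 3F <̇ 1F))
      ∨̇ (2F ≤̇ 0F ∧̇ 1F ≤̇ 3F) ∨̇ ((0F ≤̇ 2F ∧̇ 3F ≤̇ 1F) ∨̇ (1F ≤̇ 2F ∨̇ 3F ≤̇ 0F))) (c ∷ f ∷ a ∷ b ∷ [])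

    nested : ∀ c f a b v → c < f → a ≤ c → f ≤ b → v ≤ a ⊎ b ≤ v →
             (v ≤ c ⊎ f ≤ v) × (c ≤ v × v ≤ f → v ≡ a ⊎ v ≡ b)
    nested c f a b v = order (0F <̇ 1F ⇒̇ 2F ≤̇ 0F ⇒̇ 1F ≤̇ 3F ⇒̇ 4F ≤̇ 2F ∨̇ 3F ≤̇ 4F ⇒̇
      (4F ≤̇ 0F ∨̇ 1F ≤̇ 4F) ∧̇ (0F ≤̇ 4F ∧̇ 4F ≤̇ 1F ⇒̇ 4F ≐ 2F ∨̇ 4F ≐ 3F)) (c ∷ f ∷ a ∷ b ∷ v ∷ [])

    around : ∀ c f a b v → c ≤ a → b ≤ f → a ≤ v × v ≤ b →
             (c ≤ v × v ≤ f) × (v ≤ c ⊎ f ≤ v → v ≡ a ⊎ v ≡ b)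
    around c f a b v = order (0F ≤̇ 2F ⇒̇ 3F ≤̇ 1F ⇒̇ 2F ≤̇ 4F ∧̇ 4F ≤̇ 3F ⇒̇
      (0F ≤̇ 4F ∧̇ 4F ≤̇ 1F) ∧̇ (4F ≤̇ 0F ∨̇ 1F ≤̇ 4F ⇒̇ 4F ≐ 2F ∨̇ 4F ≐ 3F)) (c ∷ f ∷ a ∷ b ∷ v ∷ [])

    apart : ∀ c f a b v → c < f → f ≤ a ⊎ b ≤ c → a ≤ v × v ≤ b →
            (v ≤ c ⊎ f ≤ v) × (c ≤ v × v ≤ f → v ≡ a ⊎ v ≡ b)
    apart c f a b v = order (0F <̇ 1F ⇒̇ 1F ≤̇ 2F ∨̇ 3F ≤̇ 0F ⇒̇ 2F ≤̇ 4F ∧̇ 4F ≤̇ 3F ⇒̇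
      (4F ≤̇ 0F ∨̇ 1F ≤̇ 4F) ∧̇ (0F ≤̇ 4F ∧̇ 4F ≤̇ 1F ⇒̇ 4F ≐ 2F ∨̇ 4F ≐ 3F)) (c ∷ f ∷ a ∷ b ∷ v ∷ [])

    outer-endpoints : ∀ c f a b → c < f → a < b → (c ≤ a × b ≤ f) ⊎ (f ≤ a ⊎ b ≤ c) → (c ≤ a ⊎ b ≤ c) × (f ≤ a ⊎ b ≤ f)
    outer-endpoints c f a b = order (0F <̇ 1F ⇒̇ 2F <̇ 3F ⇒̇ (0F ≤̇ 2F ∧̇ 3F ≤̇ 1F) ∨̇ (1F ≤̇ 2F ∨̇ 3F ≤̇ 0F) ⇒̇
      (0F ≤̇ 2F ∨̇ 3F ≤̇ 0F) ∧̇ (1F ≤̇ 2F ∨̇ 3F ≤̇ 1F)) (c ∷ f ∷ a ∷ b ∷ [])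

    inner-endpoints : ∀ c f a b → c < f → a ≤ c × f ≤ b → (a ≤ c × c ≤ b) × (a ≤ f × f ≤ b)
    inner-endpoints c f a b = order (0F <̇ 1F ⇒̇ 2F ≤̇ 0F ∧̇ 1F ≤̇ 3F ⇒̇
      (2F ≤̇ 0F ∧̇ 0F ≤̇ 3F) ∧̇ (2F ≤̇ 1F ∧̇ 1F ≤̇ 3F)) (c ∷ f ∷ a ∷ b ∷ [])

  cut-outer-piece : ∀ (d e : Diagonal n) {S β} → toℕ (a e) ≤ toℕ (a d) × toℕ (b d) ≤ toℕ (b e) →
                    Piece (S ∩ outer e) β → cut d β ≡ β ∷ []
  cut-outer-piece d e {S} {β} (a≤c , f≤b) (β⊆ , 3≤) = cut-outside d (a e) (b e) 3≤
    (λ v∈ → ∈-outer⁺ d (proj₁ (position v∈)))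
    (λ v∈ v∈i → toℕ-injective₂ (proj₂ (position v∈) (∈-inner⁻ d v∈i)))
    where
    position = λ {v} (v∈ : v ∈ β) → nested _ _ _ _ (toℕ v) (diagonal-< d) a≤c f≤b (∈-outer⁻ e (p∩q⊆q S (outer e) (β⊆ v∈)))

  cut-inner-piece : ∀ (d e : Diagonal n) {S β} →
                    (toℕ (a d) ≤ toℕ (a e) × toℕ (b e) ≤ toℕ (b d)) ⊎ (toℕ (b d) ≤ toℕ (a e) ⊎ toℕ (b e) ≤ toℕ (a d)) →
                    Piece (S ∩ inner e) β → cut d β ≡ β ∷ []
  cut-inner-piece d e {S} {β} (inj₁ (c≤a , b≤f)) (β⊆ , 3≤) = cut-inside d (a e) (b e) 3≤
    (λ v∈ → ∈-inner⁺ d (proj₁ (position v∈)))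
    (λ v∈ v∈o → toℕ-injective₂ (proj₂ (position v∈) (∈-outer⁻ d v∈o)))
    where
    position = λ {v} (v∈ : v ∈ β) → around _ _ _ _ (toℕ v) c≤a b≤f (∈-inner⁻ e (p∩q⊆q S (inner e) (β⊆ v∈)))
  cut-inner-piece d e {S} {β} (inj₂ disjoint) (β⊆ , 3≤) = cut-outside d (a e) (b e) 3≤
    (λ v∈ → ∈-outer⁺ d (proj₁ (position v∈)))
    (λ v∈ v∈i → toℕ-injective₂ (proj₂ (position v∈) (∈-inner⁻ d v∈i)))
    where
    position = λ {v} (v∈ : v ∈ β) → apart _ _ _ _ (toℕ v) (diagonal-< d) disjoint (∈-inner⁻ e (p∩q⊆q S (inner e) (β⊆ v∈)))

  -- The new diagonal descends to a leaf. At a node glued along e, not crossing e puts both ends of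
  -- d on one side of e, and `cut d` leaves the pieces on the other side alone, since they meet one
  -- half-plane of d in at most the ends of e.
  refine : ∀ {ds} {S : Subset n} {s t L} (d : Diagonal n) → a d ∈ S → b d ∈ S → All (λ e → ¬ Crossing d e) ds →
           Subdivision ds S s t L → ∃ λ M → Subdivision (d ∷ ds) S s t M × concatMap (cut d) L ↭ M
  refine {S = S} d c∈ f∈ noncrossing whole =
    _ , glue (here refl) c∈ f∈ whole whole ↭-refl , ↭-reflexive (cut-whole)
    where
    cut-whole : concatMap (cut d) (nondegenerate (S ∷ [])) ≡
                nondegenerate (S ∩ inner d ∷ []) ++ nondegenerate (S ∩ outer d ∷ [])
    cut-whole with 3 ≤? ∣ S ∣
    ... | yes 3≤ = ≡.trans (cong (concatMap (cut d)) (accept S [] 3≤)) (≡.trans (++-identityʳ (cut d S)) (filter-++ (λ β → 3 ≤? ∣ β ∣) (S ∩ inner d ∷ []) (S ∩ outer d ∷ [])))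
    ... | no 3≰ = ≡.trans (cong (concatMap (cut d)) (reject S [] 3≰)) (sym (cong₂ _++_
      (reject (S ∩ inner d) [] λ 3≤ → 3≰ (≤-trans 3≤ (p⊆q⇒∣p∣≤∣q∣ (p∩q⊆p S (inner d)))))
      (reject (S ∩ outer d) [] λ 3≤ → 3≰ (≤-trans 3≤ (p⊆q⇒∣p∣≤∣q∣ (p∩q⊆p S (outer d)))))))
  refine {S = S} d c∈ f∈ noncrossing (glue {d = e} {L} {M} {N} e∈ a∈ b∈ sub₁ sub₂ p)
    with sides _ _ _ _ (diagonal-< d) (diagonal-< e)
  ... | inj₁ crossing = contradiction crossing (All.lookup noncrossing e∈)
  ... | inj₂ (inj₁ within)
    with (c∈i , f∈i) ← inner-endpoints _ _ _ _ (diagonal-< d) within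
    with (L′ , sub₁′ , q) ← refine d (x∈p∩q⁺ (c∈ , ∈-inner⁺ e c∈i)) (x∈p∩q⁺ (f∈ , ∈-inner⁺ e f∈i)) noncrossing sub₁
    = L′ ++ M , glue (there e∈) a∈ b∈ sub₁′ (weaken sub₂) ↭-refl , (begin
      concatMap (cut d) N                           ↭⟨ concatMap-↭ (cut d) p ⟩
      concatMap (cut d) (L ++ M)                    ≡⟨ concatMap-++ (cut d) L M ⟩
      concatMap (cut d) L ++ concatMap (cut d) M    ≡⟨ cong (concatMap (cut d) L ++_)
        (concatMap-fixed (cut d) (All.map (cut-outer-piece d e within) (pieces-of sub₂))) ⟩
      concatMap (cut d) L ++ M                      ↭⟨ ++⁺ʳ M q ⟩
      L′ ++ M                                       ∎)
    where open PermutationReasoning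
  ... | inj₂ (inj₂ beyond)
    with (c∈o , f∈o) ← outer-endpoints _ _ _ _ (diagonal-< d) (diagonal-< e) beyond
    with (M′ , sub₂′ , q) ← refine d (x∈p∩q⁺ (c∈ , ∈-outer⁺ e c∈o)) (x∈p∩q⁺ (f∈ , ∈-outer⁺ e f∈o)) noncrossing sub₂
    = L ++ M′ , glue (there e∈) a∈ b∈ (weaken sub₁) sub₂′ ↭-refl , (begin
      concatMap (cut d) N                           ↭⟨ concatMap-↭ (cut d) p ⟩
      concatMap (cut d) (L ++ M)                    ≡⟨ concatMap-++ (cut d) L M ⟩
      concatMap (cut d) L ++ concatMap (cut d) M    ≡⟨ cong (_++ concatMap (cut d) M)
        (concatMap-fixed (cut d) (All.map (cut-inner-piece d e beyond) (pieces-of sub₁))) ⟩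
      L ++ concatMap (cut d) M                      ↭⟨ ++⁺ˡ L q ⟩
      L ++ M′                                       ∎)
    where open PermutationReasoning

  -- `cutAlong` is a right fold, so the head of the list is the last cut made, and adding it is one
  -- `refine` of the tree of the tail.
  subdivide : 3 ≤ suc n → ∀ ds → AllPairs (λ d e → ¬ Crossing d e) ds →
              ∃ λ L → Subdivision ds (⊤ {suc n}) zero (fromℕ n) L × cutAlong ds ↭ L
  subdivide {n} 3≤ [] [] = _ , whole ,
    ↭-reflexive (sym (accept (⊤ {suc n}) [] (≤-trans 3≤ (≤-reflexive (sym (∣⊤∣≡n (suc n)))))))
  subdivide 3≤ (d ∷ ds) (noncrossing ∷ pairs)
    with (L , sub , p) ← subdivide 3≤ ds pairs
    with (M , sub′ , q) ← refine d ∈⊤ ∈⊤ noncrossing sub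
    = M , sub′ , ↭-trans (concatMap-↭ (cut d) p) q

-- Splitting the decompositions of an arc along a chord

module Gluing where
  open import Data.Empty using (⊥-elim) renaming (⊥ to ⊥₀)
  open import Data.Fin using (Fin; toℕ)
  open import Data.Fin.Patterns
  open import Data.Fin.Properties using (toℕ-injective; _≟_)
  open import Data.Fin.Subset using (Subset; inside; _∈_; _∉_; _⊆_; _∩_; _∪_; _─_; ∣_∣; ⊥)
  open import Data.Fin.Subset.Properties using (_∈?_; p⊆q⇒∣p∣≤∣q∣; p∩q⊆p; p∩q⊆q; x∈p∩q⁺; x∈p∩q⁻;
    ⊆-antisym; ∉⊥; p⊆p∪q; q⊆p∪q; x∈p∪q⁻; x∈p∧x∉q⇒x∈p─q)
  open import Data.Nat using (ℕ; _+_; _*_; _≤_)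
  open import Data.Nat.Properties using (≤-trans; *-identityʳ; <⇒≱; *-zeroʳ)
  open import Data.Product using (_×_; _,_; proj₁; proj₂)
  open import Data.Sum using (_⊎_; inj₁; inj₂)
  open import Data.Vec using ([]; _∷_; _[_]≔_)
  open import Function using (_∘_)
  open import Relation.Binary.PropositionalEquality
  open import Relation.Nullary using (yes; no; contradiction)
  open OrderFormulas
  open Convolution
  open Membership
  open Arcs

  private variable n : ℕ

  -- The chord a b separates S into S₁ and S₂, and the arc from b to a
  -- runs through S₂.
  record Separated (S S₁ S₂ : Subset n) (a b : Fin n) : Set where
    field
      ⊆₁    : S₁ ⊆ S
      ⊆₂    : S₂ ⊆ S
      cover : ∀ {v} → v ∈ S → v ∈ S₁ ⊎ v ∈ S₂
      meet  : ∀ {v} → v ∈ S₁ → v ∈ S₂ → v ≡ a ⊎ v ≡ b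
      a∈S₁  : a ∈ S₁
      b∈S₁  : b ∈ S₁
      a∈S₂  : a ∈ S₂
      b∈S₂  : b ∈ S₂
      far   : ∀ {v} → v ∈ S₂ → v ≢ a → v ≢ b → v ∈ arc b a
      far⁻  : ∀ {v} → v ∈ S₂ → v ∈ arc b a → v ∉ S₁
      near  : ∀ {v} → v ∈ S₂ → v ∉ arc a b
      same-side : ∀ {i j} → i ∈ S₁ → j ∈ S₁ →
        (∀ {v} → v ∈ S → v ∈ arc i j → v ∉ S₂) ⊎ (∀ {v} → v ∈ S₂ → v ∈ arc b a → v ∈ arc i j)
      b-between : ∀ {i j} → i ∈ S₁ → i ∉ S₂ → j ∈ S₂ → j ∉ S₁ → b ∈ arc i j
      a-outside : ∀ {i j} → i ∈ S₁ → i ∉ S₂ → j ∈ S₂ → j ∉ S₁ → a ∉ arc i j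
      to-b      : ∀ {i j v} → i ∈ S₁ → i ∉ S₂ → j ∈ S₂ → j ∉ S₁ → v ∈ S₁ → v ∈ arc i b → v ∈ arc i j
      to-b⁻     : ∀ {i j v} → i ∈ S₁ → i ∉ S₂ → j ∈ S₂ → j ∉ S₁ → v ∈ S₁ → v ∈ arc i j → v ≢ b → v ∈ arc i b
      to-a      : ∀ {i j v} → i ∈ S₁ → i ∉ S₂ → j ∈ S₂ → j ∉ S₁ → v ∈ S₁ → v ∈ arc i a → v ∈ arc i j
      to-a⁻     : ∀ {i j v} → i ∈ S₁ → i ∉ S₂ → j ∈ S₂ → j ∉ S₁ → v ∈ S₁ → v ∈ arc i j → v ∈ arc i a
      from-b    : ∀ {i j v} → i ∈ S₁ → i ∉ S₂ → j ∈ S₂ → j ∉ S₁ → v ∈ S₂ → v ∈ arc b j → v ∈ arc i j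
      from-b⁻   : ∀ {i j v} → i ∈ S₁ → i ∉ S₂ → j ∈ S₂ → j ∉ S₁ → v ∈ S₂ → v ∈ arc i j → v ≢ b → v ∈ arc b j
      from-a    : ∀ {i j v} → i ∈ S₁ → i ∉ S₂ → j ∈ S₂ → j ∉ S₁ → v ∈ S₂ → v ∈ arc a j → v ∈ arc i j
      from-a⁻   : ∀ {i j v} → i ∈ S₁ → i ∉ S₂ → j ∈ S₂ → j ∉ S₁ → v ∈ S₂ → v ∈ arc i j → v ∈ arc a j

  start∉arc : ∀ (i j : Fin n) → i ∉ arc i j
  start∉arc i j i∈ = absurd (toℕ i) (toℕ j) (∈-arc⁻ {i = i} {j} i∈)
    where
    absurd : ∀ i j → Arc i j i → ⊥₀
    absurd i j = order (((0F <̇ 0F ∧̇ 0F <̇ 1F) ∨̇ (1F ≤̇ 0F ∧̇ (0F <̇ 0F ∨̇ 0F <̇ 1F))) ⇒̇ ⊥̇) (i ∷ j ∷ [])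

  end∉arc : ∀ (i j : Fin n) → i ≢ j → j ∉ arc i j
  end∉arc i j i≢j j∈ = absurd (toℕ i) (toℕ j) (i≢j ∘ toℕ-injective) (∈-arc⁻ {i = i} {j} j∈)
    where
    absurd : ∀ i j → (i ≡ j → ⊥₀) → Arc i j j → ⊥₀
    absurd i j = order ((0F ≐ 1F ⇒̇ ⊥̇) ⇒̇ ((0F <̇ 1F ∧̇ 1F <̇ 1F) ∨̇ (1F ≤̇ 0F ∧̇ (0F <̇ 1F ∨̇ 1F <̇ 1F))) ⇒̇ ⊥̇) (i ∷ j ∷ [])

  others∈arc : ∀ (i v : Fin n) → v ≢ i → v ∈ arc i i
  others∈arc i v v≢i = ∈-arc⁺ {i = i} {i} (present (toℕ i) (toℕ v) (v≢i ∘ toℕ-injective))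
    where
    present : ∀ i v → (v ≡ i → ⊥₀) → Arc i i v
    present i v = order ((1F ≐ 0F ⇒̇ ⊥̇) ⇒̇ ((0F <̇ 1F ∧̇ 1F <̇ 0F) ∨̇ (0F ≤̇ 0F ∧̇ (0F <̇ 1F ∨̇ 1F <̇ 0F)))) (i ∷ v ∷ [])

  -- The capacities d - 2 of the pieces in S add up to |S| - 2, so a decomposable set leaves out at
  -- least two vertices of S. It is this consequence that the induction carries.
  Supported : (Subset n → ℕ) → Subset n → Set
  Supported f S = ∀ Y → f Y ≡ 0 ⊎ (Y ⊆ S × 2 + ∣ Y ∣ ≤ ∣ S ∣)

  module _ {S S₁ S₂ : Subset n} {a b : Fin n} (sep : Separated S S₁ S₂ a b)
           {f g : Subset n → ℕ} (f-supported : Supported f S₁) (g-supported : Supported g S₂)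
           (g-empty : g ⊥ ≡ 1) (g-full : g (S₂ ∩ arc b a) ≡ 1) where
    open Separated sep

    private
      term-cases : ∀ {R : Set} {P Q : Set} {x y : ℕ} → x ≡ 0 ⊎ P → y ≡ 0 ⊎ Q → (P → Q → x * y ≡ 0 ⊎ R) → x * y ≡ 0 ⊎ R
      term-cases {y = y} (inj₁ x≡0) _ h       = inj₁ (cong (_* y) x≡0)
      term-cases {x = x} (inj₂ p) (inj₁ y≡0) h = inj₁ (trans (cong (x *_) y≡0) (*-zeroʳ x))
      term-cases (inj₂ p) (inj₂ q) h           = h p q

      -- Y is the part of X that f receives. It cannot leave S₁, and it must contain every vertex
      -- outside S₂, which would otherwise be left to g.
      subset-determined : ∀ {X Y S₁ S₂ Z : Subset n} → Y ⊆ X → Y ⊆ S₁ → X ─ Y ⊆ S₂ →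
        (∀ {v} → v ∈ X → v ∈ S₁ → v ∈ Z) → (∀ {v} → v ∈ Z → v ∈ X × v ∉ S₂) → Y ≡ Z
      subset-determined {X} {Y} {Z = Z} Y⊆X Y⊆S₁ X─Y⊆S₂ into out = ⊆-antisym (λ v∈ → into (Y⊆X v∈) (Y⊆S₁ v∈)) back
        where
        back : Z ⊆ Y
        back {v} v∈Z with v ∈? Y
        ... | yes v∈Y = v∈Y
        ... | no v∉Y  = contradiction (X─Y⊆S₂ (x∈p∧x∉q⇒x∈p─q (proj₁ (out v∈Z)) v∉Y)) (proj₂ (out v∈Z))

    -- If the arc misses S₂, then f receives everything and g the empty set. Otherwise the arc
    -- contains all vertices of S₂ other than a and b, and only g can receive them; this leaves g no
    -- capacity for a or b, so f receives all of S₁ on the arc, and `g-full` says that g does its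
    -- share in one way.
    glue-same : ∀ {i j} → i ∈ S₁ → j ∈ S₁ → (f ⋆ g) (S ∩ arc i j) ≡ f (S₁ ∩ arc i j)
    glue-same {i} {j} i∈ j∈ with same-side i∈ j∈
    ... | inj₁ short = begin
      (f ⋆ g) X                 ≡⟨ ⋆-unique f g X X (λ v∈ → v∈) (λ Y Y⊆X → term-cases (f-supported Y) (g-supported (X ─ Y))
                                     λ (Y⊆ , _) (X─Y⊆ , _) → inj₂ (subset-determined Y⊆X Y⊆ X─Y⊆ (λ v∈ _ → v∈) λ v∈ → v∈ , X∉S₂ v∈)) ⟩
      f X * g (X ─ X)           ≡⟨ cong₂ _*_ (cong f X≡) (trans (cong g (⊆-antisym X─X⊆ λ v∈ → contradiction v∈ ∉⊥)) g-empty) ⟩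
      f (S₁ ∩ arc i j) * 1      ≡⟨ *-identityʳ _ ⟩
      f (S₁ ∩ arc i j)          ∎
      where
      open ≡-Reasoning
      X = S ∩ arc i j
      X∉S₂ : ∀ {v} → v ∈ X → v ∉ S₂
      X∉S₂ v∈ = let (v∈S , v∈A) = x∈p∩q⁻ S (arc i j) v∈ in short v∈S v∈A
      X─X⊆ : X ─ X ⊆ ⊥
      X─X⊆ v∈ = let (v∈X , v∉X) = ∈-─⁻ X X v∈ in contradiction v∈X v∉X
      X≡ : X ≡ S₁ ∩ arc i j
      X≡ = ⊆-antisym (λ v∈ → x∈p∩q⁺ (into v∈ , p∩q⊆q S (arc i j) v∈))
                     (λ v∈ → let (v∈S₁ , v∈A) = x∈p∩q⁻ S₁ (arc i j) v∈ in x∈p∩q⁺ (⊆₁ v∈S₁ , v∈A))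
        where
        into : ∀ {v} → v ∈ X → v ∈ S₁
        into v∈ with cover (p∩q⊆p S (arc i j) v∈)
        ... | inj₁ v∈S₁ = v∈S₁
        ... | inj₂ v∈S₂ = contradiction v∈S₂ (X∉S₂ v∈)
    ... | inj₂ long = begin
      (f ⋆ g) X                 ≡⟨ ⋆-unique f g X Z Z⊆X (λ Y Y⊆X → term-cases (f-supported Y) (g-supported (X ─ Y))
                                     λ (Y⊆ , _) (X─Y⊆ , size) → inj₂ (determined Y⊆X Y⊆ X─Y⊆ size)) ⟩
      f Z * g (X ─ Z)           ≡⟨ cong (f Z *_) (trans (cong g X─Z≡) g-full) ⟩
      f Z * 1                   ≡⟨ *-identityʳ (f Z) ⟩
      f Z                       ∎
      where
      open ≡-Reasoning
      X Z : Subset n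
      X = S ∩ arc i j
      Z = S₁ ∩ arc i j
      Z⊆X : Z ⊆ X
      Z⊆X v∈ = let (v∈S₁ , v∈A) = x∈p∩q⁻ S₁ (arc i j) v∈ in x∈p∩q⁺ (⊆₁ v∈S₁ , v∈A)
      X─Z≡ : X ─ Z ≡ S₂ ∩ arc b a
      X─Z≡ = ⊆-antisym into back
        where
        into : X ─ Z ⊆ S₂ ∩ arc b a
        into v∈ with (v∈X , v∉Z) ← ∈-─⁻ X Z v∈
          with (v∈S , v∈A) ← x∈p∩q⁻ S (arc i j) v∈X
          with cover v∈S
        ... | inj₁ v∈S₁ = contradiction (x∈p∩q⁺ (v∈S₁ , v∈A)) v∉Z
        ... | inj₂ v∈S₂ = x∈p∩q⁺ (v∈S₂ , far v∈S₂ (λ { refl → v∉Z (x∈p∩q⁺ (a∈S₁ , v∈A)) })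
                                                  (λ { refl → v∉Z (x∈p∩q⁺ (b∈S₁ , v∈A)) }))
        back : S₂ ∩ arc b a ⊆ X ─ Z
        back v∈ with (v∈S₂ , v∈A) ← x∈p∩q⁻ S₂ (arc b a) v∈ =
          x∈p∧x∉q⇒x∈p─q (x∈p∩q⁺ (⊆₂ v∈S₂ , long v∈S₂ v∈A)) λ v∈Z → far⁻ v∈S₂ v∈A (p∩q⊆p S₁ (arc i j) v∈Z)
      -- If Y misses a or b, then X ─ Y is all of S₂ but one element.
      determined : ∀ {Y} → Y ⊆ X → Y ⊆ S₁ → X ─ Y ⊆ S₂ → 2 + ∣ X ─ Y ∣ ≤ ∣ S₂ ∣ → Y ≡ Z
      determined {Y} Y⊆X Y⊆S₁ X─Y⊆S₂ size =
        ⊆-antisym (λ v∈ → x∈p∩q⁺ (Y⊆S₁ v∈ , p∩q⊆q S (arc i j) (Y⊆X v∈))) back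
        where
        too-big : ∀ u → S₂ ⊆ (X ─ Y) [ u ]≔ inside → ⊥₀
        too-big u S₂⊆ = <⇒≱ size (≤-trans (p⊆q⇒∣p∣≤∣q∣ S₂⊆) (∣insert∣≤ (X ─ Y) u))
        remaining : ∀ {v} → v ∈ S₂ → v ≢ a → v ≢ b → v ∈ X ─ Y
        remaining v∈S₂ v≢a v≢b = let v∈A = far v∈S₂ v≢a v≢b in
          x∈p∧x∉q⇒x∈p─q (x∈p∩q⁺ (⊆₂ v∈S₂ , long v∈S₂ v∈A)) λ v∈Y → far⁻ v∈S₂ v∈A (Y⊆S₁ v∈Y)
        all-but : ∀ {u w} → (w ≡ a × u ≡ b) ⊎ (w ≡ b × u ≡ a) → w ∈ X ─ Y → S₂ ⊆ (X ─ Y) [ u ]≔ inside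
        all-but {u} {w} ends w∈ {v} v∈S₂ with v ≟ w | v ≟ u
        ... | yes refl | _        = ∈-insert⁺ u w∈
        ... | no _     | yes refl = ∈-insert (X ─ Y) u
        ... | no v≢w   | no v≢u   with ends
        ...   | inj₁ (refl , refl) = ∈-insert⁺ u (remaining v∈S₂ v≢w v≢u)
        ...   | inj₂ (refl , refl) = ∈-insert⁺ u (remaining v∈S₂ v≢u v≢w)
        back : Z ⊆ Y
        back {v} v∈Z with v ∈? Y
        ... | yes v∈Y = v∈Y
        ... | no v∉Y with v∈X─Y ← x∈p∧x∉q⇒x∈p─q (Z⊆X v∈Z) v∉Y | meet (p∩q⊆p S₁ (arc i j) v∈Z) (X─Y⊆S₂ v∈X─Y)
        ...   | inj₁ refl = ⊥-elim (too-big b (all-but (inj₁ (refl , refl)) v∈X─Y))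
        ...   | inj₂ refl = ⊥-elim (too-big a (all-but (inj₂ (refl , refl)) v∈X─Y))

    -- On the arc from i to j only b lies in both parts, and `⋆-insert` lets either side take it. In
    -- S₁ the arc from i to a is the arc from i to b with b added, and in S₂ the arc from a to j is
    -- the arc from b to j with b added, since a and b are neighbours in both parts. So the taker of
    -- b decides which product arises.
    glue-across : ∀ {i j} → i ∈ S₁ → i ∉ S₂ → j ∈ S₂ → j ∉ S₁ → (f ⋆ g) (S ∩ arc i j) ≡
                  f (S₁ ∩ arc i a) * g (S₂ ∩ arc b j) + f (S₁ ∩ arc i b) * g (S₂ ∩ arc a j)
    glue-across {i} {j} i∈ i∉ j∈ j∉ = begin
      (f ⋆ g) (S ∩ arc i j)
        ≡⟨ cong (f ⋆ g) X≡ ⟩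
      (f ⋆ g) (X [ b ]≔ inside)
        ≡⟨ ⋆-insert f g X b b∉X ⟩
      ((λ Y → f (Y [ b ]≔ inside)) ⋆ g) X + (f ⋆ (λ Y → g (Y [ b ]≔ inside))) X
        ≡⟨ cong₂ _+_
             (⋆-unique _ g X Z (p⊆p∪q Z′) λ Y Y⊆X → term-cases (f-supported (Y [ b ]≔ inside)) (g-supported (X ─ Y))
               λ (Y⊆ , _) (X─Y⊆ , _) → inj₂ (determined Y⊆X (λ v∈ → Y⊆ (∈-insert⁺ b v∈)) X─Y⊆))
             (⋆-unique f _ X Z (p⊆p∪q Z′) λ Y Y⊆X → term-cases (f-supported Y) (g-supported ((X ─ Y) [ b ]≔ inside))
               λ (Y⊆ , _) (X─Y⊆ , _) → inj₂ (determined Y⊆X Y⊆ (λ v∈ → X─Y⊆ (∈-insert⁺ b v∈)))) ⟩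
      f (Z [ b ]≔ inside) * g (X ─ Z) + f Z * g ((X ─ Z) [ b ]≔ inside)
        ≡⟨ cong₂ _+_ (cong₂ (λ P Q → f P * g Q) Z+b≡ X─Z≡) (cong (λ Q → f Z * g Q) (trans (cong (_[ b ]≔ inside) X─Z≡) Z′+b≡)) ⟩
      f (S₁ ∩ arc i a) * g (S₂ ∩ arc b j) + f (S₁ ∩ arc i b) * g (S₂ ∩ arc a j) ∎
      where
      open ≡-Reasoning
      Z Z′ X : Subset n
      Z  = S₁ ∩ arc i b
      Z′ = S₂ ∩ arc b j
      X  = Z ∪ Z′
      b∉Z : b ∉ Z
      b∉Z b∈ = end∉arc i b (λ { refl → i∉ b∈S₂ }) (p∩q⊆q S₁ (arc i b) b∈)
      b∉Z′ : b ∉ Z′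
      b∉Z′ b∈ = start∉arc b j (p∩q⊆q S₂ (arc b j) b∈)
      b∉X : b ∉ X
      b∉X b∈ with x∈p∪q⁻ Z Z′ b∈
      ... | inj₁ b∈Z  = b∉Z b∈Z
      ... | inj₂ b∈Z′ = b∉Z′ b∈Z′
      X⊆arc : ∀ {v} → v ∈ X → v ∈ arc i j
      X⊆arc v∈ with x∈p∪q⁻ Z Z′ v∈
      ... | inj₁ v∈Z  = let (v∈S₁ , v∈A) = x∈p∩q⁻ S₁ (arc i b) v∈Z in to-b i∈ i∉ j∈ j∉ v∈S₁ v∈A
      ... | inj₂ v∈Z′ = let (v∈S₂ , v∈A) = x∈p∩q⁻ S₂ (arc b j) v∈Z′ in from-b i∈ i∉ j∈ j∉ v∈S₂ v∈A
      not-both : ∀ {v} → v ∈ X → v ∈ S₁ → v ∉ S₂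
      not-both v∈ v∈S₁ v∈S₂ with meet v∈S₁ v∈S₂
      ... | inj₁ refl = a-outside i∈ i∉ j∈ j∉ (X⊆arc v∈)
      ... | inj₂ refl = b∉X v∈
      determined : ∀ {Y} → Y ⊆ X → Y ⊆ S₁ → X ─ Y ⊆ S₂ → Y ≡ Z
      determined Y⊆X Y⊆S₁ X─Y⊆S₂ = subset-determined Y⊆X Y⊆S₁ X─Y⊆S₂
        (λ v∈X v∈S₁ → x∈p∩q⁺ (v∈S₁ , to-b⁻ i∈ i∉ j∈ j∉ v∈S₁ (X⊆arc v∈X) λ { refl → b∉X v∈X }))
        (λ v∈Z → p⊆p∪q Z′ v∈Z , not-both (p⊆p∪q Z′ v∈Z) (p∩q⊆p S₁ (arc i b) v∈Z))
      X≡ : S ∩ arc i j ≡ X [ b ]≔ inside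
      X≡ = ⊆-antisym into back
        where
        into : S ∩ arc i j ⊆ X [ b ]≔ inside
        into {v} v∈ with (v∈S , v∈A) ← x∈p∩q⁻ S (arc i j) v∈ with v ≟ b | cover v∈S
        ... | yes refl | _         = ∈-insert X b
        ... | no v≢b   | inj₁ v∈S₁ = ∈-insert⁺ b (p⊆p∪q Z′ (x∈p∩q⁺ (v∈S₁ , to-b⁻ i∈ i∉ j∈ j∉ v∈S₁ v∈A v≢b)))
        ... | no v≢b   | inj₂ v∈S₂ = ∈-insert⁺ b (q⊆p∪q Z Z′ (x∈p∩q⁺ (v∈S₂ , from-b⁻ i∈ i∉ j∈ j∉ v∈S₂ v∈A v≢b)))
        back : X [ b ]≔ inside ⊆ S ∩ arc i j
        back v∈ with ∈-insert⁻ b v∈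
        ... | inj₁ refl = x∈p∩q⁺ (⊆₁ b∈S₁ , b-between i∈ i∉ j∈ j∉)
        ... | inj₂ v∈X with x∈p∪q⁻ Z Z′ v∈X
        ...   | inj₁ v∈Z  = x∈p∩q⁺ (⊆₁ (p∩q⊆p S₁ (arc i b) v∈Z) , X⊆arc v∈X)
        ...   | inj₂ v∈Z′ = x∈p∩q⁺ (⊆₂ (p∩q⊆p S₂ (arc b j) v∈Z′) , X⊆arc v∈X)
      Z+b≡ : Z [ b ]≔ inside ≡ S₁ ∩ arc i a
      Z+b≡ = ⊆-antisym into back
        where
        into : Z [ b ]≔ inside ⊆ S₁ ∩ arc i a
        into v∈ with ∈-insert⁻ b v∈
        ... | inj₁ refl = x∈p∩q⁺ (b∈S₁ , to-a⁻ i∈ i∉ j∈ j∉ b∈S₁ (b-between i∈ i∉ j∈ j∉))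
        ... | inj₂ v∈Z with (v∈S₁ , v∈A) ← x∈p∩q⁻ S₁ (arc i b) v∈Z =
          x∈p∩q⁺ (v∈S₁ , to-a⁻ i∈ i∉ j∈ j∉ v∈S₁ (to-b i∈ i∉ j∈ j∉ v∈S₁ v∈A))
        back : S₁ ∩ arc i a ⊆ Z [ b ]≔ inside
        back {v} v∈ with (v∈S₁ , v∈A) ← x∈p∩q⁻ S₁ (arc i a) v∈ with v ≟ b
        ... | yes refl = ∈-insert Z b
        ... | no v≢b   = ∈-insert⁺ b (x∈p∩q⁺ (v∈S₁ , to-b⁻ i∈ i∉ j∈ j∉ v∈S₁ (to-a i∈ i∉ j∈ j∉ v∈S₁ v∈A) v≢b))
      Z′+b≡ : Z′ [ b ]≔ inside ≡ S₂ ∩ arc a j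
      Z′+b≡ = ⊆-antisym into back
        where
        into : Z′ [ b ]≔ inside ⊆ S₂ ∩ arc a j
        into v∈ with ∈-insert⁻ b v∈
        ... | inj₁ refl = x∈p∩q⁺ (b∈S₂ , from-a⁻ i∈ i∉ j∈ j∉ b∈S₂ (b-between i∈ i∉ j∈ j∉))
        ... | inj₂ v∈Z′ with (v∈S₂ , v∈A) ← x∈p∩q⁻ S₂ (arc b j) v∈Z′ =
          x∈p∩q⁺ (v∈S₂ , from-a⁻ i∈ i∉ j∈ j∉ v∈S₂ (from-b i∈ i∉ j∈ j∉ v∈S₂ v∈A))
        back : S₂ ∩ arc a j ⊆ Z′ [ b ]≔ inside
        back {v} v∈ with (v∈S₂ , v∈A) ← x∈p∩q⁻ S₂ (arc a j) v∈ with v ≟ b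
        ... | yes refl = ∈-insert Z′ b
        ... | no v≢b   = ∈-insert⁺ b (x∈p∩q⁺ (v∈S₂ , from-b⁻ i∈ i∉ j∈ j∉ v∈S₂ (from-a i∈ i∉ j∈ j∉ v∈S₂ v∈A) v≢b))
      X─Z≡ : X ─ Z ≡ Z′
      X─Z≡ = ⊆-antisym into (λ v∈Z′ → x∈p∧x∉q⇒x∈p─q (q⊆p∪q Z Z′ v∈Z′) λ v∈Z →
          not-both (p⊆p∪q Z′ v∈Z) (p∩q⊆p S₁ (arc i b) v∈Z) (p∩q⊆p S₂ (arc b j) v∈Z′))
        where
        into : X ─ Z ⊆ Z′
        into v∈ with (v∈X , v∉Z) ← ∈-─⁻ X Z v∈ with x∈p∪q⁻ Z Z′ v∈X
        ... | inj₁ v∈Z  = contradiction v∈Z v∉Z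
        ... | inj₂ v∈Z′ = v∈Z′

-- The two sides of a diagonal in terms of the order of vertices

module Sides where
  open import Data.Empty using (⊥)
  open import Data.Fin using (Fin; toℕ)
  open import Data.Fin.Patterns
  open import Data.Fin.Properties using (toℕ-injective)
  open import Data.Fin.Subset using (Subset; _∈_; _∉_; _∩_)
  open import Data.Fin.Subset.Properties using (p∩q⊆p; p∩q⊆q; x∈p∩q⁺)
  open import Data.Nat using (ℕ; _≤_; _<_)
  open import Data.Nat.Properties using (≤-refl; <⇒≤)
  open import Data.Product using (_×_; _,_; proj₁; proj₂)
  open import Data.Sum as Sum using (_⊎_; inj₁; inj₂)
  open import Data.Vec using ([]; _∷_)
  open import Function using (_∘_)
  open import Relation.Binary.PropositionalEquality
  open OrderFormulas
  open Arcs
  open Subdivisions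
  open Gluing
  open Diagonal

  private
    variable n : ℕ

    -- The variables 0F and 1F stand for the endpoints a < b of the diagonal.
    ¬̇ : ∀ {k} → Formula k → Formula k
    ¬̇ φ = φ ⇒̇ ⊥̇

    arcF : ∀ {k} → Fin k → Fin k → Fin k → Formula k
    arcF i j v = (i <̇ v ∧̇ v <̇ j) ∨̇ (j ≤̇ i ∧̇ (i <̇ v ∨̇ v <̇ j))

    In Out : ℕ → ℕ → ℕ → Set
    In  a b v = a ≤ v × v ≤ b
    Out a b v = v ≤ a ⊎ b ≤ v

    inF outF : Fin 5 → Formula 5
    inF v  = 0F ≤̇ v ∧̇ v ≤̇ 1F
    outF v = v ≤̇ 0F ∨̇ 1F ≤̇ v

    in-out : ∀ a b v → a < b → In a b v → Out a b v → v ≡ a ⊎ v ≡ b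
    in-out a b v = order (0F <̇ 1F ⇒̇ 0F ≤̇ 2F ∧̇ 2F ≤̇ 1F ⇒̇ 2F ≤̇ 0F ∨̇ 1F ≤̇ 2F ⇒̇ 2F ≐ 0F ∨̇ 2F ≐ 1F) (a ∷ b ∷ v ∷ [])

    either : ∀ a b v → a < b → In a b v ⊎ Out a b v
    either a b v = order (0F <̇ 1F ⇒̇ (0F ≤̇ 2F ∧̇ 2F ≤̇ 1F) ∨̇ (2F ≤̇ 0F ∨̇ 1F ≤̇ 2F)) (a ∷ b ∷ v ∷ [])

    outer-arc : ∀ a b v → a < b → Out a b v →
      ((v ≡ a → ⊥) → (v ≡ b → ⊥) → Arc b a v) × (Arc b a v → In a b v → ⊥) × (Arc a b v → ⊥)
    outer-arc a b v = order (0F <̇ 1F ⇒̇ 2F ≤̇ 0F ∨̇ 1F ≤̇ 2F ⇒̇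
      (¬̇ (2F ≐ 0F) ⇒̇ ¬̇ (2F ≐ 1F) ⇒̇ arcF 1F 0F 2F) ∧̇
      (arcF 1F 0F 2F ⇒̇ 0F ≤̇ 2F ∧̇ 2F ≤̇ 1F ⇒̇ ⊥̇) ∧̇ ¬̇ (arcF 0F 1F 2F)) (a ∷ b ∷ v ∷ [])

    inner-arc : ∀ a b v → a < b → In a b v →
      ((v ≡ b → ⊥) → (v ≡ a → ⊥) → Arc a b v) × (Arc a b v → Out a b v → ⊥) × (Arc b a v → ⊥)
    inner-arc a b v = order (0F <̇ 1F ⇒̇ 0F ≤̇ 2F ∧̇ 2F ≤̇ 1F ⇒̇
      (¬̇ (2F ≐ 1F) ⇒̇ ¬̇ (2F ≐ 0F) ⇒̇ arcF 0F 1F 2F) ∧̇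
      (arcF 0F 1F 2F ⇒̇ 2F ≤̇ 0F ∨̇ 1F ≤̇ 2F ⇒̇ ⊥̇) ∧̇ ¬̇ (arcF 1F 0F 2F)) (a ∷ b ∷ v ∷ [])

    inner-pair : ∀ a b i j → a < b → In a b i → In a b j → i < j ⊎ j ≤ i
    inner-pair a b i j = order (0F <̇ 1F ⇒̇ 0F ≤̇ 2F ∧̇ 2F ≤̇ 1F ⇒̇ 0F ≤̇ 3F ∧̇ 3F ≤̇ 1F ⇒̇ 2F <̇ 3F ∨̇ 3F ≤̇ 2F) (a ∷ b ∷ i ∷ j ∷ [])

    inner-short : ∀ a b i j v → a < b → In a b i → In a b j → i < j → Arc i j v → Out a b v → ⊥
    inner-short a b i j v = order (0F <̇ 1F ⇒̇ inF 2F ⇒̇ inF 3F ⇒̇ 2F <̇ 3F ⇒̇ arcF 2F 3F 4F ⇒̇ outF 4F ⇒̇ ⊥̇)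
      (a ∷ b ∷ i ∷ j ∷ v ∷ [])

    inner-long : ∀ a b i j v → a < b → In a b i → In a b j → j ≤ i → Out a b v → Arc b a v → Arc i j v
    inner-long a b i j v = order (0F <̇ 1F ⇒̇ inF 2F ⇒̇ inF 3F ⇒̇ 3F ≤̇ 2F ⇒̇ outF 4F ⇒̇ arcF 1F 0F 4F ⇒̇ arcF 2F 3F 4F)
      (a ∷ b ∷ i ∷ j ∷ v ∷ [])

    -- For outer i and j, `Around` says that the arc from i to j runs past the whole inner side, and
    -- `Beside` that it misses it; the two disjuncts of each are the arcs that do not and that do
    -- wrap past the last vertex.
    Around : ℕ → ℕ → ℕ → ℕ → Set
    Around a b i j = (i ≤ a × b ≤ j) ⊎ (j ≤ i × (i ≤ a ⊎ b ≤ j))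

    Beside : ℕ → ℕ → ℕ → ℕ → Set
    Beside a b i j = (i < j × (j ≤ a ⊎ b ≤ i)) ⊎ (j ≤ a × b ≤ i)

    aroundF besideF : ∀ {k} → Fin k → Fin k → Fin k → Fin k → Formula k
    aroundF a b i j = (i ≤̇ a ∧̇ b ≤̇ j) ∨̇ (j ≤̇ i ∧̇ (i ≤̇ a ∨̇ b ≤̇ j))
    besideF a b i j = (i <̇ j ∧̇ (j ≤̇ a ∨̇ b ≤̇ i)) ∨̇ (j ≤̇ a ∧̇ b ≤̇ i)

    outer-pair : ∀ a b i j → a < b → Out a b i → Out a b j → Beside a b i j ⊎ Around a b i j
    outer-pair a b i j = order (0F <̇ 1F ⇒̇ 2F ≤̇ 0F ∨̇ 1F ≤̇ 2F ⇒̇ 3F ≤̇ 0F ∨̇ 1F ≤̇ 3F ⇒̇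
      besideF 0F 1F 2F 3F ∨̇ aroundF 0F 1F 2F 3F) (a ∷ b ∷ i ∷ j ∷ [])

    outer-short : ∀ a b i j v → a < b → Beside a b i j → Arc i j v → In a b v → ⊥
    outer-short a b i j v = order (0F <̇ 1F ⇒̇ besideF 0F 1F 2F 3F ⇒̇ arcF 2F 3F 4F ⇒̇ inF 4F ⇒̇ ⊥̇)
      (a ∷ b ∷ i ∷ j ∷ v ∷ [])

    outer-long : ∀ a b i j v → a < b → Around a b i j → In a b v → Arc a b v → Arc i j v
    outer-long a b i j v = order (0F <̇ 1F ⇒̇ aroundF 0F 1F 2F 3F ⇒̇ inF 4F ⇒̇ arcF 0F 1F 4F ⇒̇ arcF 2F 3F 4F)
      (a ∷ b ∷ i ∷ j ∷ v ∷ [])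

    -- i lies on the side P and j on the side Q, and the arc from i to j leaves P at b.
    record Across (P Q : ℕ → Set) (a b i j v : ℕ) : Set where
      constructor across
      field
        through : Arc i j b
        beyond  : Arc i j a → ⊥
        until   : P v → (Arc i b v → Arc i j v) × (Arc i j v → (v ≡ b → ⊥) → Arc i b v) ×
                        (Arc i a v → Arc i j v) × (Arc i j v → Arc i a v)
        since   : Q v → (Arc b j v → Arc i j v) × (Arc i j v → (v ≡ b → ⊥) → Arc b j v) ×
                        (Arc a j v → Arc i j v) × (Arc i j v → Arc a j v)

    acrossF : (P Q : Fin 5 → Formula 5) (a b : Fin 5) → Formula 5
    acrossF P Q a b = arcF 2F 3F b ∧̇ ¬̇ (arcF 2F 3F a) ∧̇
      (P 4F ⇒̇ (arcF 2F b 4F ⇒̇ arcF 2F 3F 4F) ∧̇ (arcF 2F 3F 4F ⇒̇ ¬̇ (4F ≐ b) ⇒̇ arcF 2F b 4F) ∧̇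
              (arcF 2F a 4F ⇒̇ arcF 2F 3F 4F) ∧̇ (arcF 2F 3F 4F ⇒̇ arcF 2F a 4F)) ∧̇
      (Q 4F ⇒̇ (arcF b 3F 4F ⇒̇ arcF 2F 3F 4F) ∧̇ (arcF 2F 3F 4F ⇒̇ ¬̇ (4F ≐ b) ⇒̇ arcF b 3F 4F) ∧̇
              (arcF a 3F 4F ⇒̇ arcF 2F 3F 4F) ∧̇ (arcF 2F 3F 4F ⇒̇ arcF a 3F 4F))

    inner-across : ∀ a b i j v → a < b → (Out a b i → ⊥) → (In a b j → ⊥) → Across (In a b) (Out a b) a b i j v
    inner-across a b i j v lt i∉ j∉ = let (p , q , r , s) = fact lt i∉ j∉ in across p q r s
      where
      fact = order (0F <̇ 1F ⇒̇ ¬̇ (outF 2F) ⇒̇ ¬̇ (inF 3F) ⇒̇ acrossF inF outF 0F 1F) (a ∷ b ∷ i ∷ j ∷ v ∷ [])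

    outer-across : ∀ a b i j v → a < b → (In a b i → ⊥) → (Out a b j → ⊥) → Across (Out a b) (In a b) b a i j v
    outer-across a b i j v lt i∉ j∉ = let (p , q , r , s) = fact lt i∉ j∉ in across p q r s
      where
      fact = order (0F <̇ 1F ⇒̇ ¬̇ (inF 2F) ⇒̇ ¬̇ (outF 3F) ⇒̇ acrossF outF inF 1F 0F) (a ∷ b ∷ i ∷ j ∷ v ∷ [])

  module _ {S : Subset n} (d : Diagonal n) (a∈ : a d ∈ S) (b∈ : b d ∈ S) where
    private
      x y : ℕ
      x = toℕ (a d)
      y = toℕ (b d)
      x<y = diagonal-< d
      S₁ = S ∩ inner d
      S₂ = S ∩ outer d

      in⁺ : ∀ {v} → v ∈ S → In x y (toℕ v) → v ∈ S₁
      in⁺ v∈ p = x∈p∩q⁺ (v∈ , ∈-inner⁺ d p)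
      in⁻ : ∀ {v} → v ∈ S₁ → In x y (toℕ v)
      in⁻ v∈ = ∈-inner⁻ d (p∩q⊆q S (inner d) v∈)
      out⁺ : ∀ {v} → v ∈ S → Out x y (toℕ v) → v ∈ S₂
      out⁺ v∈ p = x∈p∩q⁺ (v∈ , ∈-outer⁺ d p)
      out⁻ : ∀ {v} → v ∈ S₂ → Out x y (toℕ v)
      out⁻ v∈ = ∈-outer⁻ d (p∩q⊆q S (outer d) v∈)
      fromS₁ : ∀ {v} → v ∈ S₁ → v ∈ S
      fromS₁ = p∩q⊆p S (inner d)
      fromS₂ : ∀ {v} → v ∈ S₂ → v ∈ S
      fromS₂ = p∩q⊆p S (outer d)

      arc⁺ : ∀ (i j : Fin n) {v : Fin n} → Arc (toℕ i) (toℕ j) (toℕ v) → v ∈ arc i j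
      arc⁺ i j {v} = ∈-arc⁺ {i = i} {j} {v}
      arc⁻ : ∀ (i j : Fin n) {v : Fin n} → v ∈ arc i j → Arc (toℕ i) (toℕ j) (toℕ v)
      arc⁻ i j {v} = ∈-arc⁻ {i = i} {j} {v}

      ≢-toℕ : ∀ {u v : Fin n} → u ≢ v → toℕ u ≡ toℕ v → ⊥
      ≢-toℕ u≢v = u≢v ∘ toℕ-injective

      a∈₁ : a d ∈ S₁
      a∈₁ = in⁺ a∈ (≤-refl , <⇒≤ x<y)
      b∈₁ : b d ∈ S₁
      b∈₁ = in⁺ b∈ (<⇒≤ x<y , ≤-refl)
      a∈₂ : a d ∈ S₂
      a∈₂ = out⁺ a∈ (inj₁ ≤-refl)
      b∈₂ : b d ∈ S₂
      b∈₂ = out⁺ b∈ (inj₂ ≤-refl)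

      cover₁ : ∀ {v} → v ∈ S → v ∈ S₁ ⊎ v ∈ S₂
      cover₁ {v} v∈ = Sum.map (in⁺ v∈) (out⁺ v∈) (either x y (toℕ v) x<y)

      meet₁ : ∀ {v} → v ∈ S₁ → v ∈ S₂ → v ≡ a d ⊎ v ≡ b d
      meet₁ {v} v∈₁ v∈₂ = Sum.map toℕ-injective toℕ-injective (in-out x y (toℕ v) x<y (in⁻ v∈₁) (out⁻ v∈₂))

      across₁ : ∀ {i j} v → i ∈ S₁ → i ∉ S₂ → j ∈ S₂ → j ∉ S₁ → Across (In x y) (Out x y) x y (toℕ i) (toℕ j) v
      across₁ {i} {j} v i∈ i∉ j∈ j∉ = inner-across x y (toℕ i) (toℕ j) v x<y (i∉ ∘ out⁺ (fromS₁ i∈)) (j∉ ∘ in⁺ (fromS₂ j∈))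

      across₂ : ∀ {i j} v → i ∈ S₂ → i ∉ S₁ → j ∈ S₁ → j ∉ S₂ → Across (Out x y) (In x y) y x (toℕ i) (toℕ j) v
      across₂ {i} {j} v i∈ i∉ j∈ j∉ = outer-across x y (toℕ i) (toℕ j) v x<y (i∉ ∘ in⁺ (fromS₂ i∈)) (j∉ ∘ out⁺ (fromS₁ j∈))

      open Across
      open Separated

    inner-separated : Separated S (S ∩ inner d) (S ∩ outer d) (a d) (b d)
    inner-separated .⊆₁ = fromS₁
    inner-separated .⊆₂ = fromS₂
    inner-separated .cover = cover₁
    inner-separated .meet = meet₁
    inner-separated .a∈S₁ = a∈₁
    inner-separated .b∈S₁ = b∈₁
    inner-separated .a∈S₂ = a∈₂
    inner-separated .b∈S₂ = b∈₂
    inner-separated .far {v} v∈ v≢a v≢b =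
      arc⁺ (b d) (a d) (proj₁ (outer-arc x y (toℕ v) x<y (out⁻ v∈)) (≢-toℕ v≢a) (≢-toℕ v≢b))
    inner-separated .far⁻ {v} v∈ v∈A v∈₁ =
      proj₁ (proj₂ (outer-arc x y (toℕ v) x<y (out⁻ v∈))) (arc⁻ (b d) (a d) v∈A) (in⁻ v∈₁)
    inner-separated .near {v} v∈ v∈A =
      proj₂ (proj₂ (outer-arc x y (toℕ v) x<y (out⁻ v∈))) (arc⁻ (a d) (b d) v∈A)
    inner-separated .same-side {i} {j} i∈ j∈ with inner-pair x y (toℕ i) (toℕ j) x<y (in⁻ i∈) (in⁻ j∈)
    ... | inj₁ i<j = inj₁ λ {v} _ v∈A v∈₂ → inner-short x y (toℕ i) (toℕ j) (toℕ v) x<y (in⁻ i∈) (in⁻ j∈) i<j (arc⁻ i j v∈A) (out⁻ v∈₂)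
    ... | inj₂ j≤i = inj₂ λ {v} v∈₂ v∈A →
      arc⁺ i j (inner-long x y (toℕ i) (toℕ j) (toℕ v) x<y (in⁻ i∈) (in⁻ j∈) j≤i (out⁻ v∈₂) (arc⁻ (b d) (a d) v∈A))
    inner-separated .b-between {i} {j} i∈ i∉ j∈ j∉ = arc⁺ i j (across₁ x i∈ i∉ j∈ j∉ .through)
    inner-separated .a-outside {i} {j} i∈ i∉ j∈ j∉ v∈A = across₁ x i∈ i∉ j∈ j∉ .beyond (arc⁻ i j v∈A)
    inner-separated .to-b {i} {j} {v} i∈ i∉ j∈ j∉ v∈ v∈A =
      arc⁺ i j (proj₁ (across₁ (toℕ v) i∈ i∉ j∈ j∉ .until (in⁻ v∈)) (arc⁻ i (b d) v∈A))
    inner-separated .to-b⁻ {i} {j} {v} i∈ i∉ j∈ j∉ v∈ v∈A v≢b =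
      arc⁺ i (b d) (proj₁ (proj₂ (across₁ (toℕ v) i∈ i∉ j∈ j∉ .until (in⁻ v∈))) (arc⁻ i j v∈A) (≢-toℕ v≢b))
    inner-separated .to-a {i} {j} {v} i∈ i∉ j∈ j∉ v∈ v∈A =
      arc⁺ i j (proj₁ (proj₂ (proj₂ (across₁ (toℕ v) i∈ i∉ j∈ j∉ .until (in⁻ v∈)))) (arc⁻ i (a d) v∈A))
    inner-separated .to-a⁻ {i} {j} {v} i∈ i∉ j∈ j∉ v∈ v∈A =
      arc⁺ i (a d) (proj₂ (proj₂ (proj₂ (across₁ (toℕ v) i∈ i∉ j∈ j∉ .until (in⁻ v∈)))) (arc⁻ i j v∈A))
    inner-separated .from-b {i} {j} {v} i∈ i∉ j∈ j∉ v∈ v∈A =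
      arc⁺ i j (proj₁ (across₁ (toℕ v) i∈ i∉ j∈ j∉ .since (out⁻ v∈)) (arc⁻ (b d) j v∈A))
    inner-separated .from-b⁻ {i} {j} {v} i∈ i∉ j∈ j∉ v∈ v∈A v≢b =
      arc⁺ (b d) j (proj₁ (proj₂ (across₁ (toℕ v) i∈ i∉ j∈ j∉ .since (out⁻ v∈))) (arc⁻ i j v∈A) (≢-toℕ v≢b))
    inner-separated .from-a {i} {j} {v} i∈ i∉ j∈ j∉ v∈ v∈A =
      arc⁺ i j (proj₁ (proj₂ (proj₂ (across₁ (toℕ v) i∈ i∉ j∈ j∉ .since (out⁻ v∈)))) (arc⁻ (a d) j v∈A))
    inner-separated .from-a⁻ {i} {j} {v} i∈ i∉ j∈ j∉ v∈ v∈A =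
      arc⁺ (a d) j (proj₂ (proj₂ (proj₂ (across₁ (toℕ v) i∈ i∉ j∈ j∉ .since (out⁻ v∈)))) (arc⁻ i j v∈A))

    -- `Separated` asks for the arc from its second chord end to its first to run through the second
    -- part. That part is now the inner one, so the ends exchange roles.
    outer-separated : Separated S (S ∩ outer d) (S ∩ inner d) (b d) (a d)
    outer-separated .⊆₁ = fromS₂
    outer-separated .⊆₂ = fromS₁
    outer-separated .cover = Sum.swap ∘ cover₁
    outer-separated .meet v∈₂ v∈₁ = Sum.swap (meet₁ v∈₁ v∈₂)
    outer-separated .a∈S₁ = b∈₂
    outer-separated .b∈S₁ = a∈₂
    outer-separated .a∈S₂ = b∈₁
    outer-separated .b∈S₂ = a∈₁
    outer-separated .far {v} v∈ v≢b v≢a =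
      arc⁺ (a d) (b d) (proj₁ (inner-arc x y (toℕ v) x<y (in⁻ v∈)) (≢-toℕ v≢b) (≢-toℕ v≢a))
    outer-separated .far⁻ {v} v∈ v∈A v∈₂ =
      proj₁ (proj₂ (inner-arc x y (toℕ v) x<y (in⁻ v∈))) (arc⁻ (a d) (b d) v∈A) (out⁻ v∈₂)
    outer-separated .near {v} v∈ v∈A =
      proj₂ (proj₂ (inner-arc x y (toℕ v) x<y (in⁻ v∈))) (arc⁻ (b d) (a d) v∈A)
    outer-separated .same-side {i} {j} i∈ j∈ with outer-pair x y (toℕ i) (toℕ j) x<y (out⁻ i∈) (out⁻ j∈)
    ... | inj₁ beside = inj₁ λ {v} _ v∈A v∈₁ → outer-short x y (toℕ i) (toℕ j) (toℕ v) x<y beside (arc⁻ i j v∈A) (in⁻ v∈₁)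
    ... | inj₂ around = inj₂ λ {v} v∈₁ v∈A →
      arc⁺ i j (outer-long x y (toℕ i) (toℕ j) (toℕ v) x<y around (in⁻ v∈₁) (arc⁻ (a d) (b d) v∈A))
    outer-separated .b-between {i} {j} i∈ i∉ j∈ j∉ = arc⁺ i j (across₂ x i∈ i∉ j∈ j∉ .through)
    outer-separated .a-outside {i} {j} i∈ i∉ j∈ j∉ v∈A = across₂ x i∈ i∉ j∈ j∉ .beyond (arc⁻ i j v∈A)
    outer-separated .to-b {i} {j} {v} i∈ i∉ j∈ j∉ v∈ v∈A =
      arc⁺ i j (proj₁ (across₂ (toℕ v) i∈ i∉ j∈ j∉ .until (out⁻ v∈)) (arc⁻ i (a d) v∈A))
    outer-separated .to-b⁻ {i} {j} {v} i∈ i∉ j∈ j∉ v∈ v∈A v≢b =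
      arc⁺ i (a d) (proj₁ (proj₂ (across₂ (toℕ v) i∈ i∉ j∈ j∉ .until (out⁻ v∈))) (arc⁻ i j v∈A) (≢-toℕ v≢b))
    outer-separated .to-a {i} {j} {v} i∈ i∉ j∈ j∉ v∈ v∈A =
      arc⁺ i j (proj₁ (proj₂ (proj₂ (across₂ (toℕ v) i∈ i∉ j∈ j∉ .until (out⁻ v∈)))) (arc⁻ i (b d) v∈A))
    outer-separated .to-a⁻ {i} {j} {v} i∈ i∉ j∈ j∉ v∈ v∈A =
      arc⁺ i (b d) (proj₂ (proj₂ (proj₂ (across₂ (toℕ v) i∈ i∉ j∈ j∉ .until (out⁻ v∈)))) (arc⁻ i j v∈A))
    outer-separated .from-b {i} {j} {v} i∈ i∉ j∈ j∉ v∈ v∈A =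
      arc⁺ i j (proj₁ (across₂ (toℕ v) i∈ i∉ j∈ j∉ .since (in⁻ v∈)) (arc⁻ (a d) j v∈A))
    outer-separated .from-b⁻ {i} {j} {v} i∈ i∉ j∈ j∉ v∈ v∈A v≢b =
      arc⁺ (a d) j (proj₁ (proj₂ (across₂ (toℕ v) i∈ i∉ j∈ j∉ .since (in⁻ v∈))) (arc⁻ i j v∈A) (≢-toℕ v≢b))
    outer-separated .from-a {i} {j} {v} i∈ i∉ j∈ j∉ v∈ v∈A =
      arc⁺ i j (proj₁ (proj₂ (proj₂ (across₂ (toℕ v) i∈ i∉ j∈ j∉ .since (in⁻ v∈)))) (arc⁻ (b d) j v∈A))
    outer-separated .from-a⁻ {i} {j} {v} i∈ i∉ j∈ j∉ v∈ v∈A =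
      arc⁺ (b d) j (proj₂ (proj₂ (proj₂ (across₂ (toℕ v) i∈ i∉ j∈ j∉ .since (in⁻ v∈)))) (arc⁻ i j v∈A))

-- Gluing friezes: symmetry and the Ptolemy relation

module Friezes where
  open import Data.Fin using (Fin)
  open import Data.Fin.Subset using (Subset; inside; _∈_; _∉_; _⊆_; _∩_; _─_; ∣_∣; ⊥)
  open import Data.Fin.Subset.Properties using (_∈?_; _⊆?_; p⊆q⇒∣p∣≤∣q∣; x∈p∩q⁺; x∈p∩q⁻; ⊆-antisym;
    ∉⊥; x∈p∧x∉q⇒x∈p─q)
  open import Data.Fin.Properties using (_≟_)
  open import Data.Nat using (ℕ; _+_; _*_; _≤_; _≤?_; s≤s)
  open import Data.Nat.Properties using (≤-trans; ≤-reflexive; +-mono-≤; +-cancelˡ-≤; +-monoʳ-≤;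
    1+n≰n; *-comm; module ≤-Reasoning)
  open import Data.Nat.Tactic.RingSolver using (solve-∀)
  open import Data.Product using (_,_; proj₁)
  open import Data.Sum using (inj₁; inj₂)
  open import Data.Vec using (_[_]≔_)
  open import Relation.Binary.PropositionalEquality
  open import Relation.Nullary using (yes; no; contradiction; _×-dec_)
  open Convolution
  open Membership
  open Arcs
  open Gluing

  private variable n : ℕ

  -- The invariant that gluing preserves, with w the number of decompositions among the pieces
  -- inside S and `S ∩ arc i j` the vertices of S passed on the way from i to j. The name recalls
  -- generalised frieze patterns: `empty` gives the entry 1 from a vertex of S to the next one.
  record Frieze (S : Subset n) (w : Subset n → ℕ) : Set where
    field
      supported : Supported w S
      empty     : w ⊥ ≡ 1
      symmetric : ∀ {i j} → i ∈ S → j ∈ S → w (S ∩ arc i j) ≡ w (S ∩ arc j i)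

    -- The arc from i to i passes every other vertex, one more than `supported` allows. This agrees
    -- with the convention that no walk leads from i to i.
    zero-diagonal : ∀ {i} → i ∈ S → w (S ∩ arc i i) ≡ 0
    zero-diagonal {i} i∈ with supported (S ∩ arc i i)
    ... | inj₁ eq         = eq
    ... | inj₂ (_ , size) = contradiction (≤-trans (s≤s (∣insert∣≤ (S ∩ arc i i) i)) (≤-trans size (p⊆q⇒∣p∣≤∣q∣ S⊆))) 1+n≰n
      where
      S⊆ : S ⊆ (S ∩ arc i i) [ i ]≔ inside
      S⊆ {v} v∈ with v ≟ i
      ... | yes refl = ∈-insert (S ∩ arc i i) i
      ... | no v≢i   = ∈-insert⁺ i (x∈p∩q⁺ (v∈ , others∈arc i v v≢i))

    ∩-empty : ∀ {A} → (∀ {v} → v ∈ S → v ∉ A) → w (S ∩ A) ≡ 1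
    ∩-empty {A} disjoint = trans
      (cong w (⊆-antisym (λ v∈ → let (v∈S , v∈A) = x∈p∩q⁻ S A v∈ in contradiction v∈A (disjoint v∈S)) λ v∈ → contradiction v∈ ∉⊥))
      empty

  open Frieze

  module Glued {S S₁ S₂ : Subset n} {a b : Fin n}
               (sep₁ : Separated S S₁ S₂ a b) (sep₂ : Separated S S₂ S₁ b a)
               {f g : Subset n → ℕ} (frieze₁ : Frieze S₁ f) (frieze₂ : Frieze S₂ g) where
    open Separated sep₁

    f-ab f-ba g-ab g-ba : ℕ
    f-ab = f (S₁ ∩ arc a b)
    f-ba = f (S₁ ∩ arc b a)
    g-ab = g (S₂ ∩ arc a b)
    g-ba = g (S₂ ∩ arc b a)

    f-ba≡1 : f-ba ≡ 1
    f-ba≡1 = ∩-empty frieze₁ (Separated.near sep₂)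
    -- The arc from a to b passes all other vertices of S₁, the most that `supported` allows. That
    -- there is exactly one way to do so is not counted but read off by symmetry from the empty arc
    -- the other way; `g-ba≡1` is obtained alike.
    f-ab≡1 : f-ab ≡ 1
    f-ab≡1 = trans (symmetric frieze₁ a∈S₁ b∈S₁) f-ba≡1
    g-ab≡1 : g-ab ≡ 1
    g-ab≡1 = ∩-empty frieze₂ near
    g-ba≡1 : g-ba ≡ 1
    g-ba≡1 = trans (symmetric frieze₂ b∈S₂ a∈S₂) g-ab≡1

    same₁ : ∀ {i j} → i ∈ S₁ → j ∈ S₁ → (f ⋆ g) (S ∩ arc i j) ≡ f (S₁ ∩ arc i j)
    same₁ = glue-same sep₁ (supported frieze₁) (supported frieze₂) (empty frieze₂) g-ba≡1

    same₂ : ∀ {i j} → i ∈ S₂ → j ∈ S₂ → (f ⋆ g) (S ∩ arc i j) ≡ g (S₂ ∩ arc i j)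
    same₂ {i} {j} i∈ j∈ = trans (⋆-comm f g (S ∩ arc i j))
      (glue-same sep₂ (supported frieze₂) (supported frieze₁) (empty frieze₁) f-ab≡1 i∈ j∈)

    private
      ring₁ : ∀ x y → x ≡ 0 * y + 1 * x
      ring₁ = solve-∀
      ring₂ : ∀ x y → x ≡ 1 * x + 0 * y
      ring₂ = solve-∀
      ring₃ : ∀ x y → x ≡ x * 1 + y * 0
      ring₃ = solve-∀
      ring₄ : ∀ x y → x ≡ y * 0 + x * 1
      ring₄ = solve-∀

    -- The Ptolemy relation m i j m a b = m i a m b j + m i b m a j, with m a b = 1.
    ptolemy : ∀ {i j} → i ∈ S₁ → j ∈ S₂ → (f ⋆ g) (S ∩ arc i j) ≡
              f (S₁ ∩ arc i a) * g (S₂ ∩ arc b j) + f (S₁ ∩ arc i b) * g (S₂ ∩ arc a j)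
    ptolemy {i} {j} i∈ j∈ with i ∈? S₂ | j ∈? S₁
    ... | no i∉  | no j∉   = glue-across sep₁ (supported frieze₁) (supported frieze₂) (empty frieze₂) g-ba≡1 i∈ i∉ j∈ j∉
    -- At an end of the chord the relation degenerates: one product has a diagonal factor 0, the
    -- other a factor 1 from the chord itself.
    ... | yes i∈₂ | _ with meet i∈ i∈₂
    ...   | inj₁ refl = trans (same₂ i∈₂ j∈) (trans (ring₁ _ (g (S₂ ∩ arc b j)))
              (sym (cong₂ (λ x y → x * g (S₂ ∩ arc b j) + y * g (S₂ ∩ arc a j)) (zero-diagonal frieze₁ i∈) f-ab≡1)))
    ...   | inj₂ refl = trans (same₂ i∈₂ j∈) (trans (ring₂ _ (g (S₂ ∩ arc a j)))
              (sym (cong₂ (λ x y → x * g (S₂ ∩ arc b j) + y * g (S₂ ∩ arc a j)) f-ba≡1 (zero-diagonal frieze₁ i∈))))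
    ptolemy {i} {j} i∈ j∈ | no _ | yes j∈₁ with meet j∈₁ j∈
    ...   | inj₁ refl = trans (same₁ i∈ j∈₁) (trans (ring₃ _ (f (S₁ ∩ arc i b)))
              (sym (cong₂ (λ x y → f (S₁ ∩ arc i a) * x + f (S₁ ∩ arc i b) * y) g-ba≡1 (zero-diagonal frieze₂ j∈))))
    ...   | inj₂ refl = trans (same₁ i∈ j∈₁) (trans (ring₄ _ (f (S₁ ∩ arc i a)))
              (sym (cong₂ (λ x y → f (S₁ ∩ arc i a) * x + f (S₁ ∩ arc i b) * y) (zero-diagonal frieze₂ j∈) g-ab≡1)))

  module _ {S S₁ S₂ : Subset n} {a b : Fin n}
           (sep₁ : Separated S S₁ S₂ a b) (sep₂ : Separated S S₂ S₁ b a)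
           {f g : Subset n → ℕ} (frieze₁ : Frieze S₁ f) (frieze₂ : Frieze S₂ g) where
    open Separated sep₁
    private
      module G  = Glued sep₁ sep₂ frieze₁ frieze₂
      module G′ = Glued sep₂ sep₁ frieze₂ frieze₁

      -- The parts share at most a and b. This bounds the combined capacity (|S₁| - 2) + (|S₂| - 2)
      -- by |S| - 2 in `glued-supported`.
      sizes : ∣ S₁ ∣ + ∣ S₂ ∣ ≤ 2 + ∣ S ∣
      sizes = begin
        ∣ S₁ ∣ + ∣ S₂ ∣               ≤⟨ +-monoʳ-≤ ∣ S₁ ∣ (p⊆q⇒∣p∣≤∣q∣ S₂⊆) ⟩
        ∣ S₁ ∣ + ∣ ((S ─ S₁) [ a ]≔ inside) [ b ]≔ inside ∣
          ≤⟨ +-monoʳ-≤ ∣ S₁ ∣ (≤-trans (∣insert∣≤ ((S ─ S₁) [ a ]≔ inside) b) (s≤s (∣insert∣≤ (S ─ S₁) a))) ⟩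
        ∣ S₁ ∣ + (2 + ∣ S ─ S₁ ∣)     ≡⟨ ring ∣ S₁ ∣ ∣ S ─ S₁ ∣ ⟩
        2 + (∣ S₁ ∣ + ∣ S ─ S₁ ∣)     ≡⟨ cong (2 +_) (∣X∣≡∣Y∣+∣X─Y∣ S S₁ ⊆₁) ⟨
        2 + ∣ S ∣                     ∎
        where
        open ≤-Reasoning
        ring : ∀ x y → x + (2 + y) ≡ 2 + (x + y)
        ring = solve-∀
        S₂⊆ : S₂ ⊆ ((S ─ S₁) [ a ]≔ inside) [ b ]≔ inside
        S₂⊆ {v} v∈ with v ∈? S₁
        ... | no v∉ = ∈-insert⁺ b (∈-insert⁺ a (x∈p∧x∉q⇒x∈p─q (⊆₂ v∈) v∉))
        ... | yes v∈₁ with meet v∈₁ v∈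
        ...   | inj₁ refl = ∈-insert⁺ b (∈-insert (S ─ S₁) a)
        ...   | inj₂ refl = ∈-insert ((S ─ S₁) [ a ]≔ inside) b

    glued-supported : Supported (f ⋆ g) S
    glued-supported X = ⋆-supported (supported frieze₁) (supported frieze₂) (X ⊆? S ×-dec 2 + ∣ X ∣ ≤? ∣ S ∣) X
      λ Y Y⊆X (Y⊆ , Y-size) (X─Y⊆ , X─Y-size) →
        (λ {v} v∈X → inside-S Y Y⊆ X─Y⊆ v∈X) ,
        +-cancelˡ-≤ 2 _ _ (≤-trans (≤-reflexive (trans (cong (4 +_) (∣X∣≡∣Y∣+∣X─Y∣ X Y Y⊆X)) (ring ∣ Y ∣ ∣ X ─ Y ∣)))
          (≤-trans (+-mono-≤ Y-size X─Y-size) sizes))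
      where
      ring : ∀ x y → 4 + (x + y) ≡ (2 + x) + (2 + y)
      ring = solve-∀
      inside-S : ∀ Y → Y ⊆ S₁ → X ─ Y ⊆ S₂ → X ⊆ S
      inside-S Y Y⊆ X─Y⊆ {v} v∈X with v ∈? Y
      ... | yes v∈Y = ⊆₁ (Y⊆ v∈Y)
      ... | no v∉Y  = ⊆₂ (X─Y⊆ (x∈p∧x∉q⇒x∈p─q v∈X v∉Y))

    -- The Ptolemy expression contains only entries within S₁ and within S₂, which are symmetric by
    -- hypothesis; reversing them gives the Ptolemy expression read from S₂, with a and b exchanged.
    across-symmetric : ∀ {i j} → i ∈ S₁ → j ∈ S₂ → (f ⋆ g) (S ∩ arc i j) ≡ (f ⋆ g) (S ∩ arc j i)
    across-symmetric {i} {j} i∈ j∈ = begin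
      (f ⋆ g) (S ∩ arc i j)
        ≡⟨ G.ptolemy i∈ j∈ ⟩
      f (S₁ ∩ arc i a) * g (S₂ ∩ arc b j) + f (S₁ ∩ arc i b) * g (S₂ ∩ arc a j)
        ≡⟨ cong₂ _+_ (cong₂ _*_ (symmetric frieze₁ i∈ a∈S₁) (symmetric frieze₂ b∈S₂ j∈))
                     (cong₂ _*_ (symmetric frieze₁ i∈ b∈S₁) (symmetric frieze₂ a∈S₂ j∈)) ⟩
      f (S₁ ∩ arc a i) * g (S₂ ∩ arc j b) + f (S₁ ∩ arc b i) * g (S₂ ∩ arc j a)
        ≡⟨ cong₂ _+_ (*-comm (f (S₁ ∩ arc a i)) _) (*-comm (f (S₁ ∩ arc b i)) _) ⟩
      g (S₂ ∩ arc j b) * f (S₁ ∩ arc a i) + g (S₂ ∩ arc j a) * f (S₁ ∩ arc b i)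
        ≡⟨ G′.ptolemy j∈ i∈ ⟨
      (g ⋆ f) (S ∩ arc j i)
        ≡⟨ ⋆-comm g f (S ∩ arc j i) ⟩
      (f ⋆ g) (S ∩ arc j i) ∎
      where open ≡-Reasoning

    glued : Frieze S (f ⋆ g)
    glued .supported = glued-supported
    glued .empty     = ⋆-empty
      where
      ⋆-empty : (f ⋆ g) ⊥ ≡ 1
      ⋆-empty = trans (⋆-unique f g ⊥ ⊥ (λ v∈ → v∈) λ Y Y⊆ → inj₂ (⊆-antisym Y⊆ λ v∈ → contradiction v∈ ∉⊥))
        (cong₂ _*_ (empty frieze₁) (trans (cong g (⊆-antisym (λ v∈ → proj₁ (∈-─⁻ ⊥ ⊥ v∈)) λ v∈ → contradiction v∈ ∉⊥)) (empty frieze₂)))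
    glued .symmetric {i} {j} i∈ j∈ with cover i∈ | cover j∈
    ... | inj₁ i∈₁ | inj₁ j∈₁ = trans (G.same₁ i∈₁ j∈₁) (trans (symmetric frieze₁ i∈₁ j∈₁) (sym (G.same₁ j∈₁ i∈₁)))
    ... | inj₂ i∈₂ | inj₂ j∈₂ = trans (G.same₂ i∈₂ j∈₂) (trans (symmetric frieze₂ i∈₂ j∈₂) (sym (G.same₂ j∈₂ i∈₂)))
    ... | inj₁ i∈₁ | inj₂ j∈₂ = across-symmetric i∈₁ j∈₂
    ... | inj₂ i∈₂ | inj₁ j∈₁ = sym (across-symmetric j∈₁ i∈₂)

-- Elimination along the tree of cuts

module Reductions where
  open import Data.Empty using (⊥-elim) renaming (⊥ to ⊥₀)
  open import Data.Fin using (Fin; toℕ)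
  open import Data.Fin.Properties using (_≟_)
  open import Data.Fin.Subset using (Subset; inside; _∈_; _∉_; _⊆_; _∩_; ∣_∣; ⊥)
    renaming (_-_ to _∖_)
  open import Data.Fin.Subset.Properties using (_∈?_; p⊆q⇒∣p∣≤∣q∣; p∩q⊆p; p∩q⊆q; x∈p∩q⁺; ⊆-antisym;
    ∉⊥; ⊥⊆; ∣⊥∣≡0;
    x∈p⇒∣p-x∣<∣p∣; x∈p∧x≢y⇒x∈p-y; x∉⁅y⁆⇒x≢y)
  open import Data.Integer using (ℤ; +_; 0ℤ; 1ℤ; -1ℤ; _+_; _*_; -_; _-_)
  open import Data.Integer.Properties using (pos-+; pos-*; *-comm; +-comm; *-zeroˡ; *-zeroʳ;
    +-identityˡ; +-identityʳ; +-inverseʳ)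
  open import Data.Integer.Tactic.RingSolver using (solve-∀)
  open import Data.List using (List; []; _∷_; _++_)
  import Data.List.Membership.Propositional as List
  open import Data.List.Membership.Propositional.Properties using (∈-++⁺ˡ; ∈-++⁺ʳ; ∈-++⁻)
  open import Data.List.Relation.Binary.Permutation.Propositional using (_↭_; ↭-sym; ↭⇒↭ₛ)
  open import Data.List.Relation.Binary.Permutation.Propositional.Properties using (∈-resp-↭)
  import Data.List.Relation.Binary.Permutation.Setoid.Properties as ↭ₛ
  open import Data.List.Relation.Unary.All as All using (All)
  open import Data.List.Relation.Unary.Any using (here)
  open import Data.List.Relation.Unary.AllPairs using ([]; _∷_)
  open import Data.List.Relation.Unary.Unique.Propositional using (Unique)
  open import Data.List.Relation.Unary.Unique.Propositional.Properties using ()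
    renaming (++⁺ to unique-++)
  open import Data.Nat as ℕ using (ℕ; suc; _≤_; _<_; _∸_; _≤?_; s≤s; z≤n)
  import Data.Nat.Properties as ℕ
  open import Data.Product using (_×_; _,_; ∃; proj₁; proj₂)
  open import Data.Sum using (inj₁; inj₂)
  open import Data.Vec using (_[_]≔_)
  open import Function using (_∘_)
  open import Relation.Binary.PropositionalEquality
  open import Relation.Nullary using (Dec; yes; no; ¬_; contradiction; ¬?; _×-dec_)
  open Matrices
  open Unimodularity
  open Convolution
  open Membership
  open Decompositions
  open Arcs
  open Subdivisions
  open Gluing
  open Sides
  open Friezes

  private variable n : ℕ

  Interior : Subset n → Fin n → Fin n → Fin n → Set
  Interior S s t v = v ∈ S × v ≢ s × v ≢ t

  interior? : ∀ (S : Subset n) s t v → Dec (Interior S s t v)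
  interior? S s t v = v ∈? S ×-dec ¬? (v ≟ s) ×-dec ¬? (v ≟ t)

  walksIn : (Subset n → ℕ) → Subset n → Matrix n
  walksIn w S i j = + w (S ∩ arc i j)

  -- The entry at v, u after rows l and r have been subtracted from row v and columns l′ and r′ from
  -- column u. The anchors are arguments rather than functions of v and u, so that those of either
  -- part of a gluing can be substituted.
  reduced : Matrix n → (v l r u l′ r′ : Fin n) → ℤ
  reduced M v l r u l′ r′ = row u - (row l′ + row r′)
    where
    row : Fin _ → ℤ
    row x = M v x - (M l x + M r x)

  -- Every vertex v other than s and t is an interior vertex of exactly one
  -- piece p v, whose smallest and largest vertices are l v and r v.  The row
  -- operations of the reduction are those of 1 + X.
  record Reduction {n} (S : Subset n) (s t : Fin n) (L : List (Subset n)) : Set where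
    field
      w        : Subset n → ℕ
      w-weight : ∀ X → w X ≡ weight L X
      frieze   : Frieze S w
      l r      : Fin n → Fin n
      p        : Fin n → Subset n
      X        : Matrix n

    M : Matrix n
    M = walksIn w S

    Inner : Fin n → Set
    Inner = Interior S s t

    field
      l∈S : ∀ {v} → Inner v → l v ∈ S
      r∈S : ∀ {v} → Inner v → r v ∈ S
      p∈L : ∀ {v} → Inner v → p v List.∈ L
      row-s : ∀ {v} → Inner v → M v s ≡ M (l v) s + M (r v) s
      row-t : ∀ {v} → Inner v → M v t ≡ M (l v) t + M (r v) t
      same-piece : ∀ {v u} → Inner v → Inner u → p v ≡ p u →
                   reduced M v (l v) (r v) u (l u) (r u) ≡ -1ℤ - 𝟙 v u
      different-pieces : ∀ {v u} → Inner v → Inner u → p v ≢ p u →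
                         reduced M v (l v) (r v) u (l u) (r u) ≡ 0ℤ
      fibre : ∀ {α} → α List.∈ L → ∃ λ F →
              (∀ {v} → v ∈ F → Inner v × p v ≡ α) × (∀ {v} → Inner v → p v ≡ α → v ∈ F) × 2 ℕ.+ ∣ F ∣ ≡ ∣ α ∣
      unique : Unique L
      X-inner : ∀ {v} → Inner v → ∀ x → X v x ≡ - (𝟙 (l v) x + 𝟙 (r v) x)
      X-outer : ∀ {v} → ¬ Inner v → ∀ x → X v x ≡ 0ℤ
      unimodular  : Unimodular (𝟙+ X)
      unimodularᵀ : Unimodular (𝟙+ (X ᵀ))

  open Reduction

  reduction-↭ : ∀ {S : Subset n} {s t L N} → L ↭ N → Reduction S s t L → Reduction S s t N
  reduction-↭ L↭N red = record
    { w = w red ; w-weight = λ X → trans (w-weight red X) (weight-↭ L↭N X) ; frieze = frieze red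
    ; l = l red ; r = r red ; p = p red ; X = X red
    ; l∈S = l∈S red ; r∈S = r∈S red ; p∈L = ∈-resp-↭ L↭N ∘ p∈L red
    ; row-s = row-s red ; row-t = row-t red
    ; same-piece = same-piece red ; different-pieces = different-pieces red
    ; fibre = fibre red ∘ ∈-resp-↭ (↭-sym L↭N)
    ; unique = ↭ₛ.Unique-resp-↭ (setoid _) (↭⇒↭ₛ L↭N) (unique red)
    ; X-inner = X-inner red ; X-outer = X-outer red
    ; unimodular = unimodular red ; unimodularᵀ = unimodularᵀ red }

  module Whole {S : Subset n} {s t : Fin n} (s∈ : s ∈ S) (t∈ : t ∈ S) (s≢t : s ≢ t) where
    private
      L : List (Subset n)
      L = nondegenerate (S ∷ [])

    1≤∣∣ : ∀ {Y : Subset n} {v} → v ∈ Y → 1 ≤ ∣ Y ∣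
    1≤∣∣ v∈ = ℕ.≤-trans (s≤s z≤n) (x∈p⇒∣p-x∣<∣p∣ v∈)

    two-fewer : ∀ {Y i j} → i ∈ S → j ∈ S → i ≢ j → Y ⊆ S → i ∉ Y → j ∉ Y → 2 ℕ.+ ∣ Y ∣ ≤ ∣ S ∣
    two-fewer {Y} {i} {j} i∈ j∈ i≢j Y⊆ i∉ j∉ = subst (_≤ ∣ S ∣)
      (trans (∣insert∣ (Y [ i ]≔ inside) j j∉′) (cong suc (∣insert∣ Y i i∉)))
      (p⊆q⇒∣p∣≤∣q∣ into)
      where
      j∉′ : j ∉ Y [ i ]≔ inside
      j∉′ j∈′ with ∈-insert⁻ i j∈′
      ... | inj₁ refl = i≢j refl
      ... | inj₂ j∈Y  = j∉ j∈Y
      into : (Y [ i ]≔ inside) [ j ]≔ inside ⊆ S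
      into v∈ with ∈-insert⁻ j v∈
      ... | inj₁ refl = j∈
      ... | inj₂ v∈′ with ∈-insert⁻ i v∈′
      ...   | inj₁ refl = i∈
      ...   | inj₂ v∈Y  = Y⊆ v∈Y

    2≤∣S∣ : 2 ≤ ∣ S ∣
    2≤∣S∣ = subst (λ k → 2 ℕ.+ k ≤ ∣ S ∣) (∣⊥∣≡0 n) (two-fewer s∈ t∈ s≢t ⊥⊆ ∉⊥ ∉⊥)

    weight-single : 3 ≤ ∣ S ∣ → ∀ Y → weight L Y ≡ single S (∣ S ∣ ∸ 2) Y
    weight-single 3≤ Y = trans (cong (λ N → weight N Y) (accept S [] 3≤))
      (trans (⋆-comm (single S (∣ S ∣ ∸ 2)) ε Y) (⋆-identityˡ (single S (∣ S ∣ ∸ 2)) Y))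

    weight-none : ¬ 3 ≤ ∣ S ∣ → ∀ Y → weight L Y ≡ ε Y
    weight-none 3≰ Y = cong (λ N → weight N Y) (reject S [] 3≰)

    -- With at least three vertices S is the only piece and its capacity is the bound. With two
    -- vertices there is no piece, and the bound leaves only the empty set.
    whole-one : ∀ {Y} → Y ⊆ S → 2 ℕ.+ ∣ Y ∣ ≤ ∣ S ∣ → weight L Y ≡ 1
    whole-one {Y} Y⊆ size with 3 ≤? ∣ S ∣
    ... | yes 3≤ = trans (weight-single 3≤ Y) (single-one Y⊆ (ℕ.m+n≤o⇒m≤o∸n ∣ Y ∣ (subst (_≤ ∣ S ∣) (ℕ.+-comm 2 ∣ Y ∣) size)))
    ... | no 3≰  = trans (weight-none 3≰ Y) (trans (cong ε Y≡⊥) (decompositions-⊥ {0} {n} (λ ()) (λ ())))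
      where
      Y≡⊥ : Y ≡ ⊥
      Y≡⊥ = ⊆-antisym (λ v∈ → contradiction (ℕ.≤-trans (s≤s (s≤s (1≤∣∣ v∈))) size) 3≰) ⊥⊆

    whole-supported : Supported (weight L) S
    whole-supported Y with 3 ≤? ∣ S ∣
    ... | yes 3≤ with single-supported S (∣ S ∣ ∸ 2) Y
    ...   | inj₁ eq          = inj₁ (trans (weight-single 3≤ Y) eq)
    ...   | inj₂ (Y⊆ , size) = inj₂ ((λ {v} v∈ → Y⊆ v∈) , subst (_≤ ∣ S ∣) (ℕ.+-comm ∣ Y ∣ 2) (ℕ.m≤o∸n⇒m+n≤o ∣ Y ∣ 2≤∣S∣ size))
    whole-supported Y | no 3≰ with ε-supported Y
    ...   | inj₁ eq   = inj₁ (trans (weight-none 3≰ Y) eq)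
    ...   | inj₂ refl = inj₂ ((λ {v} v∈ → contradiction v∈ ∉⊥) , subst (λ k → 2 ℕ.+ k ≤ ∣ S ∣) (sym (∣⊥∣≡0 n)) 2≤∣S∣)

    -- An arc between distinct vertices misses both of them and so stays within the bound of
    -- `whole-one`.
    whole-walks : ∀ {i j} → i ∈ S → j ∈ S → i ≢ j → weight L (S ∩ arc i j) ≡ 1
    whole-walks {i} {j} i∈ j∈ i≢j = whole-one (p∩q⊆p S (arc i j)) (two-fewer i∈ j∈ i≢j (p∩q⊆p S (arc i j))
      (λ i∈A → start∉arc i j (p∩q⊆q S (arc i j) i∈A)) (λ j∈A → end∉arc i j i≢j (p∩q⊆q S (arc i j) j∈A)))

    whole-frieze : Frieze S (weight L)
    whole-frieze .Frieze.supported = whole-supported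
    whole-frieze .Frieze.empty     = whole-one ⊥⊆ (subst (λ k → 2 ℕ.+ k ≤ ∣ S ∣) (sym (∣⊥∣≡0 n)) 2≤∣S∣)
    whole-frieze .Frieze.symmetric {i} {j} i∈ j∈ with i ≟ j
    ... | yes refl = refl
    ... | no i≢j   = trans (whole-walks i∈ j∈ i≢j) (sym (whole-walks j∈ i∈ (≢-sym i≢j)))

    private
      M₀ : Matrix n
      M₀ = walksIn (weight L) S

      Inner₀ : Fin n → Set
      Inner₀ = Interior S s t

      one : ∀ {i j} → i ∈ S → j ∈ S → i ≢ j → M₀ i j ≡ 1ℤ
      one i∈ j∈ i≢j = cong +_ (whole-walks i∈ j∈ i≢j)

      nil : ∀ {i} → i ∈ S → M₀ i i ≡ 0ℤ
      nil i∈ = cong +_ (Frieze.zero-diagonal whole-frieze i∈)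

      -- All off-diagonal walk numbers of a single piece are 1. The row operation turns 1 - δ into
      -- -1 - δ and clears the columns s and t, so the column operation subtracts nothing.
      value : ∀ (v u : Fin n) {a b c d e f g h i} → a ≡ 1ℤ - 𝟙 v u → b ≡ 1ℤ → c ≡ 1ℤ → d ≡ 1ℤ → e ≡ 0ℤ → f ≡ 1ℤ → g ≡ 1ℤ → h ≡ 1ℤ → i ≡ 0ℤ →
              (a - (b + c)) - ((d - (e + f)) + (g - (h + i))) ≡ -1ℤ - 𝟙 v u
      value v u refl refl refl refl refl refl refl refl refl = ring (𝟙 v u)
        where
        ring : ∀ x → ((1ℤ - x) - (1ℤ + 1ℤ)) - ((1ℤ - (0ℤ + 1ℤ)) + (1ℤ - (1ℤ + 0ℤ))) ≡ -1ℤ - x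
        ring = solve-∀

      entry-same : ∀ {v u} → v ∈ S → u ∈ S → M₀ v u ≡ 1ℤ - 𝟙 v u
      entry-same {v} {u} v∈ u∈ with v ≟ u
      ... | yes refl = nil v∈
      ... | no v≢u   = one v∈ u∈ v≢u

      F : Subset n
      F = S ∖ s ∖ t

      F⁻ : ∀ {v} → v ∈ F → Inner₀ v
      F⁻ v∈ with (v∈′ , v∉t) ← ∈-─⁻ (S ∖ s) _ v∈ with (v∈S , v∉s) ← ∈-─⁻ S _ v∈′ = v∈S , x∉⁅y⁆⇒x≢y v∉s , x∉⁅y⁆⇒x≢y v∉t

      F⁺ : ∀ {v} → Inner₀ v → v ∈ F
      F⁺ (v∈ , v≢s , v≢t) = x∈p∧x≢y⇒x∈p-y (x∈p∧x≢y⇒x∈p-y v∈ v≢s) v≢t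

      F-size : 2 ℕ.+ ∣ F ∣ ≡ ∣ S ∣
      F-size = begin
        2 ℕ.+ ∣ F ∣                                  ≡⟨ cong suc (∣insert∣ F s s∉F) ⟨
        suc ∣ F [ s ]≔ inside ∣                      ≡⟨ ∣insert∣ (F [ s ]≔ inside) t t∉ ⟨
        ∣ (F [ s ]≔ inside) [ t ]≔ inside ∣          ≡⟨ cong ∣_∣ (⊆-antisym into back) ⟩
        ∣ S ∣                                        ∎
        where
        open ≡-Reasoning
        s∉F : s ∉ F
        s∉F s∈F = proj₁ (proj₂ (F⁻ s∈F)) refl
        t∉ : t ∉ F [ s ]≔ inside
        t∉ t∈′ with ∈-insert⁻ s t∈′
        ... | inj₁ refl = s≢t refl
        ... | inj₂ t∈F  = proj₂ (proj₂ (F⁻ t∈F)) refl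
        into : (F [ s ]≔ inside) [ t ]≔ inside ⊆ S
        into v∈ with ∈-insert⁻ t v∈
        ... | inj₁ refl = t∈
        ... | inj₂ v∈′ with ∈-insert⁻ s v∈′
        ...   | inj₁ refl = s∈
        ...   | inj₂ v∈F  = proj₁ (F⁻ v∈F)
        back : S ⊆ (F [ s ]≔ inside) [ t ]≔ inside
        back {v} v∈ with v ≟ t | v ≟ s
        ... | yes refl | _        = ∈-insert (F [ s ]≔ inside) t
        ... | no _     | yes refl = ∈-insert⁺ t (∈-insert F s)
        ... | no v≢t   | no v≢s   = ∈-insert⁺ t (∈-insert⁺ s (F⁺ (v∈ , v≢s , v≢t)))

      abstract
        X₀ : Matrix n
        X₀ v x with interior? S s t v
        ... | yes _ = - (𝟙 s x + 𝟙 t x)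
        ... | no _  = 0ℤ

        X₀-inner : ∀ {v} → Inner₀ v → ∀ x → X₀ v x ≡ - (𝟙 s x + 𝟙 t x)
        X₀-inner {v} iv x with interior? S s t v
        ... | yes _  = refl
        ... | no ¬iv = contradiction iv ¬iv

        X₀-outer : ∀ {v} → ¬ Inner₀ v → ∀ x → X₀ v x ≡ 0ℤ
        X₀-outer {v} ¬iv x with interior? S s t v
        ... | yes iv = contradiction iv ¬iv
        ... | no _   = refl

      -- The rows subtracted are those of s and t, which are not interior, so their own rows in `X₀`
      -- are zero.
      X₀²≡0 : ∀ i j k → X₀ i j * X₀ j k ≡ 0ℤ
      X₀²≡0 i j k with interior? S s t j | interior? S s t i
      ... | no ¬ij | _      = trans (cong (X₀ i j *_) (X₀-outer ¬ij k)) (*-zeroʳ (X₀ i j))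
      ... | yes ij | no ¬ii = trans (cong (_* X₀ j k) (X₀-outer ¬ii j)) (*-zeroˡ (X₀ j k))
      ... | yes (_ , j≢s , j≢t) | yes ii = trans (cong (_* X₀ j k) (trans (X₀-inner ii j)
        (cong₂ (λ x y → - (x + y)) (Δ-off-diagonal _ (≢-sym j≢s)) (Δ-off-diagonal _ (≢-sym j≢t))))) (*-zeroˡ (X₀ j k))

      in-L : 3 ≤ ∣ S ∣ → S List.∈ L
      in-L 3≤ = subst (S List.∈_) (sym (accept S [] 3≤)) (here refl)

      L-only : ∀ {α} → α List.∈ L → α ≡ S
      L-only {α} α∈ with 3 ≤? ∣ S ∣
      ... | no 3≰ with () ← subst (α List.∈_) (reject S [] 3≰) α∈
      ... | yes 3≤ with subst (α List.∈_) (accept S [] 3≤) α∈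
      ...   | here eq = eq

      L-unique : Unique L
      L-unique with 3 ≤? ∣ S ∣
      ... | no 3≰  = subst Unique (sym (reject S [] 3≰)) []
      ... | yes 3≤ = subst Unique (sym (accept S [] 3≤)) (All.[] ∷ [])

    whole-reduction : Reduction S s t L
    whole-reduction .w        = weight L
    whole-reduction .w-weight = λ X → refl
    whole-reduction .frieze   = whole-frieze
    whole-reduction .l        = λ _ → s
    whole-reduction .r        = λ _ → t
    whole-reduction .p        = λ _ → S
    whole-reduction .X        = X₀
    whole-reduction .l∈S      = λ _ → s∈
    whole-reduction .r∈S      = λ _ → t∈
    whole-reduction .p∈L iv   = in-L (subst (3 ≤_) F-size (s≤s (s≤s (1≤∣∣ (F⁺ iv)))))
    whole-reduction .row-s (v∈ , v≢s , v≢t) = trans (one v∈ s∈ v≢s) (sym (cong₂ _+_ (nil s∈) (one t∈ s∈ (≢-sym s≢t))))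
    whole-reduction .row-t (v∈ , v≢s , v≢t) = trans (one v∈ t∈ v≢t) (sym (cong₂ _+_ (one s∈ t∈ s≢t) (nil t∈)))
    whole-reduction .same-piece {v} {u} (v∈ , v≢s , v≢t) (u∈ , u≢s , u≢t) _ = value v u (entry-same v∈ u∈)
      (one s∈ u∈ (≢-sym u≢s)) (one t∈ u∈ (≢-sym u≢t)) (one v∈ s∈ v≢s) (nil s∈) (one t∈ s∈ (≢-sym s≢t))
      (one v∈ t∈ v≢t) (one s∈ t∈ s≢t) (nil t∈)
    whole-reduction .different-pieces _ _ p≢ = contradiction refl p≢
    whole-reduction .fibre α∈ with refl ← L-only α∈ = F , (λ v∈ → F⁻ v∈ , refl) , (λ iv _ → F⁺ iv) , F-size
    whole-reduction .unique     = L-unique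
    whole-reduction .X-inner    = X₀-inner
    whole-reduction .X-outer    = X₀-outer
    whole-reduction .unimodular  = unimodular-𝟙+ X₀ X₀²≡0
    whole-reduction .unimodularᵀ = unimodular-𝟙+ (X₀ ᵀ) λ i j k → trans (*-comm (X₀ j i) (X₀ k j)) (X₀²≡0 k j i)

  module Glue {S S₁ S₂ : Subset n} {a b s t : Fin n} {L N : List (Subset n)}
              (sep₁ : Separated S S₁ S₂ a b) (sep₂ : Separated S S₂ S₁ b a)
              (s∈S₂ : s ∈ S₂) (t∈S₂ : t ∈ S₂)
              (pieces₁ : All (Piece S₁) L) (pieces₂ : All (Piece S₂) N)
              (red₁ : Reduction S₁ a b L) (red₂ : Reduction S₂ s t N) where
    open Separated sep₁
    private
      module R₁ = Reduction red₁
      module R₂ = Reduction red₂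
      module G = Glued sep₁ sep₂ R₁.frieze R₂.frieze

      pick : ∀ {P A : Set} → Dec P → A → A → A
      pick (yes _) x y = x
      pick (no _)  x y = y

      pick-yes : ∀ {P A : Set} (P? : Dec P) {x y : A} → P → pick P? x y ≡ x
      pick-yes (yes _) _ = refl
      pick-yes (no ¬p) p = contradiction p ¬p

      pick-no : ∀ {P A : Set} (P? : Dec P) {x y : A} → ¬ P → pick P? x y ≡ y
      pick-no (yes p) ¬p = contradiction p ¬p
      pick-no (no _)  _  = refl

      -- The chord ends a and b lie in both parts. They are the anchors of the root edge of the
      -- first part and never interior there, so their data come from the second.
      both : ∀ {A : Set} → (Fin n → A) → (Fin n → A) → Fin n → A
      both f₁ f₂ v = pick (v ∈? S₂) (f₂ v) (f₁ v)

      l₀ r₀ : Fin n → Fin n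
      p₀ : Fin n → Subset n
      l₀ = both R₁.l R₂.l
      r₀ = both R₁.r R₂.r
      p₀ = both R₁.p R₂.p

      w₀ : Subset n → ℕ
      w₀ = R₁.w ⋆ R₂.w

      frieze₀ : Frieze S w₀
      frieze₀ = glued sep₁ sep₂ R₁.frieze R₂.frieze

      M₀ : Matrix n
      M₀ = walksIn w₀ S

      Inner₀ : Fin n → Set
      Inner₀ = Interior S s t

      inner₁∉S₂ : ∀ {v} → R₁.Inner v → v ∉ S₂
      inner₁∉S₂ (v∈ , v≢a , v≢b) v∈₂ with meet v∈ v∈₂
      ... | inj₁ v≡a = v≢a v≡a
      ... | inj₂ v≡b = v≢b v≡b

      inner₁⇒inner : ∀ {v} → R₁.Inner v → Inner₀ v
      inner₁⇒inner iv@(v∈ , _) = ⊆₁ v∈ , (λ { refl → inner₁∉S₂ iv s∈S₂ }) , (λ { refl → inner₁∉S₂ iv t∈S₂ })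

      inner₂⇒inner : ∀ {v} → R₂.Inner v → Inner₀ v
      inner₂⇒inner (v∈ , v≢s , v≢t) = ⊆₂ v∈ , v≢s , v≢t

      data View (v : Fin n) : Set where
        first  : R₁.Inner v → l₀ v ≡ R₁.l v → r₀ v ≡ R₁.r v → p₀ v ≡ R₁.p v → View v
        second : R₂.Inner v → l₀ v ≡ R₂.l v → r₀ v ≡ R₂.r v → p₀ v ≡ R₂.p v → View v

      view₁ : ∀ {v} → R₁.Inner v → View v
      view₁ {v} iv = first iv (pick-no (v ∈? S₂) (inner₁∉S₂ iv)) (pick-no (v ∈? S₂) (inner₁∉S₂ iv)) (pick-no (v ∈? S₂) (inner₁∉S₂ iv))

      view₂ : ∀ {v} → R₂.Inner v → View v
      view₂ {v} iv@(v∈ , _) = second iv (pick-yes (v ∈? S₂) v∈) (pick-yes (v ∈? S₂) v∈) (pick-yes (v ∈? S₂) v∈)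

      view : ∀ {v} → Inner₀ v → View v
      view {v} (v∈ , v≢s , v≢t) with v ∈? S₂ | cover v∈
      ... | yes v∈₂ | _        = view₂ (v∈₂ , v≢s , v≢t)
      ... | no v∉₂  | inj₂ v∈₂ = contradiction v∈₂ v∉₂
      ... | no v∉₂  | inj₁ v∈₁ = view₁ (v∈₁ , (λ { refl → v∉₂ a∈S₂ }) , (λ { refl → v∉₂ b∈S₂ }))

      M≡M₁ : ∀ {i j} → i ∈ S₁ → j ∈ S₁ → M₀ i j ≡ R₁.M i j
      M≡M₁ i∈ j∈ = cong +_ (G.same₁ i∈ j∈)

      M≡M₂ : ∀ {i j} → i ∈ S₂ → j ∈ S₂ → M₀ i j ≡ R₂.M i j
      M≡M₂ i∈ j∈ = cong +_ (G.same₂ i∈ j∈)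

      M-sym : ∀ {i j} → i ∈ S → j ∈ S → M₀ i j ≡ M₀ j i
      M-sym i∈ j∈ = cong +_ (Frieze.symmetric frieze₀ i∈ j∈)

      M-ptolemy : ∀ {i j} → i ∈ S₁ → j ∈ S₂ → M₀ i j ≡ R₁.M i a * R₂.M b j + R₁.M i b * R₂.M a j
      M-ptolemy {i} {j} i∈ j∈ = trans (cong +_ (G.ptolemy i∈ j∈))
        (trans (pos-+ (R₁.w (S₁ ∩ arc i a) ℕ.* R₂.w (S₂ ∩ arc b j)) _)
          (cong₂ _+_ (pos-* (R₁.w (S₁ ∩ arc i a)) _) (pos-* (R₁.w (S₁ ∩ arc i b)) _)))

      -- By Ptolemy, row v of `M₀` in the columns of S₂ depends linearly on its two entries at a and
      -- b within S₁. In these two columns row v is the sum of the rows of its anchors by `row-s`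
      -- and `row-t`, hence it is so in every column of S₂.
      row-across : ∀ {v y} → R₁.Inner v → y ∈ S₂ → M₀ v y ≡ M₀ (R₁.l v) y + M₀ (R₁.r v) y
      row-across {v} {y} iv@(v∈ , _) y∈ = begin
        M₀ v y
          ≡⟨ M-ptolemy v∈ y∈ ⟩
        R₁.M v a * R₂.M b y + R₁.M v b * R₂.M a y
          ≡⟨ cong₂ (λ x z → x * R₂.M b y + z * R₂.M a y) (R₁.row-s iv) (R₁.row-t iv) ⟩
        (R₁.M lv a + R₁.M rv a) * R₂.M b y + (R₁.M lv b + R₁.M rv b) * R₂.M a y
          ≡⟨ ring (R₁.M lv a) (R₁.M rv a) (R₂.M b y) (R₁.M lv b) (R₁.M rv b) (R₂.M a y) ⟩
        (R₁.M lv a * R₂.M b y + R₁.M lv b * R₂.M a y) + (R₁.M rv a * R₂.M b y + R₁.M rv b * R₂.M a y)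
          ≡⟨ cong₂ _+_ (M-ptolemy (R₁.l∈S iv) y∈) (M-ptolemy (R₁.r∈S iv) y∈) ⟨
        M₀ lv y + M₀ rv y ∎
        where
        open ≡-Reasoning
        lv = R₁.l v
        rv = R₁.r v
        ring : ∀ p q x r s y → (p + q) * x + (r + s) * y ≡ (p * x + r * y) + (q * x + s * y)
        ring = solve-∀

      row-root : ∀ {x} → x ∈ S₂ → (∀ {v} → R₂.Inner v → R₂.M v x ≡ R₂.M (R₂.l v) x + R₂.M (R₂.r v) x) →
                 ∀ {v} → Inner₀ v → M₀ v x ≡ M₀ (l₀ v) x + M₀ (r₀ v) x
      row-root {x} x∈ row₂ {v} iv with view iv
      ... | first iv₁ el er _ = subst₂ (λ y z → M₀ v x ≡ M₀ y x + M₀ z x) (sym el) (sym er) (row-across iv₁ x∈)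
      ... | second iv₂ el er _ = subst₂ (λ y z → M₀ v x ≡ M₀ y x + M₀ z x) (sym el) (sym er)
        (trans (M≡M₂ (proj₁ iv₂) x∈) (trans (row₂ iv₂)
          (sym (cong₂ _+_ (M≡M₂ (R₂.l∈S iv₂) x∈) (M≡M₂ (R₂.r∈S iv₂) x∈)))))

      reduced-points : ∀ (M : Matrix n) v u {l l′ r r′ m m′ q q′} → l ≡ l′ → r ≡ r′ → m ≡ m′ → q ≡ q′ →
                       reduced M v l r u m q ≡ reduced M v l′ r′ u m′ q′
      reduced-points M v u refl refl refl refl = refl

      reduced-cong : ∀ {M M′ : Matrix n} {T : Subset n} → (∀ {i j} → i ∈ T → j ∈ T → M i j ≡ M′ i j) →
        ∀ {v l r u m q} → v ∈ T → l ∈ T → r ∈ T → u ∈ T → m ∈ T → q ∈ T →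
        reduced M v l r u m q ≡ reduced M′ v l r u m q
      reduced-cong {M} {M′} {T} M≡ {v} {l} {r} v∈ l∈ r∈ u∈ m∈ q∈ = cong₂ _-_ (row u∈) (cong₂ _+_ (row m∈) (row q∈))
        where
        row : ∀ {x} → x ∈ T → M v x - (M l x + M r x) ≡ M′ v x - (M′ l x + M′ r x)
        row x∈ = cong₂ _-_ (M≡ v∈ x∈) (cong₂ _+_ (M≡ l∈ x∈) (M≡ r∈ x∈))

      -- Brings an entry with v in the second part and u in the first to the form of
      -- `reduced-across`, where the reduced row of u already vanishes on S₂.
      reduced-transpose : ∀ {v l r u m q} → v ∈ S → l ∈ S → r ∈ S → u ∈ S → m ∈ S → q ∈ S →
                          reduced M₀ v l r u m q ≡ reduced M₀ u m q v l r
      reduced-transpose {v} {l} {r} {u} {m} {q} v∈ l∈ r∈ u∈ m∈ q∈ = trans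
        (reduced-cong {M′ = M₀ ᵀ} M-sym v∈ l∈ r∈ u∈ m∈ q∈)
        (ring (M₀ u v) (M₀ u l) (M₀ u r) (M₀ m v) (M₀ m l) (M₀ m r) (M₀ q v) (M₀ q l) (M₀ q r))
        where
        ring : ∀ a b c d e f g h i → (a - (b + c)) - ((d - (e + f)) + (g - (h + i))) ≡
                                     (a - (d + g)) - ((b - (e + h)) + (c - (f + i)))
        ring = solve-∀

      reduced-across : ∀ {v u m q} → R₁.Inner v → u ∈ S₂ → m ∈ S₂ → q ∈ S₂ →
                       reduced M₀ v (R₁.l v) (R₁.r v) u m q ≡ 0ℤ
      reduced-across {v} iv u∈ m∈ q∈ = cong₂ _-_ (row u∈) (cong₂ _+_ (row m∈) (row q∈))
        where
        row : ∀ {x} → x ∈ S₂ → M₀ v x - (M₀ (R₁.l v) x + M₀ (R₁.r v) x) ≡ 0ℤ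
        row {x} x∈ = trans (cong (_- (M₀ (R₁.l v) x + M₀ (R₁.r v) x)) (row-across iv x∈))
                           (+-inverseʳ (M₀ (R₁.l v) x + M₀ (R₁.r v) x))

      -- A common piece would lie in both parts, hence among a and b, but pieces have at least three
      -- vertices.
      disjoint : ∀ {α} → α List.∈ L → α List.∈ N → ⊥₀
      disjoint {α} α∈L α∈N with (α⊆₁ , 3≤) ← All.lookup pieces₁ α∈L | (α⊆₂ , _) ← All.lookup pieces₂ α∈N =
        ℕ.1+n≰n (ℕ.≤-trans 3≤ (∣pair∣≤2 a b λ v∈ → meet (α⊆₁ v∈) (α⊆₂ v∈)))

      reduced-same : ∀ {v u} → View v → View u → p₀ v ≡ p₀ u → reduced M₀ v (l₀ v) (r₀ v) u (l₀ u) (r₀ u) ≡ -1ℤ - 𝟙 v u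
      reduced-same {v} {u} (first iv el er ep) (first iu em eq ep′) same = trans (reduced-points M₀ v u el er em eq)
        (trans (reduced-cong M≡M₁ (proj₁ iv) (R₁.l∈S iv) (R₁.r∈S iv) (proj₁ iu) (R₁.l∈S iu) (R₁.r∈S iu))
               (R₁.same-piece iv iu (trans (sym ep) (trans same ep′))))
      reduced-same {v} {u} (second iv el er ep) (second iu em eq ep′) same = trans (reduced-points M₀ v u el er em eq)
        (trans (reduced-cong M≡M₂ (proj₁ iv) (R₂.l∈S iv) (R₂.r∈S iv) (proj₁ iu) (R₂.l∈S iu) (R₂.r∈S iu))
               (R₂.same-piece iv iu (trans (sym ep) (trans same ep′))))
      reduced-same (first iv _ _ ep) (second iu _ _ ep′) same =
        ⊥-elim (disjoint (R₁.p∈L iv) (subst (List._∈ N) (trans (sym ep′) (trans (sym same) ep)) (R₂.p∈L iu)))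
      reduced-same (second iv _ _ ep) (first iu _ _ ep′) same =
        ⊥-elim (disjoint (R₁.p∈L iu) (subst (List._∈ N) (trans (sym ep) (trans same ep′)) (R₂.p∈L iv)))

      reduced-different : ∀ {v u} → View v → View u → p₀ v ≢ p₀ u → reduced M₀ v (l₀ v) (r₀ v) u (l₀ u) (r₀ u) ≡ 0ℤ
      reduced-different {v} {u} (first iv el er ep) (first iu em eq ep′) p≢ = trans (reduced-points M₀ v u el er em eq)
        (trans (reduced-cong M≡M₁ (proj₁ iv) (R₁.l∈S iv) (R₁.r∈S iv) (proj₁ iu) (R₁.l∈S iu) (R₁.r∈S iu))
               (R₁.different-pieces iv iu λ same → p≢ (trans ep (trans same (sym ep′)))))
      reduced-different {v} {u} (second iv el er ep) (second iu em eq ep′) p≢ = trans (reduced-points M₀ v u el er em eq)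
        (trans (reduced-cong M≡M₂ (proj₁ iv) (R₂.l∈S iv) (R₂.r∈S iv) (proj₁ iu) (R₂.l∈S iu) (R₂.r∈S iu))
               (R₂.different-pieces iv iu λ same → p≢ (trans ep (trans same (sym ep′)))))
      reduced-different {v} {u} (first iv el er _) (second iu em eq _) _ = trans (reduced-points M₀ v u el er em eq)
        (reduced-across iv (proj₁ iu) (R₂.l∈S iu) (R₂.r∈S iu))
      reduced-different {v} {u} (second iv el er _) (first iu em eq _) _ = trans (reduced-points M₀ v u el er em eq)
        (trans (reduced-transpose (⊆₂ (proj₁ iv)) (⊆₂ (R₂.l∈S iv)) (⊆₂ (R₂.r∈S iv)) (⊆₁ (proj₁ iu)) (⊆₁ (R₁.l∈S iu)) (⊆₁ (R₁.r∈S iu)))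
               (reduced-across iu (proj₁ iv) (R₂.l∈S iv) (R₂.r∈S iv)))

      X₀ : Matrix n
      X₀ v x = R₂.X v x + R₁.X v x

      -- Anchors of the second part lie in S₂ and so are not interior to the first. The product in
      -- the other order need not vanish, as an anchor of the first part may be a chord end that is
      -- interior to the second. So `X₀` need not be square-zero, and its unimodularity comes from
      -- the factorisation (1 + X₂)(1 + X₁).
      X₂X₁≡0 : ∀ i j k → R₂.X i j * R₁.X j k ≡ 0ℤ
      X₂X₁≡0 i j k with interior? S₁ a b j | interior? S₂ s t i
      ... | no ¬ij | _      = trans (cong (R₂.X i j *_) (R₁.X-outer ¬ij k)) (*-zeroʳ (R₂.X i j))
      ... | yes ij | no ¬ii = trans (cong (_* R₁.X j k) (R₂.X-outer ¬ii j)) (*-zeroˡ (R₁.X j k))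
      ... | yes ij | yes ii = trans (cong (_* R₁.X j k) (trans (R₂.X-inner ii j)
        (cong₂ (λ x y → - (x + y))
          (Δ-off-diagonal (λ _ → 1ℤ) {R₂.l i} {j} λ { refl → inner₁∉S₂ ij (R₂.l∈S ii) })
          (Δ-off-diagonal (λ _ → 1ℤ) {R₂.r i} {j} λ { refl → inner₁∉S₂ ij (R₂.r∈S ii) })))) (*-zeroˡ (R₁.X j k))

      membership : ∀ {v} → View v → p₀ v List.∈ L ++ N
      membership (first iv _ _ ep)  = subst (List._∈ L ++ N) (sym ep) (∈-++⁺ˡ (R₁.p∈L iv))
      membership (second iv _ _ ep) = subst (List._∈ L ++ N) (sym ep) (∈-++⁺ʳ L (R₂.p∈L iv))

      X-inner₀ : ∀ {v} → View v → ∀ x → X₀ v x ≡ - (𝟙 (l₀ v) x + 𝟙 (r₀ v) x)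
      X-inner₀ {v} (first iv el er _) x = trans
        (cong₂ _+_ (R₂.X-outer (λ iv₂ → inner₁∉S₂ iv (proj₁ iv₂)) x) (R₁.X-inner iv x))
        (trans (+-identityˡ _) (sym (cong₂ (λ y z → - (𝟙 y x + 𝟙 z x)) el er)))
      X-inner₀ {v} (second iv el er _) x = trans
        (cong₂ _+_ (R₂.X-inner iv x) (R₁.X-outer (λ iv₁ → inner₁∉S₂ iv₁ (proj₁ iv)) x))
        (trans (+-identityʳ _) (sym (cong₂ (λ y z → - (𝟙 y x + 𝟙 z x)) el er)))

    glued-reduction : Reduction S s t (L ++ N)
    glued-reduction .w = w₀
    glued-reduction .w-weight Y = trans (⋆-cong R₁.w-weight R₂.w-weight Y) (sym (weight-++ L N Y))
    glued-reduction .frieze = frieze₀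
    glued-reduction .l = l₀
    glued-reduction .r = r₀
    glued-reduction .p = p₀
    glued-reduction .X = X₀
    glued-reduction .l∈S iv with view iv
    ... | first iv₁ el _ _  = subst (_∈ S) (sym el) (⊆₁ (R₁.l∈S iv₁))
    ... | second iv₂ el _ _ = subst (_∈ S) (sym el) (⊆₂ (R₂.l∈S iv₂))
    glued-reduction .r∈S iv with view iv
    ... | first iv₁ _ er _  = subst (_∈ S) (sym er) (⊆₁ (R₁.r∈S iv₁))
    ... | second iv₂ _ er _ = subst (_∈ S) (sym er) (⊆₂ (R₂.r∈S iv₂))
    glued-reduction .p∈L iv = membership (view iv)
    glued-reduction .row-s = row-root s∈S₂ R₂.row-s
    glued-reduction .row-t = row-root t∈S₂ R₂.row-t
    glued-reduction .same-piece iv iu = reduced-same (view iv) (view iu)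
    glued-reduction .different-pieces iv iu = reduced-different (view iv) (view iu)
    glued-reduction .fibre {α} α∈ with ∈-++⁻ L α∈
    ... | inj₁ α∈L with (F , F⁻ , F⁺ , size) ← R₁.fibre α∈L = F , into , back , size
      where
      into : ∀ {v} → v ∈ F → Inner₀ v × p₀ v ≡ α
      into {v} v∈ with (iv , eq) ← F⁻ v∈ = inner₁⇒inner iv , trans (pick-no (v ∈? S₂) (inner₁∉S₂ iv)) eq
      back : ∀ {v} → Inner₀ v → p₀ v ≡ α → v ∈ F
      back iv eq with view iv
      ... | first iv₁ _ _ ep  = F⁺ iv₁ (trans (sym ep) eq)
      ... | second iv₂ _ _ ep = ⊥-elim (disjoint α∈L (subst (List._∈ N) (trans (sym ep) eq) (R₂.p∈L iv₂)))
    ... | inj₂ α∈N with (F , F⁻ , F⁺ , size) ← R₂.fibre α∈N = F , into , back , size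
      where
      into : ∀ {v} → v ∈ F → Inner₀ v × p₀ v ≡ α
      into {v} v∈ with (iv , eq) ← F⁻ v∈ = inner₂⇒inner iv , trans (pick-yes (v ∈? S₂) (proj₁ iv)) eq
      back : ∀ {v} → Inner₀ v → p₀ v ≡ α → v ∈ F
      back iv eq with view iv
      ... | first iv₁ _ _ ep  = ⊥-elim (disjoint (subst (List._∈ L) (trans (sym ep) eq) (R₁.p∈L iv₁)) α∈N)
      ... | second iv₂ _ _ ep = F⁺ iv₂ (trans (sym ep) eq)
    glued-reduction .unique = unique-++ R₁.unique R₂.unique λ (α∈L , α∈N) → disjoint α∈L α∈N
    glued-reduction .X-inner iv = X-inner₀ (view iv)
    glued-reduction .X-outer {v} ¬iv x = cong₂ _+_ (R₂.X-outer (λ iv → ¬iv (inner₂⇒inner iv)) x)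
                                                   (R₁.X-outer (λ iv → ¬iv (inner₁⇒inner iv)) x)
    glued-reduction .unimodular = unimodular-cong (𝟙+-⊗-𝟙+ R₂.X R₁.X X₂X₁≡0) (unimodular-⊗ R₂.unimodular R₁.unimodular)
    glued-reduction .unimodularᵀ = unimodular-cong
      (λ i j → trans (𝟙+-⊗-𝟙+ (R₁.X ᵀ) (R₂.X ᵀ) (λ i j k → trans (*-comm (R₁.X j i) (R₂.X k j)) (X₂X₁≡0 k j i)) i j)
                     (cong (λ x → 𝟙 i j + x) (+-comm (R₁.X j i) (R₂.X j i))))
      (unimodular-⊗ R₁.unimodularᵀ R₂.unimodularᵀ)

  -- The bounds on S put s and t on the outer side of every diagonal.
  reduction : ∀ {ds} {S : Subset n} {s t L} → s ∈ S → t ∈ S → toℕ s < toℕ t →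
              (∀ {v} → v ∈ S → toℕ s ≤ toℕ v × toℕ v ≤ toℕ t) →
              Subdivision ds S s t L → Reduction S s t L
  reduction s∈ t∈ s<t range whole = Whole.whole-reduction s∈ t∈ λ { refl → ℕ.<-irrefl refl s<t }
  reduction {S = S} s∈ t∈ s<t range (glue {d = d} _ a∈ b∈ sub₁ sub₂ N↭) = reduction-↭ (↭-sym N↭)
    (Glue.glued-reduction (inner-separated d a∈ b∈) (outer-separated d a∈ b∈) s∈₂ t∈₂ (pieces-of sub₁) (pieces-of sub₂)
      (reduction a∈₁ b∈₁ (diagonal-< d) (λ v∈ → ∈-inner⁻ d (p∩q⊆q S (inner d) v∈)) sub₁)
      (reduction s∈₂ t∈₂ s<t (λ v∈ → range (p∩q⊆p S (outer d) v∈)) sub₂))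
    where
    s∈₂ = x∈p∩q⁺ (s∈ , ∈-outer⁺ d (inj₁ (proj₁ (range a∈))))
    t∈₂ = x∈p∩q⁺ (t∈ , ∈-outer⁺ d (inj₂ (proj₂ (range b∈))))
    a∈₁ = x∈p∩q⁺ (a∈ , ∈-inner⁺ d (ℕ.≤-refl , ℕ.<⇒≤ (diagonal-< d)))
    b∈₁ = x∈p∩q⁺ (b∈ , ∈-inner⁺ d (ℕ.<⇒≤ (diagonal-< d) , ℕ.≤-refl))

-- Permutation and sign matrices

module MonomialMatrices where
  open import Data.Fin using (Fin; zero; suc; toℕ; fromℕ<; punchIn; punchOut)
  open import Data.Fin.Permutation using (Permutation; _⟨$⟩ʳ_; insert; insert-punchIn; id)
  open import Data.Fin.Properties using (punchOut-injective; punchIn-punchOut; suc-injective; _≟_)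
  open import Data.Integer using (ℤ; 0ℤ; 1ℤ; _*_)
  open import Data.Integer.Properties using (*-zeroˡ; *-zeroʳ; *-1-commutativeMonoid)
  open import Data.Nat using (ℕ; zero; suc; _<_; _≤_; s≤s; z≤n; s<s; z<s)
  open import Data.Product using (_,_; ∃)
  open import Data.Vec.Functional using (Vector)
  open import Function using (_∘_)
  open import Function.Bundles using (Inverse)
  open import Function.Definitions using (Injective)
  open import Relation.Binary.PropositionalEquality
  open import Relation.Nullary using (yes; no)
  import Algebra.Properties.CommutativeMonoid.Sum as CMSum
  open CMSum *-1-commutativeMonoid using () renaming (∑-distrib-+ to product-distrib-*;
    sum-permute to product-permute) public
  open CMSum Data.Integer.Properties.+-0-commutativeMonoid using (sum-permute)
  open Sums
  open Matrices
  open Unimodularity using (cancel-inner)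

  private variable m n : ℕ

  -- Used to bring the representatives of the pieces to the first m diagonal positions. Removing the
  -- value of ρ at 0 from the codomain leaves a smaller injection, and the permutation extending it
  -- is enlarged by 0 ↦ ρ 0.
  extend-injection : ∀ (ρ : Fin m → Fin n) → Injective _≡_ _≡_ ρ →
                     ∃ λ (σ : Permutation n n) → ∀ i (i<m : toℕ i < m) → σ ⟨$⟩ʳ i ≡ ρ (fromℕ< i<m)
  extend-injection {zero}          ρ inj = id , λ i ()
  extend-injection {suc m} {zero}  ρ inj with () ← ρ zero
  extend-injection {suc m} {suc n} ρ inj with extend-injection ρ′ ρ′-injective
    where
    ρ≢ : ∀ k → ρ zero ≢ ρ (suc k)
    ρ≢ k eq with () ← inj eq
    ρ′ : Fin m → Fin n
    ρ′ k = punchOut (ρ≢ k)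
    ρ′-injective : Injective _≡_ _≡_ ρ′
    ρ′-injective {x} {y} eq = suc-injective (inj (punchOut-injective (ρ≢ x) (ρ≢ y) eq))
  ... | π , extends = insert zero (ρ zero) π , λ where
    zero    (s≤s _)   → refl
    (suc i) (s≤s i<m) → trans (insert-punchIn zero (ρ zero) π i)
      (trans (cong (punchIn (ρ zero)) (extends i i<m)) (punchIn-punchOut _))

  product-truncate : ∀ (f : Vector ℤ n) (g : Vector ℤ m) → m ≤ n →
                     (∀ i (i<m : toℕ i < m) → f i ≡ g (fromℕ< i<m)) → (∀ i → m ≤ toℕ i → f i ≡ 1ℤ) →
                     product f ≡ product g
  product-truncate {zero}  {zero}  f g _       p q = refl
  product-truncate {suc n} {zero}  f g _       p q =
    cong₂ _*_ (q zero z≤n) (product-truncate (f ∘ suc) g z≤n (λ i ()) λ i _ → q (suc i) z≤n)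
  product-truncate {suc n} {suc m} f g (s≤s m≤n) p q =
    cong₂ _*_ (p zero z<s) (product-truncate (f ∘ suc) (g ∘ suc) m≤n (λ i i<m → p (suc i) (s<s i<m)) λ i m≤i → q (suc i) (s≤s m≤i))

  inGL-⊗ : ∀ {A B : Matrix n} → InGL A → InGL B → InGL (A ⊗ B)
  inGL-⊗ {A = A} {B} (A′ , A′A , AA′) (B′ , B′B , BB′) =
    B′ ⊗ A′ , cancel-inner {A = B′} {A′} {B} {A} B′B A′A , cancel-inner {A = A} {B} {A′} {B′} AA′ BB′

  Δ-⊗ : ∀ (a b : Vector ℤ n) → Δ a ⊗ Δ b ≋ Δ (λ i → a i * b i)
  Δ-⊗ a b i j with i ≟ j
  ... | yes refl = trans
    (sum-single (λ k → Δ a i k * Δ b k i) i λ k k≢i → trans (cong (_* Δ b k i) (Δ-off-diagonal a (≢-sym k≢i))) (*-zeroˡ (Δ b k i)))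
    (cong₂ _*_ (Δ-diagonal a i) (Δ-diagonal b i))
  ... | no i≢j = sum-zero λ k → product-zero k
    where
    product-zero : ∀ k → Δ a i k * Δ b k j ≡ 0ℤ
    product-zero k with i ≟ k
    ... | no _     = *-zeroˡ (Δ b k j)
    ... | yes refl = trans (cong (a i *_) (Δ-off-diagonal b i≢j)) (*-zeroʳ (a i))

  Δ-sign-inGL : ∀ (a : Vector ℤ n) → (∀ i → a i * a i ≡ 1ℤ) → InGL (Δ a)
  Δ-sign-inGL a a²≡1 = Δ a , square , square
    where
    square : Δ a ⊗ Δ a ≋ 𝟙
    square i j = trans (Δ-⊗ a a i j) (ones i j)
      where
      ones : Δ (λ i → a i * a i) ≋ 𝟙
      ones i j with i ≟ j
      ... | yes _ = a²≡1 i
      ... | no _  = refl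

  sandwich : ∀ (A B C D E : Matrix n) → (A ⊗ B) ⊗ C ⊗ (D ⊗ E) ≋ A ⊗ (B ⊗ C ⊗ D) ⊗ E
  sandwich A B C D E = ≋-trans (⊗-cong (⊗-assoc A B C) (≋-refl {A = D ⊗ E}))
    (≋-trans (≋-sym (⊗-assoc (A ⊗ (B ⊗ C)) D E)) (⊗-cong (⊗-assoc A (B ⊗ C) D) (≋-refl {A = E})))

  module _ (σ : Permutation n n) where
    rows columns : Matrix n
    rows i v    = 𝟙 (σ ⟨$⟩ʳ i) v
    columns v j = 𝟙 v (σ ⟨$⟩ʳ j)

    permute-entries : ∀ (A : Matrix n) i j → (rows ⊗ A ⊗ columns) i j ≡ A (σ ⟨$⟩ʳ i) (σ ⟨$⟩ʳ j)
    permute-entries A i j = trans (sum-𝟙ʳ (λ k → (rows ⊗ A) i k) (σ ⟨$⟩ʳ j)) (sum-𝟙ˡ (λ k → A k (σ ⟨$⟩ʳ j)) (σ ⟨$⟩ʳ i))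

    σ-injective : ∀ {i j} → σ ⟨$⟩ʳ i ≡ σ ⟨$⟩ʳ j → i ≡ j
    σ-injective {i} {j} eq = trans (sym (Inverse.strictlyInverseʳ σ i)) (trans (cong (Inverse.from σ) eq) (Inverse.strictlyInverseʳ σ j))

    permute-Δ : ∀ (a : Vector ℤ n) i j → Δ a (σ ⟨$⟩ʳ i) (σ ⟨$⟩ʳ j) ≡ Δ (λ i → a (σ ⟨$⟩ʳ i)) i j
    permute-Δ a i j with i ≟ j
    ... | yes refl = Δ-diagonal a (σ ⟨$⟩ʳ i)
    ... | no i≢j   = Δ-off-diagonal a (i≢j ∘ σ-injective)

    private
      rows-columns : rows ⊗ columns ≋ 𝟙
      rows-columns i j = trans (sum-𝟙ˡ (λ k → 𝟙 k (σ ⟨$⟩ʳ j)) (σ ⟨$⟩ʳ i)) (permute-Δ (λ _ → 1ℤ) i j)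

      columns-rows : columns ⊗ rows ≋ 𝟙
      columns-rows v w = trans (sym (sum-permute (λ k → 𝟙 v k * 𝟙 k w) σ)) (sum-𝟙ˡ (λ k → 𝟙 k w) v)

    rows-inGL : InGL rows
    rows-inGL = columns , columns-rows , rows-columns

    columns-inGL : InGL columns
    columns-inGL = rows , rows-columns , columns-rows

-- The walk matrix: block form, determinant and normal form

module WalkMatrices where
  open import Data.Fin using (Fin; zero; suc; toℕ; fromℕ; fromℕ<)
  open import Data.Fin.Permutation using (Permutation; _⟨$⟩ʳ_)
  open import Data.Fin.Properties using (_≟_; toℕ<n; toℕ-fromℕ; toℕ-fromℕ<; fromℕ<-toℕ; injective⇒≤)
  open import Data.Fin.Subset using (Subset; inside; outside; _∈_; _∉_; ∣_∣; ⊤; _∩_)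
  open import Data.Fin.Subset.Properties using (∈⊤; ∩-identityˡ; nonempty?; Empty-unique; ∣⊥∣≡0;
    _∈?_)
  open import Data.Integer using (ℤ; +_; 0ℤ; 1ℤ; -1ℤ; _+_; _*_; -_; _-_; _^_)
  open import Data.Integer.Properties using (*-zeroˡ; *-identityˡ; *-identityʳ; +-identityˡ;
    +-identityʳ; +-inverseʳ; pos-+)
  open import Data.Integer.Tactic.RingSolver using (solve-∀)
  open import Data.List using (List; []; _∷_; lookup)
  open import Data.List.Membership.Propositional.Properties using (∈-lookup)
  open import Data.List.Relation.Binary.Permutation.Propositional using (_↭_; ↭-sym; ↭-trans)
  open import Data.List.Relation.Binary.Permutation.Propositional.Properties using (All-resp-↭)
  open import Data.List.Relation.Unary.All as All using (All)
  open import Data.List.Relation.Unary.AllPairs using (_∷_)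
  open import Data.List.Relation.Unary.Any using (index)
  open import Data.List.Relation.Unary.Any.Properties using (lookup-index)
  open import Data.List.Relation.Unary.Unique.Propositional using (Unique)
  open import Data.Nat as ℕ using (ℕ; zero; suc; _≤_; _∸_; s≤s; z≤n)
  import Data.Nat.Properties as ℕ
  open import Data.Product using (_×_; _,_; ∃; ∃₂; proj₁; proj₂)
  open import Data.Sum using (_⊎_; inj₁; inj₂)
  open import Data.Vec using ([]; _∷_)
  open import Data.Vec.Functional using (Vector)
  open import Function using (_∘_)
  open import Relation.Binary.PropositionalEquality
  open import Relation.Nullary using (Dec; yes; no; ¬_; contradiction)
  open Sums
  open Matrices
  open Determinants
  open Unimodularity
  open Arcs
  open Subdivisions
  open Friezes
  open Reductions
  open MonomialMatrices

  unique-lookup : ∀ {A : Set} {xs : List A} → Unique xs → ∀ {i j} → lookup xs i ≡ lookup xs j → i ≡ j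
  unique-lookup {xs = x ∷ xs} (x∉ ∷ u) {zero}  {zero}  eq = refl
  unique-lookup {xs = x ∷ xs} (x∉ ∷ u) {zero}  {suc j} eq = contradiction eq (All.lookup x∉ (∈-lookup j))
  unique-lookup {xs = x ∷ xs} (x∉ ∷ u) {suc i} {zero}  eq = contradiction (sym eq) (All.lookup x∉ (∈-lookup i))
  unique-lookup {xs = x ∷ xs} (x∉ ∷ u) {suc i} {suc j} eq = cong suc (unique-lookup u eq)

  χ : ∀ {n} → Subset n → Vector ℤ n
  χ F v with v ∈? F
  ... | yes _ = 1ℤ
  ... | no _  = 0ℤ

  χ-∈ : ∀ {n} {F : Subset n} {v} → v ∈ F → χ F v ≡ 1ℤ
  χ-∈ {F = F} {v} v∈ with v ∈? F
  ... | yes _ = refl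
  ... | no v∉ = contradiction v∈ v∉

  χ-∉ : ∀ {n} {F : Subset n} {v} → v ∉ F → χ F v ≡ 0ℤ
  χ-∉ {F = F} {v} v∉ with v ∈? F
  ... | yes v∈ = contradiction v∈ v∉
  ... | no _   = refl

  sum-χ : ∀ {n} (F : Subset n) → sum (χ F) ≡ + ∣ F ∣
  sum-χ []            = refl
  sum-χ (outside ∷ F) = trans (+-identityˡ _) (trans (sum-cong-≗ tail-χ) (sum-χ F))
    where
    tail-χ : ∀ v → χ (outside ∷ F) (suc v) ≡ χ F v
    tail-χ v with v ∈? F
    ... | yes _ = refl
    ... | no _  = refl
  sum-χ (inside ∷ F)  = trans (cong (_+_ 1ℤ) (trans (sum-cong-≗ tail-χ) (sum-χ F))) (sym (pos-+ 1 ∣ F ∣))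
    where
    tail-χ : ∀ v → χ (inside ∷ F) (suc v) ≡ χ F v
    tail-χ v with v ∈? F
    ... | yes _ = refl
    ... | no _  = refl

  module Theorem {n : ℕ} (D : Dissection (suc n)) (1≤n : 1 ≤ n)
                 (red : Reduction ⊤ zero (fromℕ n) (Dissection.pieces D))
                 (pieces-large : All (Piece ⊤) (Dissection.pieces D)) where
    open Dissection D
    open Reduction red

    private
      last : Fin (suc n)
      last = fromℕ n

      0≢last : zero ≢ last
      0≢last eq = ℕ.<-irrefl (trans (cong toℕ eq) (toℕ-fromℕ n)) 1≤n

    -- Off the diagonal both sides count decompositions of the arc; on the diagonal the convention
    -- of no walk meets `zero-diagonal`.
    walkMatrix≋M : walkMatrix D ≋ M
    walkMatrix≋M i j = compare (i ≟ j)
      where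
      compare : Dec (i ≡ j) → walkMatrix D i j ≡ M i j
      compare (yes refl) = cong +_ (trans (walks-equal D i) (sym (Frieze.zero-diagonal frieze ∈⊤)))
      compare (no i≢j)   = cong +_ (trans (walks-distinct D i≢j)
        (sym (trans (w-weight (⊤ ∩ arc i j)) (cong (weight pieces) (∩-identityˡ (arc i j))))))

    private
      M-symmetric : ∀ i j → M i j ≡ M j i
      M-symmetric i j = cong +_ (Frieze.symmetric frieze ∈⊤ ∈⊤)

      M-diagonal : ∀ i → M i i ≡ 0ℤ
      M-diagonal i = cong +_ (Frieze.zero-diagonal frieze ∈⊤)

      M-last-zero : M last zero ≡ 1ℤ
      M-last-zero = cong +_ (Frieze.∩-empty frieze empty-arc)
        where
        empty-arc : ∀ {v} → v ∈ ⊤ → v ∉ arc last zero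
        empty-arc {v} v∈ v∈A with ∈-arc⁻ {i = last} {zero} v∈A
        ... | inj₁ (_ , ())
        ... | inj₂ (_ , inj₁ last<v) = ℕ.<⇒≱ last<v (subst (toℕ v ≤_) (sym (toℕ-fromℕ n)) (ℕ.s≤s⁻¹ (toℕ<n v)))
        ... | inj₂ (_ , inj₂ ())

      inner? : ∀ v → Dec (Inner v)
      inner? = interior? ⊤ zero last

      outer-cases : ∀ {v} → ¬ Inner v → v ≡ zero ⊎ v ≡ last
      outer-cases {v} ¬iv with v ≟ zero | v ≟ last
      ... | yes v≡0 | _          = inj₁ v≡0
      ... | no _    | yes v≡last = inj₂ v≡last
      ... | no v≢0  | no v≢last  = contradiction (∈⊤ , v≢0 , v≢last) ¬iv

      zero-outer : ¬ Inner zero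
      zero-outer (_ , 0≢0 , _) = 0≢0 refl

      last-outer : ¬ Inner last
      last-outer (_ , _ , last≢last) = last≢last refl

      outer-entry : ∀ {v u} → ¬ Inner v → ¬ Inner u → M v u ≡ 1ℤ - 𝟙 v u
      outer-entry {v} {u} ¬iv ¬iu with v ≟ u
      ... | yes refl = M-diagonal v
      ... | no v≢u with outer-cases ¬iv | outer-cases ¬iu
      ...   | inj₁ refl | inj₁ refl = contradiction refl v≢u
      ...   | inj₂ refl | inj₂ refl = contradiction refl v≢u
      ...   | inj₁ refl | inj₂ refl = trans (M-symmetric zero last) M-last-zero
      ...   | inj₂ refl | inj₁ refl = M-last-zero

      U V R B : Matrix (suc n)
      U = 𝟙+ X
      V = 𝟙+ (X ᵀ)
      R = U ⊗ M
      B = R ⊗ V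

      X-sum-inner : ∀ {v} → Inner v → ∀ (f : Vector ℤ (suc n)) → sum (λ k → X v k * f k) ≡ - (f (l v) + f (r v))
      X-sum-inner {v} iv f = begin
        sum (λ k → X v k * f k)
          ≡⟨ sum-cong-≗ (λ k → trans (cong (_* f k) (X-inner iv k)) (ring (𝟙 (l v) k) (𝟙 (r v) k) (f k))) ⟩
        sum (λ k → -1ℤ * (𝟙 (l v) k * f k) + -1ℤ * (𝟙 (r v) k * f k))
          ≡⟨ sum-linear (λ k → -1ℤ * (𝟙 (l v) k * f k)) (λ k → 𝟙 (r v) k * f k) -1ℤ ⟩
        sum (λ k → -1ℤ * (𝟙 (l v) k * f k)) + -1ℤ * sum (λ k → 𝟙 (r v) k * f k)
          ≡⟨ cong₂ (λ a b → a + -1ℤ * b)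
               (trans (sym (*-distribˡ-sum -1ℤ (λ k → 𝟙 (l v) k * f k))) (cong (-1ℤ *_) (sum-𝟙ˡ f (l v)))) (sum-𝟙ˡ f (r v)) ⟩
        -1ℤ * f (l v) + -1ℤ * f (r v)
          ≡⟨ ring′ (f (l v)) (f (r v)) ⟩
        - (f (l v) + f (r v)) ∎
        where
        open ≡-Reasoning
        ring : ∀ a b c → - (a + b) * c ≡ -1ℤ * (a * c) + -1ℤ * (b * c)
        ring = solve-∀
        ring′ : ∀ a b → -1ℤ * a + -1ℤ * b ≡ - (a + b)
        ring′ = solve-∀

      X-sum-outer : ∀ {v} → ¬ Inner v → ∀ (f : Vector ℤ (suc n)) → sum (λ k → X v k * f k) ≡ 0ℤ
      X-sum-outer ¬iv f = sum-zero λ k → trans (cong (_* f k) (X-outer ¬iv k)) (*-zeroˡ (f k))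

      R-inner : ∀ {v} → Inner v → ∀ u → R v u ≡ M v u - (M (l v) u + M (r v) u)
      R-inner {v} iv u = trans (𝟙+-⊗ X M v u) (cong (_+_ (M v u)) (X-sum-inner iv (λ k → M k u)))

      R-outer : ∀ {v} → ¬ Inner v → ∀ u → R v u ≡ M v u
      R-outer {v} ¬iv u = trans (𝟙+-⊗ X M v u) (trans (cong (_+_ (M v u)) (X-sum-outer ¬iv (λ k → M k u))) (+-identityʳ _))

      swap-sum : ∀ v u → sum (λ k → R v k * X u k) ≡ sum (λ k → X u k * R v k)
      swap-sum v u = sum-cong-≗ λ k → ring (R v k) (X u k)
        where
        ring : ∀ a b → a * b ≡ b * a
        ring = solve-∀

      B-inner : ∀ v {u} → Inner u → B v u ≡ R v u - (R v (l u) + R v (r u))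
      B-inner v {u} iu = trans (⊗-𝟙+ R (X ᵀ) v u) (cong (_+_ (R v u)) (trans (swap-sum v u) (X-sum-inner iu (R v))))

      B-outer : ∀ v {u} → ¬ Inner u → B v u ≡ R v u
      B-outer v {u} ¬iu = trans (⊗-𝟙+ R (X ᵀ) v u)
        (trans (cong (_+_ (R v u)) (trans (swap-sum v u) (X-sum-outer ¬iu (R v)))) (+-identityʳ _))

      B-inner-inner : ∀ {v u} → Inner v → Inner u → B v u ≡ reduced M v (l v) (r v) u (l u) (r u)
      B-inner-inner {v} {u} iv iu = trans (B-inner v iu)
        (cong₂ _-_ (R-inner iv u) (cong₂ _+_ (R-inner iv (l u)) (R-inner iv (r u))))

      B-inner-outer : ∀ {v u} → Inner v → ¬ Inner u → B v u ≡ 0ℤ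
      B-inner-outer {v} {u} iv ¬iu = trans (B-outer v ¬iu) (trans (R-inner iv u)
        (trans (cong (_- (M (l v) u + M (r v) u)) (root-row (outer-cases ¬iu))) (+-inverseʳ (M (l v) u + M (r v) u))))
        where
        root-row : u ≡ zero ⊎ u ≡ last → M v u ≡ M (l v) u + M (r v) u
        root-row (inj₁ refl) = row-s iv
        root-row (inj₂ refl) = row-t iv

      -- Mirror image of `B-inner-outer`: since M is symmetric, row v of `R` at an outer v is column
      -- v of M, so the column operation at u reproduces the row operation at u.
      B-outer-inner : ∀ {v u} → ¬ Inner v → Inner u → B v u ≡ 0ℤ
      B-outer-inner {v} {u} ¬iv iu = trans (B-inner v iu) (trans
        (cong₂ _-_ (entry-at u) (cong₂ _+_ (entry-at (l u)) (entry-at (r u))))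
        (trans (sym (R-inner iu v)) (trans (sym (B-outer u ¬iv)) (B-inner-outer iu ¬iv))))
        where
        entry-at : ∀ x → R v x ≡ M x v
        entry-at x = trans (R-outer ¬iv x) (M-symmetric v x)

      B-outer-outer : ∀ {v u} → ¬ Inner v → ¬ Inner u → B v u ≡ 1ℤ - 𝟙 v u
      B-outer-outer {v} {u} ¬iv ¬iu = trans (B-outer v ¬iu) (trans (R-outer ¬iv u) (outer-entry ¬iv ¬iu))

      abstract
        -- A piece has d ≥ 3 vertices, so its fibre of d - 2 vertices is nonempty; any of them will
        -- do.
        representative : ∀ k → ∃ λ v → Inner v × p v ≡ α k
        representative k with fibre (∈-lookup {xs = pieces} k)
        ... | F , F⁻ , _ , size with nonempty? F
        ...   | yes (v , v∈) = v , F⁻ v∈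
        ...   | no empty     = contradiction
          (subst (3 ≤_) (sym size) (proj₂ (All.lookup pieces-large (∈-lookup {xs = pieces} k))))
          (ℕ.<⇒≱ (s≤s (ℕ.≤-reflexive (cong (2 ℕ.+_) (trans (cong ∣_∣ (Empty-unique empty)) (∣⊥∣≡0 (suc n)))))))

      ρ : Fin m → Fin (suc n)
      ρ k = proj₁ (representative k)

      ρ-inner : ∀ k → Inner (ρ k)
      ρ-inner k = proj₁ (proj₂ (representative k))

      p-ρ : ∀ k → p (ρ k) ≡ α k
      p-ρ k = proj₂ (proj₂ (representative k))

      α-injective : ∀ {k k′} → α k ≡ α k′ → k ≡ k′
      α-injective = unique-lookup unique

      ρ-injective : ∀ {k k′} → ρ k ≡ ρ k′ → k ≡ k′
      ρ-injective {k} {k′} eq = α-injective (trans (sym (p-ρ k)) (trans (cong p eq) (p-ρ k′)))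

      piece : ∀ {v} → Inner v → Fin m
      piece iv = index (p∈L iv)

      α-piece : ∀ {v} (iv : Inner v) → p v ≡ α (piece iv)
      α-piece iv = lookup-index (p∈L iv)

      abstract
        -- The vertices 0 and n, which no fibre contains, form one more block with representative 0.
        q : Fin (suc n) → Fin (suc n)
        q v with inner? v
        ... | yes iv = ρ (piece iv)
        ... | no _   = zero

        q-inner : ∀ {v} → Inner v → ∃ λ k → q v ≡ ρ k × p v ≡ α k
        q-inner {v} iv with inner? v
        ... | yes iv′ = piece iv′ , refl , α-piece iv′
        ... | no ¬iv  = contradiction iv ¬iv

        q-outer : ∀ {v} → ¬ Inner v → q v ≡ zero
        q-outer {v} ¬iv with inner? v
        ... | yes iv = contradiction iv ¬iv
        ... | no _   = refl

        -- The sign that brings both kinds of block to the form η - δ: those of the pieces are -1 -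
        -- δ, and that of 0 and n is 1 - δ.
        η : Fin (suc n) → ℤ
        η v with inner? v
        ... | yes _ = -1ℤ
        ... | no _  = 1ℤ

        η-inner : ∀ {v} → Inner v → η v ≡ -1ℤ
        η-inner {v} iv with inner? v
        ... | yes _  = refl
        ... | no ¬iv = contradiction iv ¬iv

        η-outer : ∀ {v} → ¬ Inner v → η v ≡ 1ℤ
        η-outer {v} ¬iv with inner? v
        ... | yes iv = contradiction iv ¬iv
        ... | no _   = refl

      q-stays-inner : ∀ {v} → Inner v → Inner (q v)
      q-stays-inner iv with (k , qv≡ρ , _) ← q-inner iv = subst Inner (sym qv≡ρ) (ρ-inner k)

      p-q : ∀ {v} → Inner v → p (q v) ≡ p v
      p-q iv with (k , qv≡ρ , pv≡α) ← q-inner iv = trans (cong p qv≡ρ) (trans (p-ρ k) (sym pv≡α))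

      q-same : ∀ {v u} → Inner v → Inner u → p v ≡ p u → q v ≡ q u
      q-same iv iu eq with (k , qv≡ρ , pv≡α) ← q-inner iv | (k′ , qu≡ρ , pu≡α) ← q-inner iu =
        trans qv≡ρ (trans (cong ρ (α-injective (trans (sym pv≡α) (trans eq pu≡α)))) (sym qu≡ρ))

      q-ρ : ∀ k → q (ρ k) ≡ ρ k
      q-ρ k with (k′ , q≡ρ , p≡α) ← q-inner (ρ-inner k) =
        trans q≡ρ (cong ρ (α-injective (trans (sym p≡α) (p-ρ k))))

      q-idem : ∀ v → q (q v) ≡ q v
      q-idem v with inner? v
      ... | yes iv = q-same (q-stays-inner iv) iv (p-q iv)
      ... | no ¬iv = trans (q-outer (λ iq → zero-outer (subst Inner (q-outer ¬iv) iq))) (sym (q-outer ¬iv))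

      η-q : ∀ v → η (q v) ≡ η v
      η-q v with inner? v
      ... | yes iv = trans (η-inner (q-stays-inner iv)) (sym (η-inner iv))
      ... | no ¬iv = trans (η-outer (λ iq → zero-outer (subst Inner (q-outer ¬iv) iq))) (sym (η-outer ¬iv))

      q-mixed : ∀ {v u} → Inner v → ¬ Inner u → q v ≢ q u
      q-mixed iv ¬iu eq = zero-outer (subst Inner (trans eq (q-outer ¬iu)) (q-stays-inner iv))

      B-same : ∀ v u → q v ≡ q u → B v u ≡ η v - 𝟙 v u
      B-same v u eq with inner? v | inner? u
      ... | yes iv | yes iu = trans (B-inner-inner iv iu)
        (trans (same-piece iv iu (trans (sym (p-q iv)) (trans (cong p eq) (p-q iu)))) (cong (_- 𝟙 v u) (sym (η-inner iv))))
      ... | no ¬iv | no ¬iu = trans (B-outer-outer ¬iv ¬iu) (cong (_- 𝟙 v u) (sym (η-outer ¬iv)))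
      ... | yes iv | no ¬iu = contradiction eq (q-mixed iv ¬iu)
      ... | no ¬iv | yes iu = contradiction (sym eq) (q-mixed iu ¬iv)

      B-different : ∀ v u → q v ≢ q u → B v u ≡ 0ℤ
      B-different v u q≢ with inner? v | inner? u
      ... | yes iv | yes iu = trans (B-inner-inner iv iu) (different-pieces iv iu (q≢ ∘ q-same iv iu))
      ... | no ¬iv | no ¬iu = contradiction (trans (q-outer ¬iv) (sym (q-outer ¬iu))) q≢
      ... | yes iv | no ¬iu = B-inner-outer iv ¬iu
      ... | no ¬iv | yes iu = B-outer-inner ¬iv iu

      open BlockDiagonalisation B q η q-idem η-q B-same B-different

      -- The block of a piece has size d - 2 and η = -1, and -(d - 2) - 1 = -(d - 1). Its size is
      -- found by summing the indicator of the fibre, which is column ρ k of 1 + K.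
      entry-ρ : ∀ k → entry (ρ k) ≡ - degree-1 D k
      entry-ρ k with fibre (∈-lookup {xs = pieces} k)
      ... | F , F⁻ , F⁺ , size = begin
        entry (ρ k)                                    ≡⟨ entry-representative (q-ρ k) ⟩
        η (ρ k) * (1ℤ + sum (λ v → K v (ρ k))) - 1ℤ    ≡⟨ cong₂ (λ a b → a * b - 1ℤ) (η-inner (ρ-inner k)) block-size ⟩
        -1ℤ * + ∣ F ∣ - 1ℤ                             ≡⟨ ring (+ ∣ F ∣) ⟩
        - ((+ 2 + + ∣ F ∣) - 1ℤ)                       ≡⟨ cong (λ a → - (a - 1ℤ)) (trans (sym (pos-+ 2 ∣ F ∣)) (cong +_ size)) ⟩
        - degree-1 D k                                 ∎
        where
        open ≡-Reasoning
        ring : ∀ a → -1ℤ * a - 1ℤ ≡ - ((+ 2 + a) - 1ℤ)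
        ring = solve-∀
        term : ∀ v → 𝟙 v (ρ k) + K v (ρ k) ≡ χ F v
        term v with v ≟ ρ k | q v ≟ ρ k
        ... | yes refl | _ = trans (cong (_+_ 1ℤ) (K-representative (q-ρ k) (ρ k))) (sym (χ-∈ (F⁺ (ρ-inner k) (p-ρ k))))
        ... | no v≢ρ | no qv≢ρ = trans (trans (+-identityˡ _) (K-elsewhere v (ρ k) qv≢ρ))
          (sym (χ-∉ λ v∈ → let (iv , eq) = F⁻ v∈ in
            qv≢ρ (trans (q-same iv (ρ-inner k) (trans eq (sym (p-ρ k)))) (q-ρ k))))
        ... | no v≢ρ | yes qv≡ρ = trans (trans (+-identityˡ _) (trans (K-other (λ qv≡v → v≢ρ (trans (sym qv≡v) qv≡ρ)) (ρ k))
            (trans (cong (λ a → 𝟙 a (ρ k)) qv≡ρ) (Δ-diagonal _ (ρ k))))) (sym (χ-∈ v∈F))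
          where
          v∈F : v ∈ F
          v∈F with inner? v
          ... | yes iv = F⁺ iv (trans (sym (p-q iv)) (trans (cong p qv≡ρ) (p-ρ k)))
          ... | no ¬iv = contradiction (subst Inner (trans (sym qv≡ρ) (q-outer ¬iv)) (ρ-inner k)) zero-outer
        block-size : 1ℤ + sum (λ v → K v (ρ k)) ≡ + ∣ F ∣
        block-size = trans (cong (_+ sum (λ v → K v (ρ k))) (sym (trans (sum-cong-≗ λ v → sym (*-identityˡ (𝟙 v (ρ k)))) (sum-𝟙ʳ (λ _ → 1ℤ) (ρ k)))))
          (trans (sym (∑-distrib-+ (λ v → 𝟙 v (ρ k)) (λ v → K v (ρ k)))) (trans (sum-cong-≗ term) (sum-χ F)))

      -- Block size 2 and η = 1 give 2 - 1: the only member besides 0 is the last vertex.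
      entry-zero : entry zero ≡ 1ℤ
      entry-zero = trans (entry-representative (q-outer zero-outer))
        (trans (cong₂ (λ a b → a * (1ℤ + b) - 1ℤ) (η-outer zero-outer) one-other) refl)
        where
        others : ∀ v → v ≢ last → K v zero ≡ 0ℤ
        others v v≢last with v ≟ zero
        ... | yes refl = K-representative (q-outer zero-outer) zero
        ... | no v≢0   = K-elsewhere v zero λ qv≡0 → zero-outer (subst Inner qv≡0 (q-stays-inner (∈⊤ , v≢0 , v≢last)))
        one-other : sum (λ v → K v zero) ≡ 1ℤ
        one-other = trans (sum-single (λ v → K v zero) last others)
          (trans (K-other (λ q≡ → 0≢last (trans (sym (q-outer last-outer)) q≡)) zero)
                 (cong (λ a → 𝟙 a zero) (q-outer last-outer)))

      extension = extend-injection ρ ρ-injective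

      σ : Permutation (suc n) (suc n)
      σ = proj₁ extension

      m≤ : m ≤ suc n
      m≤ = injective⇒≤ {f = ρ} ρ-injective

      position : Fin m → Fin (suc n)
      position k = fromℕ< (ℕ.<-≤-trans (toℕ<n k) m≤)

      σ-position : ∀ k → σ ⟨$⟩ʳ position k ≡ ρ k
      σ-position k = trans (proj₂ extension (position k) k<) (cong ρ (trans (fromℕ<-cong₂ _ (toℕ-fromℕ< _) k< (toℕ<n k)) (fromℕ<-toℕ k _)))
        where
        k< : toℕ (position k) ℕ.< m
        k< = subst (ℕ._< m) (sym (toℕ-fromℕ< _)) (toℕ<n k)
        fromℕ<-cong₂ : ∀ {i} j → i ≡ j → (i< : i ℕ.< m) (j< : j ℕ.< m) → fromℕ< i< ≡ fromℕ< j<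
        fromℕ<-cong₂ j refl i< j< = refl

      -- Every diagonal entry except that of vertex 0 is negative. The polygon has n + 1 vertices
      -- here, so n minus signs remain.
      sign : Vector ℤ (suc n)
      sign zero    = 1ℤ
      sign (suc v) = -1ℤ

      sign-nonzero : ∀ {v} → v ≢ zero → sign v ≡ -1ℤ
      sign-nonzero {zero}  0≢0 = contradiction refl 0≢0
      sign-nonzero {suc v} _   = refl

      diagonal-small : ∀ i (i<m : toℕ i ℕ.< m) → diagonalEntries D i ≡ degree-1 D (fromℕ< i<m)
      diagonal-small i i<m with toℕ i ℕ.<? m
      ... | yes _    = refl
      ... | no i≮m   = contradiction i<m i≮m

      diagonal-large : ∀ i → m ≤ toℕ i → diagonalEntries D i ≡ 1ℤ
      diagonal-large i m≤i with toℕ i ℕ.<? m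
      ... | yes i<m = contradiction i<m (ℕ.≤⇒≯ m≤i)
      ... | no _    = refl

      -- Below m the vertex is the representative of a piece. From m on it is either 0, with entry
      -- 1, or not a representative, since every ρ k sits below m; its entry is then -1.
      entry-σ : ∀ i → entry (σ ⟨$⟩ʳ i) ≡ sign (σ ⟨$⟩ʳ i) * diagonalEntries D i
      entry-σ i with toℕ i ℕ.<? m
      ... | yes i<m rewrite proj₂ extension i i<m = trans (entry-ρ (fromℕ< i<m))
        (trans (ring (degree-1 D (fromℕ< i<m))) (sym (cong (_* degree-1 D (fromℕ< i<m)) (sign-nonzero (proj₁ (proj₂ (ρ-inner (fromℕ< i<m))))))))
        where
        ring : ∀ a → - a ≡ -1ℤ * a
        ring = solve-∀
      ... | no i≮m with σ ⟨$⟩ʳ i ≟ zero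
      ...   | yes σi≡0 = trans (cong entry σi≡0) (trans entry-zero (sym (trans (*-identityʳ _) (cong sign σi≡0))))
      ...   | no σi≢0 = trans (entry-other not-fixed) (sym (trans (*-identityʳ _) (sign-nonzero σi≢0)))
        where
        not-fixed : q (σ ⟨$⟩ʳ i) ≢ σ ⟨$⟩ʳ i
        not-fixed fixed with inner? (σ ⟨$⟩ʳ i)
        ... | no ¬iv = σi≢0 (trans (sym fixed) (q-outer ¬iv))
        ... | yes iv with (k , q≡ρ , _) ← q-inner iv = i≮m (subst (λ j → toℕ j ℕ.< m)
          (σ-injective σ (trans (σ-position k) (trans (sym q≡ρ) fixed)))
          (subst (ℕ._< m) (sym (toℕ-fromℕ< _)) (toℕ<n k)))

      diagonalised : left ⊗ (U ⊗ walkMatrix D ⊗ V) ⊗ right ≋ Δ entry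
      diagonalised = ≋-trans (⊗-cong (⊗-cong (≋-refl {A = left})
        (⊗-cong (⊗-cong (≋-refl {A = U}) walkMatrix≋M) (≋-refl {A = V}))) (≋-refl {A = right})) diagonalise

      det-unchanged : ∀ {P Q : Matrix (suc n)} A → Unimodular P → Unimodular Q → det (P ⊗ A ⊗ Q) ≡ det A
      det-unchanged {P} {Q} A u v = begin
        det (P ⊗ A ⊗ Q)            ≡⟨ det-⊗ (P ⊗ A) Q ⟩
        det (P ⊗ A) * det Q        ≡⟨ cong₂ _*_ (det-⊗ P A) (Unimodular.det-one v) ⟩
        det P * det A * 1ℤ         ≡⟨ cong (λ d → d * det A * 1ℤ) (Unimodular.det-one u) ⟩
        1ℤ * det A * 1ℤ            ≡⟨ ring (det A) ⟩
        det A                      ∎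
        where
        open ≡-Reasoning
        ring : ∀ a → 1ℤ * a * 1ℤ ≡ a
        ring = solve-∀

      product-sign : product sign ≡ -1ℤ ^ n
      product-sign = trans (*-identityˡ _) (power n)
        where
        power : ∀ k → product {k} (λ _ → -1ℤ) ≡ -1ℤ ^ k
        power zero    = refl
        power (suc k) = cong (-1ℤ *_) (power k)

    walkMatrix-symmetric : IsSymmetric (walkMatrix D)
    walkMatrix-symmetric i j = trans (walkMatrix≋M i j) (trans (M-symmetric i j) (sym (walkMatrix≋M j i)))

    -- The reordering by σ is done on the product of the diagonal entries, where it costs no sign,
    -- rather than by permutation matrices.
    walkMatrix-det : det (walkMatrix D) ≡ -1ℤ ^ n * product (degree-1 D)
    walkMatrix-det = begin
      det (walkMatrix D)                                      ≡⟨ det-unchanged (walkMatrix D) unimodular unimodularᵀ ⟨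
      det (U ⊗ walkMatrix D ⊗ V)                              ≡⟨ det-unchanged (U ⊗ walkMatrix D ⊗ V) left-unimodular right-unimodular ⟨
      det (left ⊗ (U ⊗ walkMatrix D ⊗ V) ⊗ right)             ≡⟨ det-cong diagonalised ⟩
      det (Δ entry)                                           ≡⟨ det-Δ entry ⟩
      product entry                                           ≡⟨ product-permute entry σ ⟩
      product (λ i → entry (σ ⟨$⟩ʳ i))                        ≡⟨ product-cong entry-σ ⟩
      product (λ i → sign (σ ⟨$⟩ʳ i) * diagonalEntries D i)   ≡⟨ product-distrib-* (λ i → sign (σ ⟨$⟩ʳ i)) (diagonalEntries D) ⟩
      product (λ i → sign (σ ⟨$⟩ʳ i)) * product (diagonalEntries D)
        ≡⟨ cong₂ _*_ (trans (sym (product-permute sign σ)) product-sign)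
                     (product-truncate (diagonalEntries D) (degree-1 D) m≤ diagonal-small diagonal-large) ⟩
      -1ℤ ^ n * product (degree-1 D)                          ∎
      where open ≡-Reasoning

    walkMatrix-smith : ∃₂ λ (P Q : Matrix (suc n)) → InGL P × InGL Q × P ⊗ walkMatrix D ⊗ Q ≋ Δ (diagonalEntries D)
    walkMatrix-smith = P , Q , P-inGL , Q-inGL , ≋-trans rearranged (λ i j → trans (permute-entries σ (Δ entry ⊗ Δ sign) i j)
      (trans (Δ-⊗ entry sign (σ ⟨$⟩ʳ i) (σ ⟨$⟩ʳ j)) (trans (permute-Δ σ (λ v → entry v * sign v) i j) (entries i j))))
      where
      P Q : Matrix (suc n)
      P = rows σ ⊗ (left ⊗ U)
      -- `Δ sign` turns the negative diagonal entries positive. It has determinant (-1)^n, so it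
      -- enters the normal form but not the determinant computation.
      Q = V ⊗ right ⊗ (Δ sign ⊗ columns σ)

      sign²≡1 : ∀ v → sign v * sign v ≡ 1ℤ
      sign²≡1 zero    = refl
      sign²≡1 (suc v) = refl

      P-inGL : InGL P
      P-inGL = inGL-⊗ {A = rows σ} {left ⊗ U} (rows-inGL σ)
        (inGL-⊗ {A = left} {U} (Unimodular.inGL left-unimodular) (Unimodular.inGL unimodular))

      Q-inGL : InGL Q
      Q-inGL = inGL-⊗ {A = V ⊗ right} {Δ sign ⊗ columns σ}
        (inGL-⊗ {A = V} {right} (Unimodular.inGL unimodularᵀ) (Unimodular.inGL right-unimodular))
        (inGL-⊗ {A = Δ sign} {columns σ} (Δ-sign-inGL sign sign²≡1) (columns-inGL σ))

      rearranged : P ⊗ walkMatrix D ⊗ Q ≋ rows σ ⊗ (Δ entry ⊗ Δ sign) ⊗ columns σ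
      rearranged = ≋-trans (sandwich (rows σ) (left ⊗ U) (walkMatrix D) (V ⊗ right) (Δ sign ⊗ columns σ))
        (≋-trans (⊗-cong (⊗-cong (≋-refl {A = rows σ}) (≋-trans (sandwich left U (walkMatrix D) V right) diagonalised))
                         (≋-refl {A = Δ sign ⊗ columns σ}))
        (≋-trans (≋-sym (⊗-assoc (rows σ ⊗ Δ entry) (Δ sign) (columns σ)))
                 (⊗-cong (⊗-assoc (rows σ) (Δ entry) (Δ sign)) (≋-refl {A = columns σ}))))

      entries : Δ (λ i → entry (σ ⟨$⟩ʳ i) * sign (σ ⟨$⟩ʳ i)) ≋ Δ (diagonalEntries D)
      entries i j with i ≟ j
      ... | no _  = refl
      ... | yes _ = trans (cong (_* sign (σ ⟨$⟩ʳ i)) (entry-σ i)) (trans (ring (sign (σ ⟨$⟩ʳ i)) (diagonalEntries D i))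
        (trans (cong (_* diagonalEntries D i) (sign²≡1 (σ ⟨$⟩ʳ i))) (*-identityˡ _)))
        where
        ring : ∀ a b → a * b * a ≡ a * a * b
        ring = solve-∀

  module _ {n : ℕ} (3≤ : 3 ≤ suc n) (D : Dissection (suc n)) where
    open Dissection D

    private
      subdivision : ∃ λ L → Subdivision diagonals ⊤ zero (fromℕ n) L × cutAlong diagonals ↭ L
      subdivision = subdivide 3≤ diagonals noncrossing

      L↭pieces : proj₁ subdivision ↭ pieces
      L↭pieces = ↭-sym (↭-trans enumerates (proj₂ (proj₂ subdivision)))

    1≤n : 1 ≤ n
    1≤n = ℕ.≤-trans (s≤s z≤n) (ℕ.s≤s⁻¹ 3≤)

    dissection-reduction : Reduction ⊤ zero (fromℕ n) pieces
    dissection-reduction = reduction-↭ L↭pieces (reduction ∈⊤ ∈⊤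
      (subst (0 ℕ.<_) (sym (toℕ-fromℕ n)) 1≤n)
      (λ {v} _ → z≤n , subst (toℕ v ≤_) (sym (toℕ-fromℕ n)) (ℕ.s≤s⁻¹ (toℕ<n v)))
      (proj₁ (proj₂ subdivision)))

    pieces-large : All (Piece ⊤) pieces
    pieces-large = All-resp-↭ L↭pieces (pieces-of (proj₁ (proj₂ subdivision)))

open import Data.Integer using (-1ℤ; _*_; _^_)
open import Data.Nat using (ℕ; suc; _≤_; _∸_)
open import Data.Product using (_×_; _,_; ∃₂)
open import Relation.Binary.PropositionalEquality using (_≡_)

theorem2p3 : (n : ℕ) → 3 ≤ n → (D : Dissection n) →
    IsSymmetric (walkMatrix D)
    × det (walkMatrix D) ≡ -1ℤ ^ (n ∸ 1) * product (degree-1 D)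
    × ∃₂ λ (U V : Matrix n) → InGL U × InGL V × U ⊗ walkMatrix D ⊗ V ≋ Δ (diagonalEntries D)
theorem2p3 (suc n) 3≤n D = T.walkMatrix-symmetric , T.walkMatrix-det , T.walkMatrix-smith
  where
  module T = WalkMatrices.Theorem D (WalkMatrices.1≤n 3≤n D)
               (WalkMatrices.dissection-reduction 3≤n D) (WalkMatrices.pieces-large 3≤n D)
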